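{- Let $n\ge 2$ be an integer and let $D$ be the set of positive divisors of $n$. Let $G=\langle a\rangle$ be a cyclic group of order $n$ and let $S=\{a^{i} : i\in B(1,n)\}$, where $B(1,n)=\{t\in\mathbb{N} : 1\le t\le n,\ \gcd(t,n)=1\}$. Let $X=\{d\in D : p^{2}\mid d \text{ for some prime } p\}$, and let $d_1,\ldots,d_t$ be the distinct elements of $D\setminus (X\cup\{1\})$. For a square-free divisor $d\in D$ with exactly $k$ prime factors put $F(d)=(-1)^{k}\,\phi(n)/\phi(d)$. Then the spectrum of the Cayley graph $X_S(G)$ is $$\mathrm{spec}(X_S(G))=\Big[\phi(n)^{1},\ 0^{\sum_{x\in X}\phi(x)},\ F(d_1)^{\phi(d_1)},\ldots,F(d_t)^{\phi(d_t)}\Big].$$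
   Context: $\phi$ denotes Euler's totient function. For a finite group $G$ and a subset $S\subseteq G$ closed under inverses and not containing the identity, the Cayley graph $X_S(G)$ is the simple undirected graph with vertex set $G$ in which $g_1$ and $g_2$ are adjacent iff $g_1g_2^{ -1}\in S$. The spectrum of a graph is the multiset of eigenvalues of its $0/1$ adjacency matrix. The notation $[\lambda_1^{n_1},\ldots,\lambda_r^{n_r}]$ denotes the multiset in which each listed $\lambda_j$ contributes $n_j$ copies. The listed values need not be pairwise distinct (contributions of equal values add up), and an entry with exponent $0$ contributes nothing (so the entry $0$ is absent when $X=\emptyset$). -}

module Defs where

open import Level using (Level; _⊔_; 0ℓ) renaming (suc to lsuc)
open import Algebra.Bundles using (Group)
open import Algebra.Bundles.Raw using (RawRing)
import Algebra.Definitions.RawSemiring as RawSemiringDefs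
import Algebra.Definitions.RawMonoid as RawMonoidDefs
import Algebra.Properties.Group as GroupProperties
import Algebra.Properties.Monoid.Mult as MonoidMult
open import Data.Bool using (if_then_else_)
open import Data.Fin as Fin using (Fin; toℕ; punchIn; fromℕ<)
import Data.Fin.Properties as Fin
open import Data.Integer as ℤ using (ℤ; +_; -[1+_]; -1ℤ)
open import Data.List using (List; []; _∷_; map; foldr; filter; length; concatMap; replicate; upTo)
open import Data.List.Membership.Propositional using (_∈_; find; lose)
open import Data.List.Membership.Propositional.Properties
  using (∈-filter⁺; ∈-filter⁻; ∈-map⁺; ∈-map⁻; ∈-upTo⁺; ∈-upTo⁻)
open import Data.List.Relation.Unary.Any using (any?)
open import Data.Nat as ℕ using (ℕ; zero; suc; _≤_; _<_; _∸_; s≤s; z≤n; NonZero; _%_)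
import Data.Nat.Properties as ℕ
open import Data.Nat.Divisibility using (_∣_; _∣?_; ∣-trans; m∣m*n; ∣⇒≤; _∣0; ∣-refl; ∣m+n∣m⇒∣n; ∣1⇒≡1)
open import Data.Nat.DivMod using (m≡m%n+[m/n]*n; m%n<n; _/_)
open import Data.Nat.GCD using (gcd; gcd[m,n]∣m; gcd[m,n]∣n; gcd-greatest; gcd-zeroˡ)
open import Data.Nat.Primality using (Prime; prime?; prime[2])
open import Data.Product using (_×_; _,_; ∃-syntax; proj₁; proj₂)
open import Data.Rational as ℚ using (ℚ; 0ℚ; 1ℚ)
open import Function.Bundles using (Inverse)
open import Relation.Binary using (Setoid; Decidable; Symmetric; _Respects_; _Respects₂_)
open import Relation.Binary.PropositionalEquality as ≡ using (_≡_; refl; sym; trans; cong; subst)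
open import Relation.Nullary using (¬_; yes; ¬?; _×-dec_; ⌊_⌋)
open import Relation.Nullary.Decidable using (map′)
open import Relation.Unary using (Pred) renaming (Decidable to Decidable₁)

private variable
  c ℓ s : Level

-- B d n lists the t with 1 ≤ t ≤ n and gcd(t , n) = d.
B : ℕ → ℕ → List ℕ
B d n = filter (λ t → gcd t n ℕ.≟ d) (map suc (upTo n))

φ : ℕ → ℕ
φ n = length (B 1 n)

∈B⁺ : ∀ {d t n} → 1 ≤ t → t ≤ n → gcd t n ≡ d → t ∈ B d n
∈B⁺ {n = n} (s≤s _) t≤n eq = ∈-filter⁺ (λ t → gcd t n ℕ.≟ _) (∈-map⁺ suc (∈-upTo⁺ t≤n)) eq

∈B⁻ : ∀ {d t n} → t ∈ B d n → 1 ≤ t × t ≤ n × gcd t n ≡ d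
∈B⁻ {d} {n = n} t∈B with ∈-filter⁻ (λ t → gcd t n ℕ.≟ d) {xs = map suc (upTo n)} t∈B
... | t∈ , eq with ∈-map⁻ suc {xs = upTo n} t∈
... | _ , u∈ , refl = s≤s z≤n , ∈-upTo⁻ u∈ , eq

φ-nonZero : ∀ n → .{{NonZero n}} → NonZero (φ n)
φ-nonZero n = length-nonZero (∈B⁺ ℕ.≤-refl (ℕ.>-nonZero⁻¹ n) (gcd-zeroˡ n))
  where
  length-nonZero : ∀ {t} {ts : List ℕ} → t ∈ ts → NonZero (length ts)
  length-nonZero {ts = _ ∷ _} _ = _

divisors : ℕ → List ℕ
divisors n = filter (_∣? n) (map suc (upTo n))

NonSquareFree : Pred ℕ 0ℓ
NonSquareFree d = ∃[ p ] Prime p × p ℕ.^ 2 ∣ d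

nonSquareFree? : Decidable₁ NonSquareFree
nonSquareFree? zero = yes (2 , prime[2] , (4 ∣0))
nonSquareFree? d@(suc _) = map′ (λ (p , _ , h) → p , h) bound
  (ℕ.anyUpTo? (λ p → prime? p ×-dec (p ℕ.^ 2 ∣? d)) (suc d))
  where
  bound : NonSquareFree d → ∃[ p ] p < suc d × Prime p × p ℕ.^ 2 ∣ d
  bound (p , pr , p²∣d) = p , s≤s (∣⇒≤ (∣-trans (m∣m*n (p ℕ.^ 1)) p²∣d)) , pr , p²∣d

X : ℕ → List ℕ
X n = filter nonSquareFree? (divisors n)

-- The elements of D ∖ (X ∪ {1}); `divisors` has no repetitions.
squareFreeDivisors≢1 : ℕ → List ℕ
squareFreeDivisors≢1 n = filter (λ d → ¬? (nonSquareFree? d) ×-dec ¬? (d ℕ.≟ 1)) (divisors n)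

-- The number of distinct prime factors, which for square-free d is the
-- number of prime factors.
ω : ℕ → ℕ
ω d = length (filter prime? (divisors d))

-- The value at d = 0 is a placeholder: F n is only applied to divisors of n,
-- and `divisors` lists positive numbers only.
F : ℕ → ℕ → ℚ
F n zero      = 0ℚ
F n d@(suc _) = ((-1ℤ ℤ.^ ω d ℤ.* (+ φ n)) ℚ./ φ d) {{φ-nonZero d}}

-- Polynomials over ℚ: lists of coefficients, lowest degree first, with
-- trailing zeros ignored by the equality.

Poly : Set
Poly = List ℚ

coeff : Poly → ℕ → ℚ
coeff []      _       = 0ℚ
coeff (a ∷ p) zero    = a
coeff (a ∷ p) (suc i) = coeff p i

infix  4 _≈ₚ_
infixl 6 _+ₚ_
infixl 7 _*ₚ_
infix  8 -ₚ_

_≈ₚ_ : Poly → Poly → Set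
p ≈ₚ q = ∀ i → coeff p i ≡ coeff q i

_+ₚ_ : Poly → Poly → Poly
[]      +ₚ q       = q
(a ∷ p) +ₚ []      = a ∷ p
(a ∷ p) +ₚ (b ∷ q) = (a ℚ.+ b) ∷ (p +ₚ q)

-ₚ_ : Poly → Poly
-ₚ_ = map (λ a → ℚ.- a)

_*ₚ_ : Poly → Poly → Poly
[]      *ₚ q = []
(a ∷ p) *ₚ q = map (a ℚ.*_) q +ₚ (0ℚ ∷ (p *ₚ q))

constₚ : ℚ → Poly
constₚ a = a ∷ []

varₚ : Poly
varₚ = 0ℚ ∷ 1ℚ ∷ []

ℚ[x] : RawRing 0ℓ 0ℓ
ℚ[x] = record
  { Carrier = Poly ; _≈_ = _≈ₚ_ ; _+_ = _+ₚ_ ; _*_ = _*ₚ_ ; -_ = -ₚ_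
  ; 0# = [] ; 1# = constₚ 1ℚ }

Matrix : Set c → ℕ → Set c
Matrix A n = Fin n → Fin n → A

module Determinant (R : RawRing c ℓ) where
  open RawRing R
  open RawSemiringDefs rawSemiring using (_^_) renaming (sum to ∑)

  -- Laplace expansion along the first row.
  det : ∀ {n} → Matrix Carrier n → Carrier
  det {zero}  M = 1#
  det {suc n} M = ∑ λ j →
    (- 1#) ^ toℕ j * (M Fin.zero j * det (λ i k → M (Fin.suc i) (punchIn j k)))

-- det (x I − M)
charPoly : ∀ {n} → Matrix ℚ n → Poly
charPoly M = Determinant.det ℚ[x] λ i j →
  (if ⌊ i Fin.≟ j ⌋ then varₚ else []) +ₚ -ₚ constₚ (M i j)

-- L lists, with multiplicity, all eigenvalues of M: the characteristic
-- polynomial is the product of the x − λ for λ in L.  In particular M has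
-- then no eigenvalue outside ℚ in any larger field.
IsSpectrum : ∀ {n} → Matrix ℚ n → List ℚ → Set
IsSpectrum M L = charPoly M ≈ₚ foldr _*ₚ_ (constₚ 1ℚ) (map (λ e → varₚ +ₚ -ₚ constₚ e) L)

-- The multiset [λ₁^n₁, …, λᵣ^nᵣ].
multiset : List (ℚ × ℕ) → List ℚ
multiset = concatMap (λ (e , m) → replicate m e)

record SimpleGraph (V : Setoid c ℓ) (s : Level) : Set (c ⊔ ℓ ⊔ lsuc s) where
  open Setoid V using (Carrier; _≈_)
  field
    Adj        : Carrier → Carrier → Set s
    Adj-resp   : Adj Respects₂ _≈_
    Adj-sym    : Symmetric Adj
    Adj-irrefl : ∀ v → ¬ Adj v v

-- Rows and columns are indexed through an enumeration of the vertices.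
adjacencyMatrix : ∀ {n} {V : Setoid c ℓ} (Γ : SimpleGraph V s) →
                  Decidable (SimpleGraph.Adj Γ) →
                  Inverse (≡.setoid (Fin n)) V → Matrix ℚ n
adjacencyMatrix Γ adj? enum i j = if ⌊ adj? (to i) (to j) ⌋ then 1ℚ else 0ℚ
  where open Inverse enum

module _ (G : Group c ℓ) where
  open Group G using (Carrier; _≈_; _∙_; ε; _⁻¹; setoid; rawMonoid)
  private module G = Group G
  open GroupProperties G using (⁻¹-anti-homo-∙; ⁻¹-involutive; inverseʳ-unique; ∙-cancelˡ)
  open MonoidMult G.monoid using (×-homo-+; ×-assocˡ; ×-congˡ; ×-congʳ)

  cayleyGraph : (S : Pred Carrier s) → S Respects _≈_ →
                (∀ {g} → S g → S (g ⁻¹)) → ¬ S ε → SimpleGraph setoid s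
  cayleyGraph S resp inv no-ε = record
    { Adj        = λ g h → S (g ∙ h ⁻¹)
    ; Adj-resp   = (λ h≈h′ → resp (G.∙-congˡ (G.⁻¹-cong h≈h′)))
                 , (λ g≈g′ → resp (G.∙-congʳ g≈g′))
    ; Adj-sym    = λ {g} {h} gh → resp
        (G.trans (⁻¹-anti-homo-∙ g (h ⁻¹)) (G.∙-congʳ (⁻¹-involutive h))) (inv gh)
    ; Adj-irrefl = λ g gg → no-ε (resp (G.inverseʳ g) gg)
    }

  infixr 8 _^_ _^ℤ_

  -- The library's n-fold product, in multiplicative notation.
  _^_ : Carrier → ℕ → Carrier
  g ^ k = RawMonoidDefs._×_ rawMonoid k g

  _^ℤ_ : Carrier → ℤ → Carrier
  g ^ℤ (+ k)    = g ^ k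
  g ^ℤ -[1+ k ] = (g ^ suc k) ⁻¹

  record IsCyclicOfOrder (a : Carrier) (n : ℕ) : Set (c ⊔ ℓ) where
    field
      generates   : ∀ g → ∃[ k ] g ≈ a ^ℤ k
      enumeration : Inverse (≡.setoid (Fin n)) setoid

  module Unitary {a : Carrier} {n : ℕ} (2≤n : 2 ≤ n) (cyc : IsCyclicOfOrder a n) where
    open IsCyclicOfOrder cyc
    open Inverse enumeration

    -- The set {aⁱ : i ∈ B(1,n)}.
    S : Pred Carrier ℓ
    S g = ∃[ i ] i ∈ B 1 n × g ≈ a ^ i

    S-resp : S Respects _≈_
    S-resp g≈h (i , i∈B , g≈aⁱ) = i , i∈B , G.trans (G.sym g≈h) g≈aⁱ

    from-injective : ∀ {g h} → from g ≡ from h → g ≈ h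
    from-injective {g} {h} eq =
      G.trans (G.sym (inverseˡ refl)) (inverseˡ eq)

    ∈B⇒< : ∀ {t} → t ∈ B 1 n → t < n
    ∈B⇒< t∈B with ∈B⁻ {1} {n = n} t∈B
    ... | _ , t≤n , eq = ℕ.≤∧≢⇒< t≤n λ { refl →
      ℕ.<⇒≢ 2≤n (sym (∣1⇒≡1 (subst (n ∣_) eq (gcd-greatest ∣-refl ∣-refl)))) }

    ε^ : ∀ k → ε ^ k ≈ ε
    ε^ zero    = G.refl
    ε^ (suc k) = G.trans (G.identityˡ _) (ε^ k)

    -- If aᵐ ≈ ε with m ≥ 1, every element is some aʳ with r < m, so n ≤ m.
    module _ {m} .{{_ : NonZero m}} (aᵐ≈ε : a ^ m ≈ ε) where

      a^*m : ∀ q → a ^ (q ℕ.* m) ≈ ε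
      a^*m q = G.trans (G.sym (×-assocˡ a q m)) (G.trans (×-congʳ q aᵐ≈ε) (ε^ q))

      reduce : ∀ k → a ^ k ≈ a ^ (k % m)
      reduce k = G.trans (×-congˡ (m≡m%n+[m/n]*n k m))
        (G.trans (×-homo-+ a (k % m) _)
        (G.trans (G.∙-congˡ (a^*m (k / m))) (G.identityʳ _)))

      neg : ∀ k → k ≤ m → (a ^ k) ⁻¹ ≈ a ^ (m ∸ k)
      neg k k≤m = G.sym (inverseʳ-unique (a ^ k) (a ^ (m ∸ k))
        (G.trans (G.sym (×-homo-+ a k (m ∸ k)))
        (G.trans (×-congˡ (ℕ.m+[n∸m]≡n k≤m)) aᵐ≈ε)))

      residue : ∀ g → ∃[ r ] g ≈ a ^ toℕ {m} r
      residue g with generates g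
      ... | + k , g≈ = fromℕ< (m%n<n k m) , G.trans g≈
        (G.trans (reduce k) (×-congˡ (sym (Fin.toℕ-fromℕ< (m%n<n k m)))))
      ... | -[1+ k ] , g≈ = fromℕ< (m%n<n k′ m) , G.trans g≈
        (G.trans (G.⁻¹-cong (reduce (suc k)))
        (G.trans (neg (suc k % m) (ℕ.<⇒≤ (m%n<n (suc k) m)))
        (G.trans (reduce k′) (×-congˡ (sym (Fin.toℕ-fromℕ< (m%n<n k′ m)))))))
        where k′ = m ∸ suc k % m

      n≤m : n ≤ m
      n≤m = Fin.injective⇒≤ {f = λ i → proj₁ (residue (to i))} λ {i} {j} eq →
        trans (sym (inverseʳ G.refl)) (trans (from-cong
          (G.trans (proj₂ (residue (to i))) (G.trans (×-congˡ (cong toℕ eq))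
            (G.sym (proj₂ (residue (to j))))))) (inverseʳ G.refl))

    aⁿ≈ε : a ^ n ≈ ε
    aⁿ≈ε with Fin.pigeonhole (ℕ.n<1+n n) (λ i → from (a ^ toℕ i))
    ... | i , j , i<j , eq = subst (λ k → a ^ k ≈ ε) d≡n aᵈ≈ε
      where
      d = toℕ j ∸ toℕ i
      instance
        d≢0 : NonZero d
        d≢0 = ℕ.>-nonZero (ℕ.m<n⇒0<n∸m i<j)
      aᵈ≈ε : a ^ d ≈ ε
      aᵈ≈ε = ∙-cancelˡ (a ^ toℕ i) _ _
        (G.trans (G.sym (×-homo-+ a (toℕ i) d))
        (G.trans (×-congˡ (ℕ.m+[n∸m]≡n (ℕ.<⇒≤ i<j)))
        (G.trans (G.sym (from-injective eq)) (G.sym (G.identityʳ _)))))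
      d≡n : d ≡ n
      d≡n = ℕ.≤-antisym
        (ℕ.≤-trans (ℕ.m∸n≤m (toℕ j) (toℕ i)) (ℕ.≤-pred (Fin.toℕ<n j)))
        (n≤m aᵈ≈ε)

    S-no-ε : ¬ S ε
    S-no-ε (i , i∈B , ε≈aⁱ) = ℕ.<⇒≱ (∈B⇒< i∈B)
      (n≤m {{ℕ.>-nonZero (proj₁ (∈B⁻ {1} {n = n} i∈B))}} (G.sym ε≈aⁱ))

    S-inv : ∀ {g} → S g → S (g ⁻¹)
    S-inv (i , i∈B , g≈aⁱ) = n ∸ i
      , ∈B⁺ (ℕ.m<n⇒0<n∸m i<n) (ℕ.m∸n≤m n i) (∣1⇒≡1 (subst (gcd (n ∸ i) n ∣_) eq
          (gcd-greatest d∣i (gcd[m,n]∣n (n ∸ i) n))))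
      , G.trans (G.⁻¹-cong g≈aⁱ) (neg {{ℕ.>-nonZero (ℕ.<⇒≤ 2≤n)}} aⁿ≈ε i (ℕ.<⇒≤ i<n))
      where
      i<n = ∈B⇒< i∈B
      eq  = proj₂ (proj₂ (∈B⁻ {1} {n = n} i∈B))
      d∣i : gcd (n ∸ i) n ∣ i
      d∣i = ∣m+n∣m⇒∣n (subst (gcd (n ∸ i) n ∣_) (sym (ℕ.m∸n+n≡m (ℕ.<⇒≤ i<n)))
        (gcd[m,n]∣n (n ∸ i) n)) (gcd[m,n]∣m (n ∸ i) n)

    graph : SimpleGraph setoid ℓ
    graph = cayleyGraph S S-resp S-inv S-no-ε

    S? : Decidable₁ S
    S? g = map′ find (λ (_ , i∈B , g≈aⁱ) → lose i∈B g≈aⁱ)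
      (any? (λ i → map′ from-injective from-cong (from g Fin.≟ from (a ^ i))) (B 1 n))

    A : Matrix ℚ n
    A = adjacencyMatrix graph (λ g h → S? (g ∙ h ⁻¹)) enumeration

{-# OPTIONS --safe #-}
module Submission where

-- The rationals contain no roots of unity, so A is diagonalised by rational
-- matrices built along the prime factorisation of n.  Write C(n) for the matrix
-- whose entry at a pair of residues modulo n says whether their difference is
-- prime to n, and J for the p × p all-ones matrix, p prime.  Up to relabelling
-- residues, C(p m) is (J − I) ⊗ C(m) if p ∤ m, and J ⊗ C(m) if p ∣ m.  The
-- eigenvalues of J − I are p − 1, once, and −1, p − 1 times; those of J are p,
-- once, and 0.  The multiset of the μ(d) φ(n) / φ(d), each taken φ(d) times, d
-- running through the divisors of n, satisfies the same recursion.  A relation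
-- L A R = diagonal with L R = I determines det (x I − A), because determinants
-- are multiplicative.

open import Defs

-- Determinants are given by Laplace expansion, which hides multiplicativity. It is obtained from
-- uniqueness: a form that is linear and alternating in the rows is the determinant times its value
-- at the identity, so no sums over permutations occur. Multisets of eigenvalues are not compared as
-- lists. Such a multiset is represented by the sums over it of an arbitrary function `g` into a
-- commutative monoid; a step of the recursion multiplies eigenvalues by a rational `w`, which
-- merely replaces `g` by `λ v → g (w ℚ.* v)`, and the characteristic polynomial is the case of e ↦
-- x - e in the multiplicative monoid of ℚ[x]. When p ∣ m, the (p - 1) m zeros coming from J have to
-- be matched with the divisors of p m that do not divide m: each of these is divisible by p², and
-- their total weight follows from the identity that the φ(d), d ∣ n, add up to n. Rows may be
-- labelled by any system of residues, so relabelling is absorbed in the labels and a matrix is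
-- permuted only once, on reaching the group.

module Determinants where

  open import Algebra.Bundles using (CommutativeRing)
  open import Algebra.Bundles.Raw using (module RawRing)
  import Algebra.Properties.Ring
  import Algebra.Properties.Semiring.Sum
  import Algebra.Definitions.RawSemiring as RawSemiringDefs
  import Algebra.Properties.CommutativeSemigroup
  open import Level using (_⊔_)
  open import Data.Fin using (Fin; zero; suc; toℕ; punchIn)
  open import Data.Nat using (ℕ; zero; suc)
  open import Data.Product using (_×_; _,_; proj₁; proj₂)
  open import Data.Unit.Polymorphic using (⊤)
  open import Data.Vec.Functional using (Vector; _∷_; insertAt; removeAt)
  open import Relation.Binary.PropositionalEquality as ≡ using (_≡_; _≢_)
  open import Relation.Nullary using (contradiction)
  import Relation.Binary.Reasoning.Setoid

  -- Alternating forms and multiplicativity of the determinant.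

  module DeterminantTheory {c ℓ} (R : CommutativeRing c ℓ) where
    open CommutativeRing R hiding (zero)
    open Algebra.Properties.Ring ring
      using (-‿distribˡ-*; -‿distribʳ-*; -‿involutive; -0#≈0#) renaming (+-inverseʳ-unique to inverseʳ-unique)
    open Algebra.Properties.Semiring.Sum semiring
      using (sum-cong-≋; ∑-distrib-+; ∑-comm; *-distribˡ-sum; *-distribʳ-sum; sum-replicate-zero)
    open RawSemiringDefs (RawRing.rawSemiring rawRing) using () renaming (sum to ∑; product to ∏; _^_ to _^ᵣ_)
    open Determinant rawRing using (det)
    open Relation.Binary.Reasoning.Setoid setoid
    private
      module *C = Algebra.Properties.CommutativeSemigroup *-commutativeSemigroup

    infix 4 _≋_
    _≋_ : ∀ {k n} → (M N : Fin k → Vector Carrier n) → Set ℓ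
    M ≋ N = ∀ i j → M i j ≈ N i j

    ∑-zero : ∀ {n} {f : Vector Carrier n} → (∀ i → f i ≈ 0#) → ∑ f ≈ 0#
    ∑-zero {n} f≈0 = trans (sum-cong-≋ f≈0) (sum-replicate-zero n)

    δ : ∀ {n} → Matrix Carrier n
    δ zero    zero    = 1#
    δ zero    (suc j) = 0#
    δ (suc i) zero    = 0#
    δ (suc i) (suc j) = δ i j

    δ-refl : ∀ {n} (i : Fin n) → δ i i ≡ 1#
    δ-refl zero    = ≡.refl
    δ-refl (suc i) = δ-refl i

    δ-≢ : ∀ {n} {i j : Fin n} → i ≢ j → δ i j ≡ 0#
    δ-≢ {i = zero}  {zero}  i≢j = contradiction ≡.refl i≢j
    δ-≢ {i = zero}  {suc j} i≢j = ≡.refl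
    δ-≢ {i = suc i} {zero}  i≢j = ≡.refl
    δ-≢ {i = suc i} {suc j} i≢j = δ-≢ λ eq → i≢j (≡.cong suc eq)

    ∑-δˡ : ∀ {n} i (f : Vector Carrier n) → ∑ (λ j → δ i j * f j) ≈ f i
    ∑-δˡ {suc n} zero f = trans (+-cong (*-identityˡ _) (∑-zero {n} λ j → zeroˡ _)) (+-identityʳ _)
    ∑-δˡ (suc i) f = trans (+-cong (zeroˡ _) (∑-δˡ i (λ j → f (suc j)))) (+-identityˡ _)

    δ-sym : ∀ {n} (i j : Fin n) → δ i j ≈ δ j i
    δ-sym zero    zero    = refl
    δ-sym zero    (suc j) = refl
    δ-sym (suc i) zero    = refl
    δ-sym (suc i) (suc j) = δ-sym i j

    ∑-δʳ : ∀ {n} i (f : Vector Carrier n) → ∑ (λ j → f j * δ j i) ≈ f i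
    ∑-δʳ i f = trans (sum-cong-≋ λ j → trans (*-comm _ _) (*-congʳ (δ-sym j i))) (∑-δˡ i f)

    infixl 7 _⊡_
    _⊡_ : ∀ {n} → Matrix Carrier n → Matrix Carrier n → Matrix Carrier n
    (M ⊡ N) i j = ∑ λ k → M i k * N k j

    ⊡-cong : ∀ {n} {M M′ N N′ : Matrix Carrier n} → M ≋ M′ → N ≋ N′ → M ⊡ N ≋ M′ ⊡ N′
    ⊡-cong M≋M′ N≋N′ i j = sum-cong-≋ λ k → *-cong (M≋M′ i k) (N≋N′ k j)

    ⊡-identityˡ : ∀ {n} (M : Matrix Carrier n) → δ ⊡ M ≋ M
    ⊡-identityˡ M i j = ∑-δˡ i λ k → M k j

    ⊡-assoc : ∀ {n} (L M N : Matrix Carrier n) → (L ⊡ M) ⊡ N ≋ L ⊡ (M ⊡ N)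
    ⊡-assoc L M N i j = begin
      ∑ (λ k → ∑ (λ l → L i l * M l k) * N k j)
        ≈⟨ sum-cong-≋ (λ k → *-distribʳ-sum (N k j) (λ l → L i l * M l k)) ⟩
      ∑ (λ k → ∑ λ l → L i l * M l k * N k j)
        ≈⟨ ∑-comm (λ k l → L i l * M l k * N k j) ⟩
      ∑ (λ l → ∑ λ k → L i l * M l k * N k j)
        ≈⟨ sum-cong-≋ (λ l → sum-cong-≋ λ k → *-assoc (L i l) (M l k) (N k j)) ⟩
      ∑ (λ l → ∑ λ k → L i l * (M l k * N k j))
        ≈⟨ sum-cong-≋ (λ l → *-distribˡ-sum (L i l) (λ k → M l k * N k j)) ⟨
      ∑ (λ l → L i l * ∑ λ k → M l k * N k j) ∎

    module _ {n : ℕ} where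

      -- `k` counts the rows and `n` is their length; the two are separate because fixing the first
      -- row lowers only `k`. Rows are functions, compared pointwise, so compatibility with
      -- pointwise equality has to be required.
      Congruent : ∀ {k} → ((Fin k → Vector Carrier n) → Carrier) → Set (c ⊔ ℓ)
      Congruent D = ∀ {M N} → M ≋ N → D M ≈ D N

      Linear : ∀ {k} → ((Fin (suc k) → Vector Carrier n) → Carrier) → Set (c ⊔ ℓ)
      Linear D =
        (∀ u v M → D ((λ j → u j + v j) ∷ M) ≈ D (u ∷ M) + D (v ∷ M)) ×
        (∀ a u M → D ((λ j → a * u j) ∷ M) ≈ a * D (u ∷ M))

      Vanishing : ∀ {k} → ((Fin (suc k) → Vector Carrier n) → Carrier) → Set (c ⊔ ℓ)
      Vanishing {zero}  D = ⊤
      Vanishing {suc k} D = ∀ v M → D (v ∷ v ∷ M) ≈ 0#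

      -- Asking for linearity in the first row and for vanishing on equal first
      -- two rows, hereditarily in the remaining rows, makes every argument below
      -- a plain induction on the number of rows.
      data Alternating : ∀ k → ((Fin k → Vector Carrier n) → Carrier) → Set (c ⊔ ℓ) where
        none : ∀ {D} → Congruent D → Alternating zero D
        rows : ∀ {k D} → Congruent D → Linear D → Vanishing D →
               (∀ v → Alternating k (λ M → D (v ∷ M))) → Alternating (suc k) D

      congruent : ∀ {k D} → Alternating k D → Congruent D
      congruent (none cong)       = cong
      congruent (rows cong _ _ _) = cong

      linear : ∀ {k D} → Alternating (suc k) D → Linear D
      linear (rows _ lin _ _) = lin

      vanishing : ∀ {k D} → Alternating (suc k) D → Vanishing D
      vanishing (rows _ _ van _) = van

      alternating : ∀ {k D} → Alternating (suc k) D → ∀ v → Alternating k (λ M → D (v ∷ M))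
      alternating (rows _ _ _ alt) = alt

      ∷-cong : ∀ {k} {u v : Vector Carrier n} {M N : Fin k → Vector Carrier n} →
               (∀ j → u j ≈ v j) → M ≋ N → (u ∷ M) ≋ (v ∷ N)
      ∷-cong u≈v M≋N zero    = u≈v
      ∷-cong u≈v M≋N (suc i) = M≋N i

      head∷tail : ∀ {k} (M : Fin (suc k) → Vector Carrier n) → M ≋ (M zero ∷ λ i → M (suc i))
      head∷tail M zero    j = refl
      head∷tail M (suc i) j = refl

      Alternating-resp : ∀ {k D E} → (∀ M → D M ≈ E M) → Alternating k D → Alternating k E
      Alternating-resp D≈E (none cong) = none λ M≋N →
        trans (sym (D≈E _)) (trans (cong M≋N) (D≈E _))
      Alternating-resp {suc k} {D} {E} D≈E (rows cong (add , hom) van alt) = rows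
          (λ M≋N → trans (sym (D≈E _)) (trans (cong M≋N) (D≈E _)))
          ( (λ u v M → trans (sym (D≈E _)) (trans (add u v M) (+-cong (D≈E _) (D≈E _))))
          , (λ a u M → trans (sym (D≈E _)) (trans (hom a u M) (*-congˡ (D≈E _)))))
          -- `Vanishing` is void for a single row and reduces only once the number of remaining rows
          -- is split, hence the auxiliary `vanish`, here and in the next lemmas.
          (vanish k D E D≈E van)
          λ v → Alternating-resp (λ M → D≈E _) (alt v)
        where
        vanish : ∀ k (D E : (Fin (suc k) → Vector Carrier n) → Carrier) →
                 (∀ M → D M ≈ E M) → Vanishing D → Vanishing E
        vanish zero    D E D≈E van = _
        vanish (suc k) D E D≈E van = λ v M → trans (sym (D≈E _)) (van v M)

      Alternating-scale : ∀ {k D} a → Alternating k D → Alternating k (λ M → a * D M)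
      Alternating-scale a (none cong) = none λ M≋N → *-congˡ (cong M≋N)
      Alternating-scale {suc k} {D} a (rows cong (add , hom) van alt) = rows
          (λ M≋N → *-congˡ (cong M≋N))
          ( (λ u v M → trans (*-congˡ (add u v M)) (distribˡ _ _ _))
          , (λ b u M → trans (*-congˡ (hom b u M)) (*C.x∙yz≈y∙xz _ _ _)))
          (vanish k D van)
          λ v → Alternating-scale a (alt v)
        where
        vanish : ∀ k (D : (Fin (suc k) → Vector Carrier n) → Carrier) →
                 Vanishing D → Vanishing (λ M → a * D M)
        vanish zero    D van = _
        vanish (suc k) D van = λ v M → trans (*-congˡ (van v M)) (zeroʳ a)

      Alternating-∑ : ∀ {k m} {D : Fin m → (Fin k → Vector Carrier n) → Carrier} →
                      (∀ j → Alternating k (D j)) → Alternating k (λ M → ∑ λ j → D j M)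
      Alternating-∑ {zero}      alt = none λ M≋N → sum-cong-≋ λ j → congruent (alt j) M≋N
      Alternating-∑ {suc k} {m} {D} alt = rows
          (λ M≋N → sum-cong-≋ λ j → congruent (alt j) M≋N)
          ( (λ u v M → trans (sum-cong-≋ λ j → proj₁ (linear (alt j)) u v M)
                             (∑-distrib-+ (λ j → D j (u ∷ M)) (λ j → D j (v ∷ M))))
          , (λ a u M → trans (sum-cong-≋ λ j → proj₂ (linear (alt j)) a u M)
                             (sym (*-distribˡ-sum a (λ j → D j (u ∷ M))))))
          (vanish k D (λ j → vanishing (alt j)))
          λ v → Alternating-∑ λ j → alternating (alt j) v
        where
        vanish : ∀ k (D : Fin m → (Fin (suc k) → Vector Carrier n) → Carrier) →
                 (∀ j → Vanishing (D j)) → Vanishing (λ M → ∑ λ j → D j M)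
        vanish zero    D van = _
        vanish (suc k) D van = λ v M → ∑-zero λ j → van j v M

      module _ {k : ℕ} {D : (Fin (suc (suc k)) → Vector Carrier n) → Carrier}
               (alt : Alternating (suc (suc k)) D) where
        private
          add₀ = proj₁ (linear alt)
          vanishes = vanishing alt
          add₁ = λ w → proj₁ (linear (alternating alt w))

        -- Additivity in both rows expands the vanishing value at `u+v ∷ u+v ∷ M` into four terms,
        -- two of which vanish.
        swap : ∀ u v M → D (u ∷ v ∷ M) ≈ - D (v ∷ u ∷ M)
        swap u v M = inverseʳ-unique _ _ (begin
          D (v ∷ u ∷ M) + D (u ∷ v ∷ M)
            ≈⟨ +-comm _ _ ⟩
          D (u ∷ v ∷ M) + D (v ∷ u ∷ M)
            ≈⟨ +-cong (+-identityˡ _) (+-identityʳ _) ⟨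
          (0# + D (u ∷ v ∷ M)) + (D (v ∷ u ∷ M) + 0#)
            ≈⟨ +-cong (+-congʳ (vanishes u M)) (+-congˡ (vanishes v M)) ⟨
          (D (u ∷ u ∷ M) + D (u ∷ v ∷ M)) + (D (v ∷ u ∷ M) + D (v ∷ v ∷ M))
            ≈⟨ +-cong (add₁ u u v M) (add₁ v u v M) ⟨
          D (u ∷ u+v ∷ M) + D (v ∷ u+v ∷ M)
            ≈⟨ add₀ u v (u+v ∷ M) ⟨
          D (u+v ∷ u+v ∷ M)
            ≈⟨ vanishes u+v M ⟩
          0# ∎)
          where u+v = λ j → u j + v j

      -- Vanishing is assumed for the first two rows only. A copy of `v` further down is reached by
      -- exchanging `v` with `M zero` and recursing in the form with `M zero` fixed.
      repeated-row : ∀ {k D} → Alternating (suc k) D → (v : Vector Carrier n) (M : Fin k → Vector Carrier n) →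
                     ∀ i → (∀ j → M i j ≈ v j) → D (v ∷ M) ≈ 0#
      repeated-row {suc k} alt v M zero M₀≈v = trans
        (congruent alt (∷-cong (λ j → refl) λ where
          zero    j → M₀≈v j
          (suc i) j → refl))
        (vanishing alt v (λ i → M (suc i)))
      repeated-row {suc k} {D} alt v M (suc i) Mᵢ≈v = begin
        D (v ∷ M)
          ≈⟨ congruent alt (∷-cong (λ j → refl) (head∷tail M)) ⟩
        D (v ∷ M zero ∷ λ i → M (suc i))
          ≈⟨ swap alt v (M zero) _ ⟩
        - D (M zero ∷ v ∷ λ i → M (suc i))
          ≈⟨ -‿cong (repeated-row (alternating alt (M zero)) v (λ i → M (suc i)) i Mᵢ≈v) ⟩
        - 0#
          ≈⟨ -0#≈0# ⟩
        0# ∎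

      -- `kill` is met when `e` is a further row, already fixed outside `M`; multiples of `e` can
      -- then be cleared from all rows of `M`. With `e` a basis vector this empties a column.
      shear : ∀ {k D} → Alternating k D → (e : Vector Carrier n) →
              (∀ (M : Fin k → Vector Carrier n) i → (∀ j → M i j ≈ e j) → D M ≈ 0#) →
              ∀ (M : Fin k → Vector Carrier n) (a : Vector Carrier k) → D (λ i j → M i j + a i * e j) ≈ D M
      shear (none cong) e kill M a = cong λ ()
      shear {suc k} {D} (rows cong (add , hom) _ alt′) e kill M a = begin
        D (λ i j → M i j + a i * e j)
          ≈⟨ cong (head∷tail _) ⟩
        D ((λ j → M zero j + a zero * e j) ∷ N)
          ≈⟨ add (M zero) (λ j → a zero * e j) N ⟩
        D (M zero ∷ N) + D ((λ j → a zero * e j) ∷ N)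
          ≈⟨ +-congˡ (trans (hom (a zero) e N)
               (trans (*-congˡ (kill (e ∷ N) zero λ j → refl)) (zeroʳ _))) ⟩
        D (M zero ∷ N) + 0#
          ≈⟨ +-identityʳ _ ⟩
        D (M zero ∷ N)
          ≈⟨ shear (alt′ (M zero)) e (λ M′ i eq → kill (M zero ∷ M′) (suc i) eq)
               (λ i → M (suc i)) (λ i → a (suc i)) ⟩
        D (M zero ∷ λ i → M (suc i))
          ≈⟨ cong (head∷tail M) ⟨
        D M ∎
        where N = λ i j → M (suc i) j + a (suc i) * e j

      linear-∑ : ∀ {k D} → Alternating (suc k) D → ∀ {m} (a : Vector Carrier m)
                 (e : Fin m → Vector Carrier n) (M : Fin k → Vector Carrier n) →
                 D ((λ j → ∑ λ i → a i * e i j) ∷ M) ≈ ∑ λ i → a i * D (e i ∷ M)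
      linear-∑ {D = D} alt@(rows cong (add , hom) _ _) {zero}  a e M = begin
        D ((λ j → 0#) ∷ M)      ≈⟨ cong (∷-cong (λ j → zeroˡ _) (λ i j → refl)) ⟨
        D ((λ j → 0# * 0#) ∷ M) ≈⟨ hom 0# (λ j → 0#) M ⟩
        0# * D ((λ j → 0#) ∷ M) ≈⟨ zeroˡ _ ⟩
        0# ∎
      linear-∑ alt@(rows cong (add , hom) _ _) {suc m} a e M = trans (add _ _ M)
        (+-cong (hom _ _ M) (linear-∑ alt (λ i → a (suc i)) (λ i → e (suc i)) M))

    IsLinear : ∀ {m n} → (Vector Carrier m → Vector Carrier n) → Set _
    IsLinear g = (∀ {u v} → (∀ j → u j ≈ v j) → ∀ j → g u j ≈ g v j)
               × (∀ u v j → g (λ i → u i + v i) j ≈ g u j + g v j)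
               × (∀ a u j → g (λ i → a * u i) j ≈ a * g u j)

    -- Three instances are used: deleting an entry of each row, which gives minors, inserting a zero
    -- into each row, and multiplying each row by a fixed matrix.
    Alternating-∘ : ∀ {m n k D} {g : Vector Carrier m → Vector Carrier n} → IsLinear g →
                    Alternating k D → Alternating k (λ M → D (λ i → g (M i)))
    Alternating-∘ (g-cong , _) (none cong) = none λ M≋N → cong λ i → g-cong (M≋N i)
    Alternating-∘ {m} {n} {suc k} {D} {g} lin@(g-cong , g-add , g-hom) (rows cong (add , hom) van alt′) = rows
        (λ M≋N → cong λ i → g-cong (M≋N i))
        ( (λ u v M → trans (D-∷ _ M) (trans (cong (∷-cong (g-add u v) λ i j → refl))
            (trans (add _ _ _) (sym (+-cong (D-∷ u M) (D-∷ v M))))))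
        , (λ a u M → trans (D-∷ _ M) (trans (cong (∷-cong (g-hom a u) λ i j → refl))
            (trans (hom _ _ _) (sym (*-congˡ (D-∷ u M)))))))
        (vanish k D cong van)
        λ v → Alternating-resp (λ M → sym (D-∷ v M)) (Alternating-∘ lin (alt′ (g v)))
      where
      map-∷ : ∀ {k} u (M : Fin k → Vector Carrier m) →
              (λ i → g ((u ∷ M) i)) ≋ (g u ∷ λ i → g (M i))
      map-∷ u M zero    j = refl
      map-∷ u M (suc i) j = refl
      D-∷ : ∀ u M → D (λ i → g ((u ∷ M) i)) ≈ D (g u ∷ λ i → g (M i))
      D-∷ u M = cong (map-∷ u M)
      vanish : ∀ k (D : (Fin (suc k) → Vector Carrier n) → Carrier) → Congruent D →
               Vanishing D → Vanishing (λ M → D (λ i → g (M i)))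
      vanish zero    D cong van = _
      vanish (suc k) D cong van = λ v M → trans
        (cong λ where
          zero          j → refl
          (suc zero)    j → refl
          (suc (suc i)) j → refl)
        (van (g v) λ i → g (M i))

    sign : ∀ {n} → Fin n → Carrier
    sign j = (- 1#) ^ᵣ toℕ j

    sign-suc : ∀ {n} (j : Fin n) x → sign (suc j) * x ≈ - (sign j * x)
    sign-suc j x = trans (*-assoc _ _ _) (trans (sym (-‿distribˡ-* _ _)) (-‿cong (*-identityˡ _)))

    -- The pair of columns (j , punchIn j k) is matched with its transpose, and h
    -- has to be invariant under the matching.
    Symmetricₚ : ∀ n → (Fin (suc n) → Fin n → Carrier) → Set ℓ
    Symmetricₚ zero    h = ⊤
    Symmetricₚ (suc n) h =
      (∀ k → h zero k ≈ h (suc k) zero) × Symmetricₚ n (λ j k → h (suc j) (suc k))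

    -- The terms at `(zero , k)` and `(suc k , zero)` have opposite signs and cancel. For the others
    -- both indices are shifted, the two changes of sign compensate, and a smaller sum of the same
    -- kind remains.
    signed-symmetric-sum : ∀ n h → Symmetricₚ n h → ∑ (λ j → ∑ λ k → sign j * (sign k * h j k)) ≈ 0#
    signed-symmetric-sum zero    h _ = +-identityʳ _
    signed-symmetric-sum (suc n) h (h₀ , h₊) = begin
      ∑ (λ k → 1# * (sign k * h zero k)) +
        ∑ (λ j → sign (suc j) * (1# * h (suc j) zero) + ∑ λ k → sign (suc j) * (sign (suc k) * h (suc j) (suc k)))
        ≈⟨ +-cong (sum-cong-≋ top)
             (trans (∑-distrib-+ (λ j → sign (suc j) * (1# * h (suc j) zero))
                                 (λ j → ∑ λ k → sign (suc j) * (sign (suc k) * h (suc j) (suc k))))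
               (+-cong (sum-cong-≋ left) (sum-cong-≋ λ j → sum-cong-≋ (double-sign j)))) ⟩
      ∑ f + (∑ (λ j → - f j) + ∑ λ j → ∑ λ k → sign j * (sign k * h (suc j) (suc k)))
        ≈⟨ +-congˡ (+-congˡ (signed-symmetric-sum n (λ j k → h (suc j) (suc k)) h₊)) ⟩
      ∑ f + (∑ (λ j → - f j) + 0#)
        ≈⟨ +-congˡ (+-identityʳ _) ⟩
      ∑ f + ∑ (λ j → - f j)
        ≈⟨ ∑-distrib-+ f (λ j → - f j) ⟨
      ∑ (λ j → f j + - f j)
        ≈⟨ ∑-zero (λ j → -‿inverseʳ (f j)) ⟩
      0# ∎
      where
      f : Vector Carrier (suc n)
      f k = sign k * h (suc k) zero
      top : ∀ k → 1# * (sign k * h zero k) ≈ f k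
      top k = trans (*-identityˡ _) (*-congˡ (h₀ k))
      left : ∀ j → sign (suc j) * (1# * h (suc j) zero) ≈ - f j
      left j = trans (sign-suc j _) (-‿cong (*-congˡ (*-identityˡ _)))
      double-sign : ∀ j k → sign (suc j) * (sign (suc k) * h (suc j) (suc k)) ≈
                            sign j * (sign k * h (suc j) (suc k))
      double-sign j k = begin
        sign (suc j) * (sign (suc k) * h (suc j) (suc k)) ≈⟨ sign-suc j _ ⟩
        - (sign j * (sign (suc k) * h (suc j) (suc k)))   ≈⟨ -‿cong (*-congˡ (sign-suc k _)) ⟩
        - (sign j * - (sign k * h (suc j) (suc k)))       ≈⟨ -‿cong (-‿distribʳ-* _ _) ⟨
        - - (sign j * (sign k * h (suc j) (suc k)))       ≈⟨ -‿involutive _ ⟩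
        sign j * (sign k * h (suc j) (suc k))             ∎

    -- The pairs `(zero , k)` and `(suc k , zero)` select the same two columns in opposite order and
    -- leave the same columns over. `Φ` sees only the map listing the columns left over, which the
    -- recursion is able to adjust.
    punchIn-symmetric : ∀ m (v : Vector Carrier (suc (suc m))) (Φ : (Fin m → Fin (suc (suc m))) → Carrier) →
      (∀ {c d} → (∀ l → c l ≡ d l) → Φ c ≈ Φ d) →
      Symmetricₚ (suc m) λ j k → v j * (v (punchIn j k) * Φ (λ l → punchIn j (punchIn k l)))
    punchIn-symmetric m v Φ Φ-cong = (λ k → *C.x∙yz≈y∙xz _ _ _) , rest m v Φ Φ-cong
      where
      rest : ∀ m (v : Vector Carrier (suc (suc m))) (Φ : (Fin m → Fin (suc (suc m))) → Carrier) →
        (∀ {c d} → (∀ l → c l ≡ d l) → Φ c ≈ Φ d) → Symmetricₚ m λ j k →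
        v (suc j) * (v (suc (punchIn j k)) * Φ (λ l → punchIn (suc j) (punchIn (suc k) l)))
      rest zero    v Φ Φ-cong = _
      -- Neither selected column is column zero, which therefore comes first among those left over;
      -- `lift` puts it back in front of a choice from the remaining columns.
      rest (suc m) v Φ Φ-cong = resp (suc m)
        (λ j k → v (suc j) * (v (suc (punchIn j k)) * Φ (λ l → punchIn (suc j) (punchIn (suc k) l))))
        (λ j k → *-congˡ (*-congˡ (Φ-cong (lift-punchIn j k))))
        (punchIn-symmetric m (λ j → v (suc j)) (λ c → Φ (lift c)) λ c≗d → Φ-cong (lift-cong c≗d))
        where
        lift : (Fin m → Fin (suc (suc m))) → Fin (suc m) → Fin (suc (suc (suc m)))
        lift c zero    = zero
        lift c (suc l) = suc (c l)
        lift-cong : ∀ {c d} → (∀ l → c l ≡ d l) → ∀ l → lift c l ≡ lift d l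
        lift-cong c≗d zero    = ≡.refl
        lift-cong c≗d (suc l) = ≡.cong suc (c≗d l)
        lift-punchIn : ∀ j k l → lift (λ i → punchIn j (punchIn k i)) l ≡ punchIn (suc j) (punchIn (suc k) l)
        lift-punchIn j k zero    = ≡.refl
        lift-punchIn j k (suc l) = ≡.refl
        resp : ∀ n {g} h → (∀ j k → g j k ≈ h j k) → Symmetricₚ n g → Symmetricₚ n h
        resp zero    h g≈h _         = _
        resp (suc n) h g≈h (g₀ , g₊) =
          (λ k → trans (sym (g≈h _ _)) (trans (g₀ k) (g≈h _ _))) , resp n _ (λ j k → g≈h _ _) g₊

    removeAt-linear : ∀ {n} (j : Fin (suc n)) → IsLinear (λ v → removeAt v j)
    removeAt-linear j = (λ u≈v k → u≈v _) , (λ u v k → refl) , (λ a u k → refl)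

    minor : ∀ {n} → (Fin n → Vector Carrier (suc n)) → Fin (suc n) → Matrix Carrier n
    minor M j i k = M i (punchIn j k)

    laplace : ∀ {n} → Vector Carrier (suc n) → (Fin n → Vector Carrier (suc n)) → Fin (suc n) → Carrier
    laplace v M j = sign j * (v j * det (minor M j))

    det-cong : ∀ {n} {M N : Matrix Carrier n} → M ≋ N → det M ≈ det N
    det-cong {zero}  M≋N = refl
    det-cong {suc n} {M} {N} M≋N = sum-cong-≋ term
      where
      term : ∀ j → laplace (M zero) (λ i → M (suc i)) j ≈ laplace (N zero) (λ i → N (suc i)) j
      term j = *-congˡ (*-cong (M≋N zero j) (det-cong λ i k → M≋N (suc i) (punchIn j k)))

    -- With the first row fixed, the expansion is a combination of minors of the other rows,
    -- alternating by induction. If the first two rows are equal, the terms of the double expansion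
    -- along them are, apart from the sign, invariant under exchange of the two columns.
    det-alternating : ∀ n → Alternating n (det {n})
    det-alternating zero    = none λ _ → refl
    det-alternating (suc n) = rows det-cong
        ( (λ u v M → trans (sum-cong-≋ (add u v M)) (∑-distrib-+ (laplace u M) (laplace v M)))
        , (λ a u M → trans (sum-cong-≋ (hom a u M)) (sym (*-distribˡ-sum a (laplace u M)))))
        (vanish n)
        λ v → Alternating-∑ λ j → Alternating-scale (sign j) (Alternating-scale (v j)
          (Alternating-∘ (removeAt-linear j) (det-alternating n)))
      where
      add : ∀ u v M j → laplace (λ i → u i + v i) M j ≈ laplace u M j + laplace v M j
      add u v M j = trans (*-congˡ (distribʳ _ _ _)) (distribˡ _ _ _)
      hom : ∀ a u M j → laplace (λ i → a * u i) M j ≈ a * laplace u M j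
      hom a u M j = trans (*-congˡ (*-assoc _ _ _)) (*C.x∙yz≈y∙xz _ _ _)
      vanish : ∀ n → Vanishing (det {suc n})
      vanish zero    = _
      vanish (suc m) v M = trans (sum-cong-≋ expand)
        (signed-symmetric-sum (suc m) (λ j k → v j * g j k) (punchIn-symmetric m v Φ λ c≗d →
          det-cong λ i l → reflexive (≡.cong (M i) (c≗d l))))
        where
        Φ : (Fin m → Fin (suc (suc m))) → Carrier
        Φ c = det (λ i l → M i (c l))
        g : Fin (suc (suc m)) → Fin (suc m) → Carrier
        g j k = v (punchIn j k) * Φ (λ l → punchIn j (punchIn k l))
        expand : ∀ j → laplace v (v ∷ M) j ≈ ∑ λ k → sign j * (sign k * (v j * g j k))
        expand j = begin
          sign j * (v j * ∑ λ k → sign k * g j k)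
            ≈⟨ *-congˡ (*-distribˡ-sum (v j) λ k → sign k * g j k) ⟩
          sign j * (∑ λ k → v j * (sign k * g j k))
            ≈⟨ *-distribˡ-sum (sign j) (λ k → v j * (sign k * g j k)) ⟩
          ∑ (λ k → sign j * (v j * (sign k * g j k)))
            ≈⟨ sum-cong-≋ swap-factors ⟩
          ∑ (λ k → sign j * (sign k * (v j * g j k))) ∎
          where
          swap-factors : ∀ k → sign j * (v j * (sign k * g j k)) ≈ sign j * (sign k * (v j * g j k))
          swap-factors k = *-congˡ (*C.x∙yz≈y∙xz _ _ _)

    insertZero : ∀ {n} → Fin (suc n) → Vector Carrier n → Vector Carrier (suc n)
    insertZero j v = insertAt v j 0#

    insertZero-linear : ∀ {n} (j : Fin (suc n)) → IsLinear (insertZero j)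
    insertZero-linear j = cong j , add j , hom j
      where
      cong : ∀ {n} (j : Fin (suc n)) {u v} → (∀ i → u i ≈ v i) → ∀ k → insertZero j u k ≈ insertZero j v k
      cong zero            u≈v zero    = refl
      cong zero            u≈v (suc k) = u≈v k
      cong {suc n} (suc j) u≈v zero    = u≈v zero
      cong {suc n} (suc j) u≈v (suc k) = cong j (λ i → u≈v (suc i)) k
      add : ∀ {n} (j : Fin (suc n)) u v k →
            insertZero j (λ i → u i + v i) k ≈ insertZero j u k + insertZero j v k
      add zero            u v zero    = sym (+-identityˡ _)
      add zero            u v (suc k) = refl
      add {suc n} (suc j) u v zero    = refl
      add {suc n} (suc j) u v (suc k) = add j (λ i → u (suc i)) (λ i → v (suc i)) k
      hom : ∀ {n} (j : Fin (suc n)) a u k → insertZero j (λ i → a * u i) k ≈ a * insertZero j u k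
      hom zero            a u zero    = sym (zeroʳ a)
      hom zero            a u (suc k) = refl
      hom {suc n} (suc j) a u zero    = refl
      hom {suc n} (suc j) a u (suc k) = hom j a (λ i → u (suc i)) k

    -- Brings a row into the form that `shear` reduces: zero at `j`, plus a multiple of `δ j`.
    insertZero-removeAt : ∀ {n} (j : Fin (suc n)) v k →
                          insertZero j (removeAt v j) k + v j * δ j k ≈ v k
    insertZero-removeAt zero            v zero    = trans (+-identityˡ _) (*-identityʳ _)
    insertZero-removeAt zero            v (suc k) = trans (+-congˡ (zeroʳ _)) (+-identityʳ _)
    insertZero-removeAt {suc n} (suc j) v zero    = trans (+-congˡ (zeroʳ _)) (+-identityʳ _)
    insertZero-removeAt {suc n} (suc j) v (suc k) = insertZero-removeAt j (λ i → v (suc i)) k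

    insertZero-0 : ∀ {n} (j : Fin (suc n)) k → insertZero j (λ _ → 0#) k ≈ 0#
    insertZero-0 zero            zero    = refl
    insertZero-0 zero            (suc k) = refl
    insertZero-0 {suc n} (suc j) zero    = refl
    insertZero-0 {suc n} (suc j) (suc k) = insertZero-0 j k

    -- The rows are those of the identity with row `j` moved to the top, a cycle made of `j`
    -- exchanges of neighbours. One `swap` puts `δ zero` on top; fixing it leaves the same situation
    -- with one row and one column fewer.
    first-row-sign : ∀ n {D} → Alternating (suc n) D → ∀ (j : Fin (suc n)) →
                     D (δ j ∷ λ i → insertZero j (δ i)) ≈ sign j * D δ
    first-row-sign n alt zero = trans
      (congruent alt λ where
        zero    j       → refl
        (suc i) zero    → refl
        (suc i) (suc j) → refl)
      (sym (*-identityˡ _))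
    first-row-sign (suc n) {D} alt (suc j) = begin
      D (δ (suc j) ∷ λ i → insertZero (suc j) (δ i))
        ≈⟨ congruent alt (∷-cong (λ k → refl) λ where
             zero    zero    → refl
             zero    (suc k) → insertZero-0 j k
             (suc i) zero    → refl
             (suc i) (suc k) → refl) ⟩
      D (δ (suc j) ∷ δ zero ∷ λ i → insertZero zero (insertZero j (δ i)))
        ≈⟨ swap alt _ _ _ ⟩
      - D (δ zero ∷ δ (suc j) ∷ λ i → insertZero zero (insertZero j (δ i)))
        ≈⟨ -‿cong (congruent alt (∷-cong (λ k → refl) λ where
             zero    zero    → refl
             zero    (suc k) → refl
             (suc i) k       → refl)) ⟩
      - D′ (δ j ∷ λ i → insertZero j (δ i))
        ≈⟨ -‿cong (first-row-sign n alt′ j) ⟩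
      - (sign j * D′ δ)
        -- The clause for `zero`, read for `D` itself, identifies `D′ δ` with `D δ`.
        ≈⟨ -‿cong (*-congˡ (trans (first-row-sign (suc n) alt zero) (*-identityˡ _))) ⟩
      - (sign j * D δ)
        ≈⟨ sign-suc j _ ⟨
      sign (suc j) * D δ ∎
      where
      D′ : Matrix Carrier (suc n) → Carrier
      D′ M = D (δ zero ∷ λ i → insertZero zero (M i))
      alt′ : Alternating (suc n) D′
      alt′ = Alternating-∘ (insertZero-linear zero) (alternating alt (δ zero))

    -- Expanding the first row in basis vectors leaves values with first row `δ j`. These ignore
    -- column `j` of the other rows, so they are alternating forms in the minor, multiples of its
    -- determinant by induction; `first-row-sign` supplies the factor.
    alternating-unique : ∀ n {D} → Alternating n D → ∀ M → D M ≈ det M * D δ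
    alternating-unique zero    alt M = trans (congruent alt λ ()) (sym (*-identityˡ _))
    alternating-unique (suc n) {D} alt M = begin
      D M
        ≈⟨ congruent alt (λ where
             zero    j → sym (∑-δʳ j (M zero))
             (suc i) j → refl) ⟩
      D ((λ j → ∑ λ i → M zero i * δ i j) ∷ M′)
        ≈⟨ linear-∑ alt (M zero) δ M′ ⟩
      ∑ (λ j → M zero j * D (δ j ∷ M′))
        ≈⟨ sum-cong-≋ term ⟩
      ∑ (λ j → laplace (M zero) M′ j * D δ)
        ≈⟨ *-distribʳ-sum (D δ) (laplace (M zero) M′) ⟨
      det M * D δ ∎
      where
      M′ : Fin n → Vector Carrier (suc n)
      M′ i = M (suc i)
      alt′ : ∀ j → Alternating n (λ N → D (δ j ∷ λ i → insertZero j (N i)))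
      alt′ j = Alternating-∘ (insertZero-linear j) (alternating alt (δ j))
      expand : ∀ j → D (δ j ∷ M′) ≈ det (minor M′ j) * (sign j * D δ)
      expand j = begin
        D (δ j ∷ M′)
          ≈⟨ congruent alt (∷-cong (λ k → refl) (λ i k → insertZero-removeAt j (M′ i) k)) ⟨
        D (δ j ∷ λ i k → insertZero j (minor M′ j i) k + M′ i j * δ j k)
          ≈⟨ shear (alternating alt (δ j)) (δ j) (repeated-row alt (δ j))
               (λ i → insertZero j (minor M′ j i)) (λ i → M′ i j) ⟩
        D (δ j ∷ λ i → insertZero j (minor M′ j i))
          ≈⟨ alternating-unique n (alt′ j) (minor M′ j) ⟩
        det (minor M′ j) * D (δ j ∷ λ i → insertZero j (δ i))
          ≈⟨ *-congˡ (first-row-sign n alt j) ⟩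
        det (minor M′ j) * (sign j * D δ) ∎
      term : ∀ j → M zero j * D (δ j ∷ M′) ≈ laplace (M zero) M′ j * D δ
      term j = begin
        M zero j * D (δ j ∷ M′)                         ≈⟨ *-congˡ (expand j) ⟩
        M zero j * (det (minor M′ j) * (sign j * D δ))  ≈⟨ *-assoc _ _ _ ⟨
        M zero j * det (minor M′ j) * (sign j * D δ)    ≈⟨ *-assoc _ _ _ ⟨
        M zero j * det (minor M′ j) * sign j * D δ      ≈⟨ *-congʳ (*-comm _ _) ⟩
        laplace (M zero) M′ j * D δ                     ∎

    -- `M ⊡ N` arises from `M` by one linear map applied to every row, so its determinant is
    -- alternating in `M`, with value `det N` at the identity.
    det-⊡ : ∀ {n} (M N : Matrix Carrier n) → det (M ⊡ N) ≈ det M * det N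
    det-⊡ {n} M N = trans
      (alternating-unique n (Alternating-∘ ⊡N-linear (det-alternating n)) M)
      (*-congˡ (det-cong (⊡-identityˡ N)))
      where
      ⊡N-linear : IsLinear λ v j → ∑ λ k → v k * N k j
      ⊡N-linear = (λ u≈v j → sum-cong-≋ λ k → *-congʳ (u≈v k))
             , (λ u v j → trans (sum-cong-≋ λ k → distribʳ (N k j) (u k) (v k))
                                (∑-distrib-+ (λ k → u k * N k j) λ k → v k * N k j))
             , (λ a u j → trans (sum-cong-≋ λ k → *-assoc a (u k) (N k j))
                                (sym (*-distribˡ-sum a λ k → u k * N k j)))

    det-diagonal : ∀ {n} {M : Matrix Carrier n} (d : Vector Carrier n) →
                   (∀ i j → M i j ≈ d i * δ i j) → det M ≈ ∏ d
    det-diagonal {zero}  d M≈d = refl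
    det-diagonal {suc n} {M} d M≈d = trans (+-cong first (∑-zero rest)) (+-identityʳ _)
      where
      first : laplace (M zero) (λ i → M (suc i)) zero ≈ d zero * ∏ (λ i → d (suc i))
      first = trans (*-identityˡ _) (*-cong (trans (M≈d zero zero) (*-identityʳ _))
        (det-diagonal (λ i → d (suc i)) λ i j → M≈d (suc i) (suc j)))
      rest : ∀ j → laplace (M zero) (λ i → M (suc i)) (suc j) ≈ 0#
      rest j = trans (*-congˡ (trans (*-congʳ (trans (M≈d zero (suc j)) (zeroʳ _))) (zeroˡ _))) (zeroʳ _)

    -- The scalars commute, so det L · det M · det R is det M times det L · det R, and the latter is
    -- the determinant of L R.
    det-similar : ∀ {n} {M : Matrix Carrier n} (L R : Matrix Carrier n) (d : Vector Carrier n) →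
                  L ⊡ R ≋ δ → (∀ i j → (L ⊡ M ⊡ R) i j ≈ d i * δ i j) → det M ≈ ∏ d
    det-similar {n} {M} L R d LR≋δ LMR≈d = begin
      det M                          ≈⟨ *-identityˡ _ ⟨
      1# * det M                     ≈⟨ *-congʳ det-LR ⟨
      det L * det R * det M          ≈⟨ *-assoc _ _ _ ⟩
      det L * (det R * det M)        ≈⟨ *-congˡ (*-comm _ _) ⟩
      det L * (det M * det R)        ≈⟨ *-assoc _ _ _ ⟨
      det L * det M * det R          ≈⟨ *-congʳ (det-⊡ L M) ⟨
      det (L ⊡ M) * det R            ≈⟨ det-⊡ (L ⊡ M) R ⟨
      det (L ⊡ M ⊡ R)                ≈⟨ det-diagonal d LMR≈d ⟩
      ∏ d                            ∎
      where
      ∏-1 : ∀ n → ∏ {n} (λ _ → 1#) ≈ 1#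
      ∏-1 zero    = refl
      ∏-1 (suc n) = trans (*-identityˡ _) (∏-1 n)
      det-LR : det L * det R ≈ 1#
      det-LR = begin
        det L * det R  ≈⟨ det-⊡ L R ⟨
        det (L ⊡ R)    ≈⟨ det-diagonal (λ _ → 1#) (λ i j → trans (LR≋δ i j) (sym (*-identityˡ _))) ⟩
        ∏ {n} (λ _ → 1#) ≈⟨ ∏-1 n ⟩
        1#             ∎

-- Polynomials over ℚ as a commutative ring.

module PolynomialRing where

  open import Algebra.Bundles using (CommutativeRing)
  open import Algebra.Structures using (IsCommutativeRing)
  open import Data.List using ([]; _∷_; map)
  open import Data.Nat using (ℕ; zero; suc)
  open import Data.Product using (_,_)
  open import Data.Rational as ℚ using (ℚ; 0ℚ; 1ℚ)
  import Data.Rational.Properties as ℚ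
  open import Data.Rational.Solver using (module +-*-Solver)
  open import Level using (0ℓ)
  open import Relation.Binary.PropositionalEquality as ≡
    using (_≡_; refl; sym; trans; cong; cong₂; module ≡-Reasoning)

  -- The Cauchy product on coefficient sequences, with the recursion of `_*ₚ_`. The multiplicative
  -- laws are proved for sequences, where lists of unequal length and trailing zeros cause no cases,
  -- and return to lists through `coeff-*`.
  conv : (ℕ → ℚ) → (ℕ → ℚ) → ℕ → ℚ
  conv u v zero    = u 0 ℚ.* v 0
  conv u v (suc i) = u 0 ℚ.* v (suc i) ℚ.+ conv (λ k → u (suc k)) v i

  conv-cong : ∀ {u u′ v v′} → (∀ k → u k ≡ u′ k) → (∀ k → v k ≡ v′ k) → ∀ i → conv u v i ≡ conv u′ v′ i
  conv-cong u≗u′ v≗v′ zero    = cong₂ ℚ._*_ (u≗u′ 0) (v≗v′ 0)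
  conv-cong u≗u′ v≗v′ (suc i) = cong₂ ℚ._+_ (cong₂ ℚ._*_ (u≗u′ 0) (v≗v′ (suc i)))
    (conv-cong (λ k → u≗u′ (suc k)) v≗v′ i)

  conv-zeroˡ : ∀ v i → conv (λ _ → 0ℚ) v i ≡ 0ℚ
  conv-zeroˡ v zero    = ℚ.*-zeroˡ (v 0)
  conv-zeroˡ v (suc i) = cong₂ ℚ._+_ (ℚ.*-zeroˡ (v (suc i))) (conv-zeroˡ v i)

  conv-distribʳ : ∀ u u′ v i → conv (λ k → u k ℚ.+ u′ k) v i ≡ conv u v i ℚ.+ conv u′ v i
  conv-distribʳ u u′ v zero    = ℚ.*-distribʳ-+ (v 0) (u 0) (u′ 0)
  conv-distribʳ u u′ v (suc i) = trans
    (cong₂ ℚ._+_ (ℚ.*-distribʳ-+ (v (suc i)) (u 0) (u′ 0)) (conv-distribʳ (λ k → u (suc k)) (λ k → u′ (suc k)) v i))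
    (solve 4 (λ a b c d → (a :+ b) :+ (c :+ d) := (a :+ c) :+ (b :+ d)) refl
      (u 0 ℚ.* v (suc i)) (u′ 0 ℚ.* v (suc i)) (conv (λ k → u (suc k)) v i) (conv (λ k → u′ (suc k)) v i))
    where open +-*-Solver

  conv-scale : ∀ a u v i → conv (λ k → a ℚ.* u k) v i ≡ a ℚ.* conv u v i
  conv-scale a u v zero    = ℚ.*-assoc a (u 0) (v 0)
  conv-scale a u v (suc i) = trans
    (cong₂ ℚ._+_ (ℚ.*-assoc a (u 0) (v (suc i))) (conv-scale a (λ k → u (suc k)) v i))
    (sym (ℚ.*-distribˡ-+ a _ _))

  -- The defining recursion separates the term with `u 0`, this one the term with `v 0`; having both
  -- makes commutativity an induction.
  conv-sucʳ : ∀ u v i → conv u v (suc i) ≡ u (suc i) ℚ.* v 0 ℚ.+ conv u (λ k → v (suc k)) i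
  conv-sucʳ u v zero    = ℚ.+-comm (u 0 ℚ.* v 1) (u 1 ℚ.* v 0)
  conv-sucʳ u v (suc i) = trans
    (cong (u 0 ℚ.* v (suc (suc i)) ℚ.+_) (conv-sucʳ (λ k → u (suc k)) v i))
    (solve 3 (λ a b c → a :+ (b :+ c) := b :+ (a :+ c)) refl
      (u 0 ℚ.* v (suc (suc i))) (u (suc (suc i)) ℚ.* v 0) (conv (λ k → u (suc k)) (λ k → v (suc k)) i))
    where open +-*-Solver

  conv-comm : ∀ u v i → conv u v i ≡ conv v u i
  conv-comm u v zero    = ℚ.*-comm (u 0) (v 0)
  conv-comm u v (suc i) = trans
    (cong₂ ℚ._+_ (ℚ.*-comm (u 0) (v (suc i))) (conv-comm (λ k → u (suc k)) v i))
    (sym (conv-sucʳ v u i))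

  conv-assoc : ∀ u v w i → conv (conv u v) w i ≡ conv u (conv v w) i
  conv-assoc u v w zero    = ℚ.*-assoc (u 0) (v 0) (w 0)
  conv-assoc u v w (suc i) = begin
    -- The shifted sequence of `conv u v` unfolds to a scaled shift of `v` plus `conv u′ v`.
    u 0 ℚ.* v 0 ℚ.* w (suc i) ℚ.+ conv (λ k → u 0 ℚ.* v (suc k) ℚ.+ conv u′ v k) w i
      ≡⟨ cong (u 0 ℚ.* v 0 ℚ.* w (suc i) ℚ.+_) (conv-distribʳ (λ k → u 0 ℚ.* v (suc k)) (conv u′ v) w i) ⟩
    u 0 ℚ.* v 0 ℚ.* w (suc i) ℚ.+ (conv (λ k → u 0 ℚ.* v (suc k)) w i ℚ.+ conv (conv u′ v) w i)
      ≡⟨ cong₂ (λ x y → u 0 ℚ.* v 0 ℚ.* w (suc i) ℚ.+ (x ℚ.+ y))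
           (conv-scale (u 0) (λ k → v (suc k)) w i) (conv-assoc u′ v w i) ⟩
    u 0 ℚ.* v 0 ℚ.* w (suc i) ℚ.+ (u 0 ℚ.* conv (λ k → v (suc k)) w i ℚ.+ conv u′ (conv v w) i)
      ≡⟨ solve 5 (λ a b c d e → a :* b :* c :+ (a :* d :+ e) := a :* (b :* c :+ d) :+ e) refl
           (u 0) (v 0) (w (suc i)) _ _ ⟩
    u 0 ℚ.* conv v w (suc i) ℚ.+ conv u′ (conv v w) i ∎
    where
    open ≡-Reasoning
    open +-*-Solver
    u′ = λ k → u (suc k)

  coeff-+ : ∀ p q i → coeff (p +ₚ q) i ≡ coeff p i ℚ.+ coeff q i
  coeff-+ []      q       i       = sym (ℚ.+-identityˡ _)
  coeff-+ (a ∷ p) []      i       = sym (ℚ.+-identityʳ _)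
  coeff-+ (a ∷ p) (b ∷ q) zero    = refl
  coeff-+ (a ∷ p) (b ∷ q) (suc i) = coeff-+ p q i

  coeff-neg : ∀ p i → coeff (-ₚ p) i ≡ ℚ.- coeff p i
  coeff-neg []      i       = refl
  coeff-neg (a ∷ p) zero    = refl
  coeff-neg (a ∷ p) (suc i) = coeff-neg p i

  coeff-scale : ∀ a p i → coeff (map (a ℚ.*_) p) i ≡ a ℚ.* coeff p i
  coeff-scale a []      i       = sym (ℚ.*-zeroʳ a)
  coeff-scale a (b ∷ p) zero    = refl
  coeff-scale a (b ∷ p) (suc i) = coeff-scale a p i

  coeff-* : ∀ p q i → coeff (p *ₚ q) i ≡ conv (coeff p) (coeff q) i
  coeff-* []      q i = sym (conv-zeroˡ (coeff q) i)
  coeff-* (a ∷ p) q zero = trans (coeff-+ (map (a ℚ.*_) q) (0ℚ ∷ (p *ₚ q)) 0)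
    (trans (ℚ.+-identityʳ _) (coeff-scale a q 0))
  coeff-* (a ∷ p) q (suc i) = trans (coeff-+ (map (a ℚ.*_) q) (0ℚ ∷ (p *ₚ q)) (suc i))
    (cong₂ ℚ._+_ (coeff-scale a q (suc i)) (coeff-* p q i))

  *ₚ-cong : ∀ {p p′ q q′} → p ≈ₚ p′ → q ≈ₚ q′ → p *ₚ q ≈ₚ p′ *ₚ q′
  *ₚ-cong {p} {p′} {q} {q′} p≈p′ q≈q′ i =
    trans (coeff-* p q i) (trans (conv-cong p≈p′ q≈q′ i) (sym (coeff-* p′ q′ i)))

  *ₚ-comm : ∀ p q → p *ₚ q ≈ₚ q *ₚ p
  *ₚ-comm p q i = trans (coeff-* p q i) (trans (conv-comm (coeff p) (coeff q) i) (sym (coeff-* q p i)))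

  *ₚ-assoc : ∀ p q r → (p *ₚ q) *ₚ r ≈ₚ p *ₚ (q *ₚ r)
  *ₚ-assoc p q r i = begin
    coeff ((p *ₚ q) *ₚ r) i                      ≡⟨ coeff-* (p *ₚ q) r i ⟩
    conv (coeff (p *ₚ q)) (coeff r) i            ≡⟨ conv-cong (coeff-* p q) (λ _ → refl) i ⟩
    conv (conv (coeff p) (coeff q)) (coeff r) i  ≡⟨ conv-assoc (coeff p) (coeff q) (coeff r) i ⟩
    conv (coeff p) (conv (coeff q) (coeff r)) i  ≡⟨ conv-cong (λ _ → refl) (coeff-* q r) i ⟨
    conv (coeff p) (coeff (q *ₚ r)) i            ≡⟨ coeff-* p (q *ₚ r) i ⟨
    coeff (p *ₚ (q *ₚ r)) i                      ∎
    where open ≡-Reasoning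

  coeff-constₚ-* : ∀ a p i → coeff (constₚ a *ₚ p) i ≡ a ℚ.* coeff p i
  coeff-constₚ-* a p i = trans (coeff-+ (map (a ℚ.*_) p) (0ℚ ∷ []) i)
    (trans (cong₂ ℚ._+_ (coeff-scale a p i) (coeff-0∷[] i)) (ℚ.+-identityʳ _))
    where
    coeff-0∷[] : ∀ i → coeff (0ℚ ∷ []) i ≡ 0ℚ
    coeff-0∷[] zero    = refl
    coeff-0∷[] (suc i) = refl

  *ₚ-identityˡ : ∀ p → constₚ 1ℚ *ₚ p ≈ₚ p
  *ₚ-identityˡ p i = trans (coeff-constₚ-* 1ℚ p i) (ℚ.*-identityˡ _)

  *ₚ-distribʳ : ∀ p q r → (q +ₚ r) *ₚ p ≈ₚ (q *ₚ p) +ₚ (r *ₚ p)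
  *ₚ-distribʳ p q r i = begin
    coeff ((q +ₚ r) *ₚ p) i
      ≡⟨ coeff-* (q +ₚ r) p i ⟩
    conv (coeff (q +ₚ r)) (coeff p) i
      ≡⟨ conv-cong (coeff-+ q r) (λ _ → refl) i ⟩
    conv (λ k → coeff q k ℚ.+ coeff r k) (coeff p) i
      ≡⟨ conv-distribʳ (coeff q) (coeff r) (coeff p) i ⟩
    conv (coeff q) (coeff p) i ℚ.+ conv (coeff r) (coeff p) i
      ≡⟨ cong₂ ℚ._+_ (coeff-* q p i) (coeff-* r p i) ⟨
    coeff (q *ₚ p) i ℚ.+ coeff (r *ₚ p) i
      ≡⟨ coeff-+ (q *ₚ p) (r *ₚ p) i ⟨
    coeff ((q *ₚ p) +ₚ (r *ₚ p)) i ∎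
    where open ≡-Reasoning

  +ₚ-cong : ∀ {p p′ q q′} → p ≈ₚ p′ → q ≈ₚ q′ → p +ₚ q ≈ₚ p′ +ₚ q′
  +ₚ-cong {p} {p′} {q} {q′} p≈p′ q≈q′ i =
    trans (coeff-+ p q i) (trans (cong₂ ℚ._+_ (p≈p′ i) (q≈q′ i)) (sym (coeff-+ p′ q′ i)))

  +ₚ-comm : ∀ p q → p +ₚ q ≈ₚ q +ₚ p
  +ₚ-comm p q i = trans (coeff-+ p q i) (trans (ℚ.+-comm (coeff p i) (coeff q i)) (sym (coeff-+ q p i)))

  +ₚ-assoc : ∀ p q r → (p +ₚ q) +ₚ r ≈ₚ p +ₚ (q +ₚ r)
  +ₚ-assoc p q r i = begin
    coeff ((p +ₚ q) +ₚ r) i                       ≡⟨ coeff-+ (p +ₚ q) r i ⟩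
    coeff (p +ₚ q) i ℚ.+ coeff r i                ≡⟨ cong (ℚ._+ coeff r i) (coeff-+ p q i) ⟩
    coeff p i ℚ.+ coeff q i ℚ.+ coeff r i         ≡⟨ ℚ.+-assoc (coeff p i) _ _ ⟩
    coeff p i ℚ.+ (coeff q i ℚ.+ coeff r i)       ≡⟨ cong (coeff p i ℚ.+_) (coeff-+ q r i) ⟨
    coeff p i ℚ.+ coeff (q +ₚ r) i                ≡⟨ coeff-+ p (q +ₚ r) i ⟨
    coeff (p +ₚ (q +ₚ r)) i                       ∎
    where open ≡-Reasoning

  -ₚ-inverseˡ : ∀ p → (-ₚ p) +ₚ p ≈ₚ []
  -ₚ-inverseˡ p i = trans (coeff-+ (-ₚ p) p i)
    (trans (cong (ℚ._+ coeff p i) (coeff-neg p i)) (ℚ.+-inverseˡ (coeff p i)))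

  ℚ[x]-isCommutativeRing : IsCommutativeRing _≈ₚ_ _+ₚ_ _*ₚ_ -ₚ_ [] (constₚ 1ℚ)
  ℚ[x]-isCommutativeRing = record
    { isRing = record
      { +-isAbelianGroup = record
        { isGroup = record
          { isMonoid = record
            { isSemigroup = record
              { isMagma = record
                { isEquivalence = record
                  { refl  = λ _ → refl
                  ; sym   = λ p≈q i → sym (p≈q i)
                  ; trans = λ p≈q q≈r i → trans (p≈q i) (q≈r i)
                  }
                ; ∙-cong = λ {p p′ q q′} → +ₚ-cong {p} {p′} {q} {q′}
                }
              ; assoc = +ₚ-assoc
              }
            ; identity = (λ p i → refl) , λ p → +ₚ-comm p []
            }
          ; inverse = -ₚ-inverseˡ , λ p i → trans (+ₚ-comm p (-ₚ p) i) (-ₚ-inverseˡ p i)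
          ; ⁻¹-cong = λ {p q} p≈q i →
              trans (coeff-neg p i) (trans (cong ℚ.-_ (p≈q i)) (sym (coeff-neg q i)))
          }
        ; comm = +ₚ-comm
        }
      ; *-cong     = λ {p p′ q q′} → *ₚ-cong {p} {p′} {q} {q′}
      ; *-assoc    = *ₚ-assoc
      ; *-identity = *ₚ-identityˡ
                   , λ p i → trans (*ₚ-comm p (constₚ 1ℚ) i) (*ₚ-identityˡ p i)
      ; distrib    = (λ p q r i → trans (*ₚ-comm p (q +ₚ r) i) (trans (*ₚ-distribʳ p q r i)
                       (+ₚ-cong {q *ₚ p} {p *ₚ q} {r *ₚ p} {p *ₚ r} (*ₚ-comm q p) (*ₚ-comm r p) i)))
                   , *ₚ-distribʳ
      }
    ; *-comm = *ₚ-comm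
    }

  ℚ[x]-commutativeRing : CommutativeRing 0ℓ 0ℓ
  ℚ[x]-commutativeRing = record { isCommutativeRing = ℚ[x]-isCommutativeRing }

-- Characteristic polynomials of diagonalised matrices.

module CharacteristicPolynomials where

  open Determinants
  open PolynomialRing
  open import Algebra.Bundles using (CommutativeRing)
  open import Algebra.Bundles.Raw using (module RawRing)
  import Algebra.Definitions.RawSemiring as RawSemiringDefs
  import Algebra.Properties.Ring
  import Algebra.Properties.Semiring.Sum
  import Algebra.Properties.CommutativeSemigroup
  open import Data.Bool using (if_then_else_)
  open import Data.Fin using (Fin; zero; suc)
  import Data.Fin.Properties as Fin
  open import Data.List using ([])
  open import Data.Nat using (zero; suc)
  open import Data.Rational as ℚ using (ℚ; 0ℚ; 1ℚ)
  import Data.Rational.Properties as ℚ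
  open import Data.Vec.Functional using (Vector)
  open import Relation.Binary.PropositionalEquality as ≡ using (_≡_; refl; sym; trans)
  open import Relation.Nullary using (yes; no; ⌊_⌋)

  module CharacteristicMatrix {c ℓ} (R : CommutativeRing c ℓ) where
    open CommutativeRing R hiding (zero) renaming (refl to ≈-refl; sym to ≈-sym; trans to ≈-trans)
    open DeterminantTheory R
    open Algebra.Properties.Ring ring using (-‿distribˡ-*; -‿distribʳ-*; -1*x≈-x)
    open Algebra.Properties.Semiring.Sum semiring
      using (sum-cong-≋; ∑-distrib-+; *-distribˡ-sum)
    open RawSemiringDefs (RawRing.rawSemiring rawRing) using () renaming (sum to ∑; product to ∏)
    open Determinant rawRing using (det)
    open import Relation.Binary.Reasoning.Setoid setoid
    private
      module *C = Algebra.Properties.CommutativeSemigroup *-commutativeSemigroup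

    x∙δ- : ∀ {n} → Carrier → Matrix Carrier n → Matrix Carrier n
    x∙δ- x M i j = x * δ i j + - M i j

    ⊡-linear : ∀ {n} (L M N : Matrix Carrier n) x i j →
               ∑ (λ k → L i k * (x * M k j + - N k j)) ≈ x * (L ⊡ M) i j + - (L ⊡ N) i j
    ⊡-linear L M N x i j = begin
      ∑ (λ k → L i k * (x * M k j + - N k j))
        ≈⟨ sum-cong-≋ (λ k → ≈-trans (distribˡ (L i k) (x * M k j) (- N k j))
             (+-cong (*C.x∙yz≈y∙xz (L i k) x (M k j))
               (≈-trans (≈-sym (-‿distribʳ-* (L i k) (N k j))) (≈-sym (-1*x≈-x (L i k * N k j)))))) ⟩
      -- Negation is written as multiplication by -1, so that it leaves the sum by distributivity.
      ∑ (λ k → x * (L i k * M k j) + - 1# * (L i k * N k j))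
        ≈⟨ ∑-distrib-+ (λ k → x * (L i k * M k j)) (λ k → - 1# * (L i k * N k j)) ⟩
      ∑ (λ k → x * (L i k * M k j)) + ∑ (λ k → - 1# * (L i k * N k j))
        ≈⟨ +-cong (*-distribˡ-sum x (λ k → L i k * M k j)) (*-distribˡ-sum (- 1#) (λ k → L i k * N k j)) ⟨
      x * (L ⊡ M) i j + - 1# * (L ⊡ N) i j
        ≈⟨ +-congˡ (-1*x≈-x _) ⟩
      x * (L ⊡ M) i j + - (L ⊡ N) i j ∎

    -- L (x I - M) R equals x L R - L M R, which is diagonal with entries x - d i.
    det-characteristic : ∀ {n} (M L R : Matrix Carrier n) (d : Vector Carrier n) (x : Carrier) →
      L ⊡ R ≋ δ → (∀ i j → (L ⊡ (M ⊡ R)) i j ≈ d i * δ i j) →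
      det (x∙δ- x M) ≈ ∏ λ i → x + - d i
    det-characteristic {n} M L R d x LR≋δ LMR≈d = det-similar L R (λ i → x + - d i) LR≋δ λ i j → begin
      (L ⊡ x∙δ- x M ⊡ R) i j
        ≈⟨ ⊡-assoc L (x∙δ- x M) R i j ⟩
      (L ⊡ (x∙δ- x M ⊡ R)) i j
        ≈⟨ ⊡-cong {M = L} (λ _ _ → ≈-refl) (λ k l → right k l) i j ⟩
      ∑ (λ k → L i k * (x * R k j + - (M ⊡ R) k j))
        ≈⟨ ⊡-linear L R (M ⊡ R) x i j ⟩
      x * (L ⊡ R) i j + - (L ⊡ (M ⊡ R)) i j
        ≈⟨ +-cong (*-congˡ (LR≋δ i j)) (≈-trans (-‿cong (LMR≈d i j)) (-‿distribˡ-* (d i) (δ i j))) ⟩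
      x * δ i j + - d i * δ i j
        ≈⟨ distribʳ (δ i j) x (- d i) ⟨
      (x + - d i) * δ i j ∎
      where
      right : (x∙δ- x M ⊡ R) ≋ (λ k l → x * R k l + - (M ⊡ R) k l)
      right k l = begin
        ∑ (λ m → (x * δ k m + - M k m) * R m l)
          ≈⟨ sum-cong-≋ (λ m → ≈-trans (distribʳ (R m l) (x * δ k m) (- M k m))
               (+-cong (*-assoc x (δ k m) (R m l)) (≈-trans (≈-sym (-‿distribˡ-* (M k m) (R m l))) (≈-sym (-1*x≈-x (M k m * R m l)))))) ⟩
        ∑ (λ m → x * (δ k m * R m l) + - 1# * (M k m * R m l))
          ≈⟨ ∑-distrib-+ (λ m → x * (δ k m * R m l)) (λ m → - 1# * (M k m * R m l)) ⟩
        ∑ (λ m → x * (δ k m * R m l)) + ∑ (λ m → - 1# * (M k m * R m l))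
          ≈⟨ +-cong (*-distribˡ-sum x (λ m → δ k m * R m l)) (*-distribˡ-sum (- 1#) (λ m → M k m * R m l)) ⟨
        x * (δ ⊡ R) k l + - 1# * (M ⊡ R) k l
          ≈⟨ +-cong (*-congˡ (⊡-identityˡ R k l)) (-1*x≈-x _) ⟩
        x * R k l + - (M ⊡ R) k l ∎

  module ℚMat = DeterminantTheory ℚ.+-*-commutativeRing
  module PMat = DeterminantTheory ℚ[x]-commutativeRing
  module P = CommutativeRing ℚ[x]-commutativeRing

  open ℚMat using (_⊡_) renaming (δ to δℚ)

  ∏ₚ : ∀ {n} → Vector Poly n → Poly
  ∏ₚ = RawSemiringDefs.product (RawRing.rawSemiring P.rawRing)

  constₚ-cong : ∀ {a b} → a ≡ b → constₚ a ≈ₚ constₚ b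
  constₚ-cong refl i = refl

  constₚ-* : ∀ a b → constₚ a *ₚ constₚ b ≈ₚ constₚ (a ℚ.* b)
  constₚ-* a b zero    = ℚ.+-identityʳ (a ℚ.* b)
  constₚ-* a b (suc i) = refl

  constₚ-0 : constₚ 0ℚ ≈ₚ []
  constₚ-0 zero    = refl
  constₚ-0 (suc i) = refl

  -- Constants are compatible with matrix products, so a rational diagonalisation becomes one over
  -- ℚ[x], where the variable is available. The agreement is only up to `_≈ₚ_`, as `constₚ 0ℚ` is
  -- not the empty list.
  constₚ-⊡ : ∀ {n} (M N : Matrix ℚ n) i j →
             ((λ i j → constₚ (M i j)) PMat.⊡ λ i j → constₚ (N i j)) i j ≈ₚ constₚ ((M ⊡ N) i j)
  constₚ-⊡ {n} M N i j = go (M i) λ k → N k j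
    where
    sumₚ : ∀ {n} (u v : Vector ℚ n) → Poly
    sumₚ u v = RawSemiringDefs.sum (RawRing.rawSemiring P.rawRing) λ k → constₚ (u k) *ₚ constₚ (v k)
    sumℚ : ∀ {n} (u v : Vector ℚ n) → ℚ
    sumℚ u v = RawSemiringDefs.sum (RawRing.rawSemiring ℚ.+-*-rawRing) λ k → u k ℚ.* v k
    go : ∀ {n} (u v : Vector ℚ n) → sumₚ u v ≈ₚ constₚ (sumℚ u v)
    go {zero}  u v = λ k → sym (constₚ-0 k)
    go {suc n} u v = +ₚ-cong {constₚ (u zero) *ₚ constₚ (v zero)} {constₚ (u zero ℚ.* v zero)}
      {sumₚ u⁺ v⁺} {constₚ (sumℚ u⁺ v⁺)} (constₚ-* (u zero) (v zero)) (go u⁺ v⁺)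
      where
      u⁺ = λ k → u (suc k)
      v⁺ = λ k → v (suc k)

  constₚ-δ : ∀ {n} (i j : Fin n) → constₚ (δℚ i j) ≈ₚ PMat.δ i j
  constₚ-δ zero    zero    = λ _ → refl
  constₚ-δ zero    (suc j) = constₚ-0
  constₚ-δ (suc i) zero    = constₚ-0
  constₚ-δ (suc i) (suc j) = constₚ-δ i j

  charPoly-diagonalisable : ∀ {n} (M L R : Matrix ℚ n) (d : Vector ℚ n) →
    (∀ i j → (L ⊡ R) i j ≡ δℚ i j) → (∀ i j → (L ⊡ (M ⊡ R)) i j ≡ d i ℚ.* δℚ i j) →
    charPoly M ≈ₚ ∏ₚ λ i → varₚ +ₚ -ₚ constₚ (d i)
  charPoly-diagonalisable {n} M L R d LR≡δ LMR≡d = P.trans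
    {charPoly M} {Determinant.det P.rawRing (x∙δ- varₚ (ι M))} {∏ₚ λ i → varₚ +ₚ -ₚ constₚ (d i)}
    (PMat.det-cong {n} {charMatrix} {N = x∙δ- varₚ (ι M)} entry)
    (det-characteristic (ι M) (ι L) (ι R) (λ i → constₚ (d i)) varₚ
      (λ i j → P.trans {(ι L PMat.⊡ ι R) i j} {constₚ ((L ⊡ R) i j)} {PMat.δ i j} (constₚ-⊡ L R i j)
        (P.trans {constₚ ((L ⊡ R) i j)} {constₚ (δℚ i j)} {PMat.δ i j} (constₚ-cong (LR≡δ i j)) (constₚ-δ i j)))
      λ i j → begin
        (ι L PMat.⊡ (ι M PMat.⊡ ι R)) i j
          ≈⟨ PMat.⊡-cong {M = ι L} {ι L} {ι M PMat.⊡ ι R} {ι (M ⊡ R)} (λ _ _ _ → refl) (constₚ-⊡ M R) i j ⟩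
        (ι L PMat.⊡ ι (M ⊡ R)) i j
          ≈⟨ constₚ-⊡ L (M ⊡ R) i j ⟩
        constₚ ((L ⊡ (M ⊡ R)) i j)
          ≈⟨ constₚ-cong (LMR≡d i j) ⟩
        constₚ (d i ℚ.* δℚ i j)
          ≈⟨ constₚ-* (d i) (δℚ i j) ⟨
        constₚ (d i) *ₚ constₚ (δℚ i j)
          ≈⟨ P.*-congˡ {constₚ (d i)} {constₚ (δℚ i j)} {PMat.δ i j} (constₚ-δ i j) ⟩
        constₚ (d i) *ₚ PMat.δ i j ∎)
    where
    open import Relation.Binary.Reasoning.Setoid P.setoid
    open CharacteristicMatrix ℚ[x]-commutativeRing
    charMatrix : Matrix Poly n
    charMatrix i j = (if ⌊ i Fin.≟ j ⌋ then varₚ else []) +ₚ -ₚ constₚ (M i j)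
    ι : Matrix ℚ n → Matrix Poly n
    ι M i j = constₚ (M i j)
    -- `charPoly` finds the diagonal by a decision, `x∙δ-` by a product with `δ`; the product is
    -- evaluated on and off the diagonal.
    entry : ∀ i j → charMatrix i j ≈ₚ x∙δ- varₚ (ι M) i j
    entry i j with i Fin.≟ j
    ... | yes refl rewrite PMat.δ-refl i = P.+-congʳ { -ₚ constₚ (M i i)} {varₚ} {varₚ *ₚ constₚ 1ℚ}
      (P.sym {varₚ *ₚ constₚ 1ℚ} {varₚ} (P.*-identityʳ varₚ))
    ... | no i≢j rewrite PMat.δ-≢ i≢j = P.+-congʳ { -ₚ constₚ (M i j)} {[]} {varₚ *ₚ []}
      (P.sym {varₚ *ₚ []} {[]} (P.zeroʳ varₚ))

-- Totients, divisors and the values of F under multiplication by a prime.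

module Arithmetic where

  open import Data.Bool using (if_then_else_)
  open import Data.Integer as ℤ using (ℤ; +_; -1ℤ)
  import Data.Integer.Properties as ℤ
  open import Data.List using (List; []; _∷_; _++_; map; filter; length; upTo)
  import Data.List.Properties as List
  open import Data.List.Membership.Propositional using (_∈_)
  open import Data.List.Membership.Propositional.Properties
    using (∈-filter⁺; ∈-filter⁻; ∈-map⁺; ∈-map⁻; ∈-upTo⁺; ∈-upTo⁻; ∈-++⁺ˡ; ∈-++⁺ʳ; ∈-++⁻)
  open import Data.List.Membership.Propositional.Properties.WithK using (unique∧set⇒bag)
  open import Data.List.Relation.Binary.BagAndSetEquality using (∼bag⇒↭)
  open import Data.List.Relation.Binary.Permutation.Propositional using (_↭_)
  open import Data.List.Relation.Binary.Permutation.Propositional.Properties using (↭-length)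
  import Data.List.Relation.Unary.All as All
  open import Data.List.Relation.Unary.AllPairs using ([]; _∷_)
  open import Data.List.Relation.Unary.Any using (here; there)
  open import Data.List.Relation.Unary.Unique.Propositional using (Unique)
  import Data.List.Relation.Unary.Unique.Propositional.Properties as Unique
  open import Data.Nat as ℕ using (ℕ; zero; suc; _+_; _*_; _∸_; _≤_; s≤s; z≤n; NonZero)
  import Data.Nat.Properties as ℕ
  open import Algebra.Properties.CommutativeSemigroup ℕ.+-commutativeSemigroup using (interchange)
  open import Data.Nat.Coprimality using (gcd≡1⇒coprime; coprime-divisor)
  open import Data.Nat.Divisibility
  open import Data.Nat.GCD
  open import Data.Nat.ListAction using (sum)
  open import Data.Nat.Primality
    using (Prime; prime?; prime⇒nonZero; prime⇒irreducible; euclidsLemma; ¬prime[1])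
  open import Data.Product using (_×_; _,_; proj₁; proj₂)
  open import Data.Rational as ℚ using (ℚ; 0ℚ)
  import Data.Rational.Properties as ℚ
  import Data.Rational.Unnormalised as ℚᵘ
  import Data.Rational.Unnormalised.Properties as ℚᵘ
  open import Data.Sum using (inj₁; inj₂)
  open import Function using (_∘_; case_of_)
  open import Function.Bundles using (mk⇔)
  open import Relation.Binary.PropositionalEquality as ≡
    using (_≡_; refl; sym; trans; cong; cong₂; subst; module ≡-Reasoning)
  open import Relation.Nullary using (¬_; ¬?; Dec; yes; no; contradiction; does)
  open import Relation.Unary using (Pred) renaming (Decidable to Decidable₁)
  open import Level using (0ℓ)

  -- The counting arguments rest on this: a bijection is replaced by two inclusions between
  -- duplicate-free lists.
  unique-↭ : ∀ {xs ys : List ℕ} → Unique xs → Unique ys →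
             (∀ {x} → x ∈ xs → x ∈ ys) → (∀ {x} → x ∈ ys → x ∈ xs) → xs ↭ ys
  unique-↭ xs! ys! xs⊆ys ys⊆xs = ∼bag⇒↭ (unique∧set⇒bag xs! ys! (mk⇔ xs⊆ys ys⊆xs))

  ∈-range⁺ : ∀ {t n} → 1 ≤ t → t ≤ n → t ∈ map suc (upTo n)
  ∈-range⁺ (s≤s _) t≤n = ∈-map⁺ suc (∈-upTo⁺ t≤n)

  ∈-range⁻ : ∀ {t n} → t ∈ map suc (upTo n) → 1 ≤ t × t ≤ n
  ∈-range⁻ {n = n} t∈ with ∈-map⁻ suc {xs = upTo n} t∈
  ... | _ , u∈ , refl = s≤s z≤n , ∈-upTo⁻ u∈

  range-unique : ∀ n → Unique (map suc (upTo n))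
  range-unique n = Unique.map⁺ ℕ.suc-injective (Unique.upTo⁺ n)

  ∈-divisors⁺ : ∀ {d} n → .{{NonZero n}} → d ∣ n → d ∈ divisors n
  ∈-divisors⁺ {zero}  (suc n) d∣n = contradiction (0∣⇒≡0 d∣n) λ ()
  ∈-divisors⁺ {suc d} n d∣n = ∈-filter⁺ (_∣? n) (∈-range⁺ (s≤s z≤n) (∣⇒≤ d∣n)) d∣n

  ∈-divisors⁻ : ∀ {d} n → d ∈ divisors n → 1 ≤ d × d ∣ n
  ∈-divisors⁻ n d∈ with ∈-filter⁻ (_∣? n) {xs = map suc (upTo n)} d∈
  ... | d∈range , d∣n = proj₁ (∈-range⁻ d∈range) , d∣n

  divisors-unique : ∀ n → Unique (divisors n)
  divisors-unique n = Unique.filter⁺ (_∣? n) (range-unique n)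

  module _ {p : ℕ} (p-prime : Prime p) where
    private instance
      p-nonZero : NonZero p
      p-nonZero = prime⇒nonZero p-prime

    prime∤⇒gcd≡1 : ∀ {k} → ¬ p ∣ k → gcd p k ≡ 1
    prime∤⇒gcd≡1 {k} p∤k with prime⇒irreducible p-prime (gcd[m,n]∣m p k)
    ... | inj₁ eq = eq
    ... | inj₂ eq = contradiction (subst (_∣ k) eq (gcd[m,n]∣n p k)) p∤k

    prime∤1 : ¬ p ∣ 1
    prime∤1 p∣1 = ¬prime[1] (subst Prime (∣1⇒≡1 p∣1) p-prime)

    ∣p*m∧p∤⇒∣m : ∀ {d m} → d ∣ p * m → ¬ p ∣ d → d ∣ m
    ∣p*m∧p∤⇒∣m {d} d∣pm p∤d =
      coprime-divisor (gcd≡1⇒coprime (trans (gcd-comm d p) (prime∤⇒gcd≡1 p∤d))) d∣pm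

    gcd[t,p*m]≡1⁻ : ∀ t m → gcd t (p * m) ≡ 1 → ¬ p ∣ t × gcd t m ≡ 1
    gcd[t,p*m]≡1⁻ t m eq =
        (λ p∣t → prime∤1 (subst (p ∣_) eq (gcd-greatest p∣t (m∣m*n m))))
      , ∣1⇒≡1 (subst (gcd t m ∣_) eq (gcd-greatest (gcd[m,n]∣m t m) (∣-trans (gcd[m,n]∣n t m) (n∣m*n p))))

    gcd[t,p*m]≡1⁺ : ∀ t m → ¬ p ∣ t → gcd t m ≡ 1 → gcd t (p * m) ≡ 1
    gcd[t,p*m]≡1⁺ t m p∤t eq = ∣1⇒≡1 (subst (g ∣_) eq
      (gcd-greatest g∣t (∣p*m∧p∤⇒∣m (gcd[m,n]∣n t (p * m)) λ p∣g → p∤t (∣-trans p∣g g∣t))))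
      where
      g = gcd t (p * m)
      g∣t = gcd[m,n]∣m t (p * m)

    prime∣prime⇒≡ : ∀ {q} → Prime q → q ∣ p → q ≡ p
    prime∣prime⇒≡ q-prime q∣p with prime⇒irreducible p-prime q∣p
    ... | inj₁ refl = contradiction q-prime ¬prime[1]
    ... | inj₂ q≡p  = q≡p

  gcd[m+t,m] : ∀ m t → gcd (m + t) m ≡ gcd t m
  gcd[m+t,m] m t = ∣-antisym
    (gcd-greatest (∣m+n∣m⇒∣n (gcd[m,n]∣m (m + t) m) (gcd[m,n]∣n (m + t) m)) (gcd[m,n]∣n (m + t) m))
    (gcd-greatest (∣m∣n⇒∣m+n (gcd[m,n]∣n t m) (gcd[m,n]∣m t m)) (gcd[m,n]∣n t m))

  -- The range `N` is freed from the modulus `m` to allow several periods; `coprimes m m` is `B 1 m`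
  -- by definition.
  coprimes : ℕ → ℕ → List ℕ
  coprimes N m = filter (λ t → gcd t m ℕ.≟ 1) (map suc (upTo N))

  coprimes-unique : ∀ N m → Unique (coprimes N m)
  coprimes-unique N m = Unique.filter⁺ (λ t → gcd t m ℕ.≟ 1) (range-unique N)

  ∈-coprimes⁺ : ∀ N m {t} → 1 ≤ t → t ≤ N → gcd t m ≡ 1 → t ∈ coprimes N m
  ∈-coprimes⁺ N m 1≤t t≤N eq = ∈-filter⁺ (λ t → gcd t m ℕ.≟ 1) (∈-range⁺ 1≤t t≤N) eq

  ∈-coprimes⁻ : ∀ N m {t} → t ∈ coprimes N m → 1 ≤ t × t ≤ N × gcd t m ≡ 1
  ∈-coprimes⁻ N m t∈ with ∈-filter⁻ (λ t → gcd t m ℕ.≟ 1) {xs = map suc (upTo N)} t∈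
  ... | t∈range , eq = proj₁ (∈-range⁻ t∈range) , proj₂ (∈-range⁻ t∈range) , eq

  coprimes-+ : ∀ N m → coprimes (m + N) m ↭ B 1 m ++ map (m ℕ.+_) (coprimes N m)
  coprimes-+ N m = unique-↭ (coprimes-unique (m + N) m)
    (Unique.++⁺ (coprimes-unique m m) (Unique.map⁺ (ℕ.+-cancelˡ-≡ m _ _) (coprimes-unique N m)) disjoint)
    split join
    where
    disjoint : ∀ {t} → ¬ (t ∈ coprimes m m × t ∈ map (m ℕ.+_) (coprimes N m))
    disjoint (t∈₁ , t∈₂) with ∈-map⁻ (m ℕ.+_) t∈₂
    ... | s , s∈ , refl = ℕ.<⇒≱ (ℕ.m<m+n m (proj₁ (∈-coprimes⁻ N m s∈))) (proj₁ (proj₂ (∈-coprimes⁻ m m t∈₁)))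
    split : ∀ {t} → t ∈ coprimes (m + N) m → t ∈ B 1 m ++ map (m ℕ.+_) (coprimes N m)
    split {t} t∈ with ∈-coprimes⁻ (m + N) m t∈ | t ℕ.≤? m
    ... | 1≤t , t≤ , eq | yes t≤m = ∈-++⁺ˡ (∈-coprimes⁺ m m 1≤t t≤m eq)
    ... | 1≤t , t≤ , eq | no t≰m  = ∈-++⁺ʳ (B 1 m) (subst (_∈ map (m ℕ.+_) (coprimes N m)) m+s≡t
      (∈-map⁺ (m ℕ.+_) (∈-coprimes⁺ N m (ℕ.m<n⇒0<n∸m (ℕ.≰⇒> t≰m))
        (ℕ.≤-trans (ℕ.∸-monoˡ-≤ m t≤) (ℕ.≤-reflexive (ℕ.m+n∸m≡n m N)))
        (trans (sym (gcd[m+t,m] m (t ∸ m))) (trans (cong (λ s → gcd s m) m+s≡t) eq)))))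
      where m+s≡t = ℕ.m+[n∸m]≡n (ℕ.<⇒≤ (ℕ.≰⇒> t≰m))
    join : ∀ {t} → t ∈ B 1 m ++ map (m ℕ.+_) (coprimes N m) → t ∈ coprimes (m + N) m
    join t∈ with ∈-++⁻ (B 1 m) t∈
    ... | inj₁ t∈₁ with ∈-coprimes⁻ m m t∈₁
    ...   | 1≤t , t≤m , eq = ∈-coprimes⁺ (m + N) m 1≤t (ℕ.≤-trans t≤m (ℕ.m≤m+n m N)) eq
    join t∈ | inj₂ t∈₂ with ∈-map⁻ (m ℕ.+_) t∈₂
    ... | s , s∈ , refl with ∈-coprimes⁻ N m s∈
    ...   | 1≤s , s≤N , eq = ∈-coprimes⁺ (m + N) m (ℕ.≤-trans 1≤s (ℕ.m≤n+m s m)) (ℕ.+-monoʳ-≤ m s≤N)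
                               (trans (gcd[m+t,m] m s) eq)

  -- Being prime to `m` has period `m`, and each of the `k` periods contains `φ m` such numbers.
  length-coprimes : ∀ k m → length (coprimes (k * m) m) ≡ k * φ m
  length-coprimes zero    m = refl
  length-coprimes (suc k) m = begin
    length (coprimes (m + k * m) m)                        ≡⟨ ↭-length (coprimes-+ (k * m) m) ⟩
    length (B 1 m ++ map (m ℕ.+_) (coprimes (k * m) m))      ≡⟨ List.length-++ (B 1 m) ⟩
    φ m + length (map (m ℕ.+_) (coprimes (k * m) m))         ≡⟨ cong (ℕ._+_ (φ m)) (List.length-map (m ℕ.+_) (coprimes (k * m) m)) ⟩
    φ m + length (coprimes (k * m) m)                      ≡⟨ cong (ℕ._+_ (φ m)) (length-coprimes k m) ⟩
    φ m + k * φ m                                          ∎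
    where open ≡-Reasoning

  module _ {p : ℕ} (p-prime : Prime p) where
    private instance
      p-nonZero : NonZero p
      p-nonZero = prime⇒nonZero p-prime

    -- Every prime factor of `p * m` already divides `m`, so the numbers prime to either are the
    -- same, now counted over `p` periods of `m`.
    φ-*-∣ : ∀ {m} → p ∣ m → φ (p * m) ≡ p * φ m
    φ-*-∣ {m} p∣m = trans (↭-length same) (length-coprimes p m)
      where
      same : B 1 (p * m) ↭ coprimes (p * m) m
      same = unique-↭ (coprimes-unique (p * m) (p * m)) (coprimes-unique (p * m) m)
        (λ {t} t∈ → let 1≤t , t≤ , eq = ∈-coprimes⁻ (p * m) (p * m) t∈ in
          ∈-coprimes⁺ (p * m) m 1≤t t≤ (proj₂ (gcd[t,p*m]≡1⁻ p-prime t m eq)))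
        (λ {t} t∈ → let 1≤t , t≤ , eq = ∈-coprimes⁻ (p * m) m t∈ in
          ∈-coprimes⁺ (p * m) (p * m) 1≤t t≤ (gcd[t,p*m]≡1⁺ p-prime t m
            (λ p∣t → prime∤1 p-prime (subst (p ∣_) eq (gcd-greatest p∣t p∣m))) eq))

    gcd[p*s,m]≡1⁺ : ∀ s m → ¬ p ∣ m → gcd s m ≡ 1 → gcd (p * s) m ≡ 1
    gcd[p*s,m]≡1⁺ s m p∤m eq =
      trans (gcd-comm (p * s) m) (gcd[t,p*m]≡1⁺ p-prime m s p∤m (trans (gcd-comm m s) eq))

    gcd[p*s,m]≡1⁻ : ∀ s m → gcd (p * s) m ≡ 1 → gcd s m ≡ 1
    gcd[p*s,m]≡1⁻ s m eq =
      trans (gcd-comm s m) (proj₂ (gcd[t,p*m]≡1⁻ p-prime m s (trans (gcd-comm m (p * s)) eq)))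

    -- A number that is prime to `m` either avoids `p`, and is then prime to `p * m`, or is `p * s`
    -- with `s` prime to `m`. There are `φ m` of the second kind, which turns the factor `p` into
    -- `p ∸ 1` in `φ-*-∤`.
    coprimes-∤ : ∀ {m} → ¬ p ∣ m → coprimes (p * m) m ↭ B 1 (p * m) ++ map (p *_) (B 1 m)
    coprimes-∤ {m} p∤m = unique-↭ (coprimes-unique (p * m) m)
      (Unique.++⁺ (coprimes-unique (p * m) (p * m))
        (Unique.map⁺ (ℕ.*-cancelˡ-≡ _ _ p) (coprimes-unique m m)) disjoint)
      split join
      where
      prime-to-p : ∀ {t} → t ∈ B 1 (p * m) → ¬ p ∣ t
      prime-to-p {t} t∈ = proj₁ (gcd[t,p*m]≡1⁻ p-prime t m (proj₂ (proj₂ (∈-coprimes⁻ (p * m) (p * m) t∈))))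
      disjoint : ∀ {t} → ¬ (t ∈ B 1 (p * m) × t ∈ map (p *_) (B 1 m))
      disjoint (t∈₁ , t∈₂) = let s , _ , t≡p*s = ∈-map⁻ (p *_) t∈₂ in
        prime-to-p t∈₁ (divides s (trans t≡p*s (ℕ.*-comm p s)))
      multiple : ∀ s → p * s ∈ coprimes (p * m) m → s ∈ B 1 m
      multiple s ps∈ = let 1≤ps , ps≤pm , eq = ∈-coprimes⁻ (p * m) m ps∈ in
        ∈-coprimes⁺ m m (ℕ.>-nonZero⁻¹ s {{ℕ.m*n≢0⇒n≢0 p {{ℕ.>-nonZero 1≤ps}}}})
          (ℕ.*-cancelˡ-≤ p ps≤pm) (gcd[p*s,m]≡1⁻ s m eq)
      split : ∀ {t} → t ∈ coprimes (p * m) m → t ∈ B 1 (p * m) ++ map (p *_) (B 1 m)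
      split {t} t∈ = case p ∣? t of λ where
        (no p∤t) → let 1≤t , t≤ , eq = ∈-coprimes⁻ (p * m) m t∈ in
          ∈-++⁺ˡ (∈-coprimes⁺ (p * m) (p * m) 1≤t t≤ (gcd[t,p*m]≡1⁺ p-prime t m p∤t eq))
        (yes (divides s t≡s*p)) → let t≡p*s = trans t≡s*p (ℕ.*-comm s p) in
          ∈-++⁺ʳ (B 1 (p * m)) (subst (_∈ map (p *_) (B 1 m)) (sym t≡p*s)
            (∈-map⁺ (p *_) (multiple s (subst (_∈ coprimes (p * m) m) t≡p*s t∈))))
      join : ∀ {t} → t ∈ B 1 (p * m) ++ map (p *_) (B 1 m) → t ∈ coprimes (p * m) m
      join {t} t∈ = case ∈-++⁻ (B 1 (p * m)) t∈ of λ where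
        (inj₁ t∈₁) → let 1≤t , t≤ , eq = ∈-coprimes⁻ (p * m) (p * m) t∈₁ in
          ∈-coprimes⁺ (p * m) m 1≤t t≤ (proj₂ (gcd[t,p*m]≡1⁻ p-prime t m eq))
        (inj₂ t∈₂) → let s , s∈ , t≡p*s = ∈-map⁻ (p *_) t∈₂
                         1≤s , s≤m , eq = ∈-coprimes⁻ m m s∈ in
          subst (_∈ coprimes (p * m) m) (sym t≡p*s) (∈-coprimes⁺ (p * m) m
            (ℕ.≤-trans 1≤s (ℕ.m≤n*m s p)) (ℕ.*-monoʳ-≤ p s≤m) (gcd[p*s,m]≡1⁺ s m p∤m eq))

    φ-*-∤ : ∀ {m} → ¬ p ∣ m → φ (p * m) ≡ (p ∸ 1) * φ m
    φ-*-∤ {m} p∤m = begin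
      φ (p * m)                          ≡⟨ ℕ.m+n∸n≡m (φ (p * m)) (φ m) ⟨
      φ (p * m) + φ m ∸ φ m              ≡⟨ cong (_∸ φ m) count ⟩
      p * φ m ∸ φ m                      ≡⟨ cong (p * φ m ∸_) (ℕ.*-identityˡ (φ m)) ⟨
      p * φ m ∸ 1 * φ m                  ≡⟨ ℕ.*-distribʳ-∸ (φ m) p 1 ⟨
      (p ∸ 1) * φ m                      ∎
      where
      open ≡-Reasoning
      count : φ (p * m) + φ m ≡ p * φ m
      count = begin
        φ (p * m) + φ m                                ≡⟨ cong (ℕ._+_ (φ (p * m))) (List.length-map (p *_) (B 1 m)) ⟨
        φ (p * m) + length (map (p *_) (B 1 m))        ≡⟨ List.length-++ (B 1 (p * m)) ⟨
        length (B 1 (p * m) ++ map (p *_) (B 1 m))     ≡⟨ ↭-length (coprimes-∤ p∤m) ⟨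
        length (coprimes (p * m) m)                    ≡⟨ length-coprimes p m ⟩
        p * φ m                                        ∎

    divisors-∤ : ∀ {m} → .{{NonZero m}} → ¬ p ∣ m →
                 divisors (p * m) ↭ divisors m ++ map (p *_) (divisors m)
    divisors-∤ {m} p∤m = unique-↭ (divisors-unique (p * m))
      (Unique.++⁺ (divisors-unique m) (Unique.map⁺ (ℕ.*-cancelˡ-≡ _ _ p) (divisors-unique m)) disjoint)
      split join
      where
      disjoint : ∀ {d} → ¬ (d ∈ divisors m × d ∈ map (p *_) (divisors m))
      disjoint (d∈₁ , d∈₂) with ∈-map⁻ (p *_) d∈₂
      ... | e , e∈ , refl = p∤m (∣-trans (m∣m*n e) (proj₂ (∈-divisors⁻ m d∈₁)))
      split : ∀ {d} → d ∈ divisors (p * m) → d ∈ divisors m ++ map (p *_) (divisors m)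
      split {d} d∈ with ∈-divisors⁻ (p * m) d∈ | p ∣? d
      ... | _ , d∣pm | no p∤d = ∈-++⁺ˡ (∈-divisors⁺ m (∣p*m∧p∤⇒∣m p-prime d∣pm p∤d))
      ... | _ , d∣pm | yes (divides e d≡e*p) with trans d≡e*p (ℕ.*-comm e p)
      ...   | refl = ∈-++⁺ʳ (divisors m) (∈-map⁺ (p *_) (∈-divisors⁺ m (*-cancelˡ-∣ p d∣pm)))
      join : ∀ {d} → d ∈ divisors m ++ map (p *_) (divisors m) → d ∈ divisors (p * m)
      join d∈ with ∈-++⁻ (divisors m) d∈
      ... | inj₁ d∈₁ = ∈-divisors⁺ (p * m) {{ℕ.m*n≢0 p m}} (∣-trans (proj₂ (∈-divisors⁻ m d∈₁)) (n∣m*n p))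
      ... | inj₂ d∈₂ with ∈-map⁻ (p *_) d∈₂
      ...   | e , e∈ , refl = ∈-divisors⁺ (p * m) {{ℕ.m*n≢0 p m}} (*-monoʳ-∣ p (proj₂ (∈-divisors⁻ m e∈)))

    -- Used when `p ∣ m`, where the new divisors all have eigenvalue zero; only their total weight
    -- matters then, and no explicit list of them is required.
    divisors-∣ : ∀ m → .{{NonZero m}} →
                 divisors (p * m) ↭ divisors m ++ filter (λ d → ¬? (d ∣? m)) (divisors (p * m))
    divisors-∣ m = unique-↭ (divisors-unique (p * m))
      (Unique.++⁺ (divisors-unique m) (Unique.filter⁺ (λ d → ¬? (d ∣? m)) (divisors-unique (p * m))) disjoint)
      split join
      where
      new⁻ : ∀ {d} → d ∈ filter (λ d → ¬? (d ∣? m)) (divisors (p * m)) → d ∈ divisors (p * m) × ¬ d ∣ m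
      new⁻ = ∈-filter⁻ (λ d → ¬? (d ∣? m)) {xs = divisors (p * m)}
      disjoint : ∀ {d} → ¬ (d ∈ divisors m × d ∈ filter (λ d → ¬? (d ∣? m)) (divisors (p * m)))
      disjoint (d∈₁ , d∈₂) = proj₂ (new⁻ d∈₂) (proj₂ (∈-divisors⁻ m d∈₁))
      split : ∀ {d} → d ∈ divisors (p * m) → d ∈ divisors m ++ filter (λ d → ¬? (d ∣? m)) (divisors (p * m))
      split {d} d∈ with d ∣? m
      ... | yes d∣m = ∈-++⁺ˡ (∈-divisors⁺ m d∣m)
      ... | no d∤m  = ∈-++⁺ʳ (divisors m) (∈-filter⁺ (λ d → ¬? (d ∣? m)) d∈ d∤m)
      join : ∀ {d} → d ∈ divisors m ++ filter (λ d → ¬? (d ∣? m)) (divisors (p * m)) → d ∈ divisors (p * m)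
      join d∈ with ∈-++⁻ (divisors m) d∈
      ... | inj₁ d∈₁ = ∈-divisors⁺ (p * m) {{ℕ.m*n≢0 p m}} (∣-trans (proj₂ (∈-divisors⁻ m d∈₁)) (n∣m*n p))
      ... | inj₂ d∈₂ = proj₁ (new⁻ d∈₂)

    -- A divisor of `p * m` that does not divide `m` contains `p` once more than `m` does, hence at
    -- least twice.
    new-divisor-nonSquareFree : ∀ {d m} → p ∣ m → d ∣ p * m → ¬ d ∣ m → NonSquareFree d
    new-divisor-nonSquareFree {d} {m} p∣m d∣pm d∤m with p ∣? d
    ... | no p∤d = contradiction (∣p*m∧p∤⇒∣m p-prime d∣pm p∤d) d∤m
    ... | yes (divides e d≡e*p) with trans d≡e*p (ℕ.*-comm e p)
    ...   | refl with p ∣? e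
    ...     | yes p∣e = p , p-prime , *-monoʳ-∣ p (subst (_∣ e) (sym (ℕ.*-identityʳ p)) p∣e)
    -- If `p` occurred only once in d = p e, then e would divide k = m / p, and d would divide m.
    ...     | no p∤e with p∣m
    ...       | divides k refl = contradiction
      (subst (p * e ∣_) (ℕ.*-comm p k) (*-monoʳ-∣ p (∣p*m∧p∤⇒∣m p-prime
        (subst (e ∣_) (ℕ.*-comm k p) (*-cancelˡ-∣ p d∣pm)) p∤e))) d∤m

    -- The square is not p², since p does not divide d; for another prime r, the square r² is prime
    -- to p, which therefore cancels.
    nonSquareFree-*⁻ : ∀ {d} → ¬ p ∣ d → NonSquareFree (p * d) → NonSquareFree d
    nonSquareFree-*⁻ {d} p∤d (r , r-prime , r²∣pd) with r ℕ.≟ p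
    ... | yes refl = contradiction (subst (_∣ d) (ℕ.*-identityʳ p) (*-cancelˡ-∣ p r²∣pd)) p∤d
    ... | no r≢p   = r , r-prime , ∣p*m∧p∤⇒∣m p-prime r²∣pd p∤r²
      where
      p∤r : ¬ p ∣ r
      p∤r p∣r = r≢p (sym (prime∣prime⇒≡ r-prime p-prime p∣r))
      p∤r² : ¬ p ∣ r ℕ.^ 2
      p∤r² p∣r² with euclidsLemma r (r * 1) p-prime p∣r²
      ... | inj₁ p∣r   = p∤r p∣r
      ... | inj₂ p∣r*1 = p∤r (subst (p ∣_) (ℕ.*-identityʳ r) p∣r*1)

    ω-* : ∀ {d} → .{{NonZero d}} → ¬ p ∣ d → ω (p * d) ≡ suc (ω d)
    ω-* {d} p∤d = ↭-length (unique-↭ (Unique.filter⁺ prime? (divisors-unique (p * d)))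
      (All.tabulate (λ {q} q∈ p≡q → p∤d (subst (_∣ d) (sym p≡q) (proj₁ (primes⁻ q∈))))
        ∷ Unique.filter⁺ prime? (divisors-unique d))
      split join)
      where
      primes⁻ : ∀ {q k} → q ∈ filter prime? (divisors k) → q ∣ k × Prime q
      primes⁻ {k = k} q∈ with ∈-filter⁻ prime? {xs = divisors k} q∈
      ... | q∈divisors , q-prime = proj₂ (∈-divisors⁻ k q∈divisors) , q-prime
      primes⁺ : ∀ {q k} → .{{NonZero k}} → q ∣ k → Prime q → q ∈ filter prime? (divisors k)
      primes⁺ {k = k} q∣k q-prime = ∈-filter⁺ prime? (∈-divisors⁺ k q∣k) q-prime
      split : ∀ {q} → q ∈ filter prime? (divisors (p * d)) → q ∈ p ∷ filter prime? (divisors d)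
      split q∈ with primes⁻ {k = p * d} q∈
      ... | q∣pd , q-prime with euclidsLemma p d q-prime q∣pd
      ...   | inj₁ q∣p = here (prime∣prime⇒≡ p-prime q-prime q∣p)
      ...   | inj₂ q∣d = there (primes⁺ q∣d q-prime)
      join : ∀ {q} → q ∈ p ∷ filter prime? (divisors d) → q ∈ filter prime? (divisors (p * d))
      join (here refl) = primes⁺ {{ℕ.m*n≢0 p d}} (m∣m*n d) p-prime
      join (there q∈) with primes⁻ {k = d} q∈
      ... | q∣d , q-prime = primes⁺ {{ℕ.m*n≢0 p d}} (∣-trans q∣d (n∣m*n p)) q-prime

  sum-map-+ : ∀ (f g : ℕ → ℕ) xs → sum (map (λ x → f x + g x) xs) ≡ sum (map f xs) + sum (map g xs)
  sum-map-+ f g []       = refl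
  sum-map-+ f g (x ∷ xs) = trans (cong (ℕ._+_ (f x + g x)) (sum-map-+ f g xs)) (interchange (f x) (g x) _ _)

  sum-map-const : ∀ c (xs : List ℕ) → sum (map (λ _ → c) xs) ≡ length xs * c
  sum-map-const c []       = refl
  sum-map-const c (x ∷ xs) = cong (c ℕ.+_) (sum-map-const c xs)

  module _ {P : Pred ℕ 0ℓ} (P? : Decidable₁ P) where

    length-filter-∷ : ∀ x xs → length (filter P? (x ∷ xs)) ≡ (if does (P? x) then 1 else 0) + length (filter P? xs)
    length-filter-∷ x xs with P? x
    ... | yes _ = refl
    ... | no _  = refl

    length-filter : ∀ xs → length (filter P? xs) ≡ sum (map (λ x → if does (P? x) then 1 else 0) xs)
    length-filter []       = refl
    length-filter (x ∷ xs) = trans (length-filter-∷ x xs) (cong (_ ℕ.+_) (length-filter xs))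

  double-counting : ∀ {P : ℕ → ℕ → Set} (P? : ∀ d t → Dec (P d t)) ds ts →
    sum (map (λ d → length (filter (P? d) ts)) ds) ≡ sum (map (λ t → length (filter (λ d → P? d t) ds)) ts)
  double-counting P? ds []       = trans (sum-map-const 0 ds) (ℕ.*-zeroʳ (length ds))
  double-counting P? ds (t ∷ ts) = begin
    sum (map (λ d → length (filter (P? d) (t ∷ ts))) ds)
      ≡⟨ cong sum (List.map-cong (λ d → length-filter-∷ (P? d) t ts) ds) ⟩
    sum (map (λ d → (if does (P? d t) then 1 else 0) + length (filter (P? d) ts)) ds)
      ≡⟨ sum-map-+ (λ d → if does (P? d t) then 1 else 0) (λ d → length (filter (P? d) ts)) ds ⟩
    sum (map (λ d → if does (P? d t) then 1 else 0) ds) + sum (map (λ d → length (filter (P? d) ts)) ds)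
      ≡⟨ cong₂ _+_ (sym (length-filter (λ d → P? d t) ds)) (double-counting P? ds ts) ⟩
    length (filter (λ d → P? d t) ds) + sum (map (λ t → length (filter (λ d → P? d t) ds)) ts) ∎
    where open ≡-Reasoning

  map-cong-∈ : ∀ {a} {A : Set a} {f g : ℕ → A} xs → (∀ {x} → x ∈ xs → f x ≡ g x) → map f xs ≡ map g xs
  map-cong-∈ xs f≗g = List.map-cong-local (All.tabulate {xs = xs} f≗g)

  -- Each t ≤ n is counted at the denominator d of the reduced fraction t / n,
  -- that is at the d with d * gcd t n ≡ n.
  sum-φ-divisors : ∀ n → .{{NonZero n}} → sum (map φ (divisors n)) ≡ n
  sum-φ-divisors n = begin
    sum (map φ (divisors n))
      ≡⟨ cong sum (map-cong-∈ (divisors n) fibre) ⟩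
    sum (map (λ d → length (filter (denominator? d) ts)) (divisors n))
      ≡⟨ double-counting denominator? (divisors n) ts ⟩
    sum (map (λ t → length (filter (λ d → denominator? d t) (divisors n))) ts)
      ≡⟨ cong sum (map-cong-∈ ts λ {t} _ → one t) ⟩
    sum (map (λ _ → 1) ts)
      ≡⟨ sum-map-const 1 ts ⟩
    length ts * 1
      ≡⟨ ℕ.*-identityʳ (length ts) ⟩
    length ts
      ≡⟨ trans (List.length-map suc (upTo n)) (List.length-upTo n) ⟩
    n ∎
    where
    open ≡-Reasoning
    ts = map suc (upTo n)
    denominator? : ∀ d t → Dec (d * gcd t n ≡ n)
    denominator? d t = d * gcd t n ℕ.≟ n
    one : ∀ t → length (filter (λ d → denominator? d t) (divisors n)) ≡ 1
    one t with gcd[m,n]∣n t n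
    ... | divides q n≡q*g = ↭-length (unique-↭ {ys = q ∷ []}
      (Unique.filter⁺ (λ d → denominator? d t) (divisors-unique n)) (All.[] ∷ [])
      (λ d∈ → here (ℕ.*-cancelʳ-≡ _ q (gcd t n)
        (trans (proj₂ (∈-filter⁻ (λ d → denominator? d t) {xs = divisors n} d∈)) n≡q*g)))
      λ { (here refl) → ∈-filter⁺ (λ d → denominator? d t)
            (∈-divisors⁺ n (subst (q ∣_) (sym n≡q*g) (m∣m*n (gcd t n)))) (sym n≡q*g) })
      where
      instance
        g≢0 : NonZero (gcd t n)
        g≢0 = ℕ.≢-nonZero (gcd[m,n]≢0 t n (inj₂ (ℕ.≢-nonZero⁻¹ n)))
    -- With n = k d the condition d · gcd(t, n) = n says gcd(t, n) = k, so that t = k s with s prime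
    -- to d.
    fibre : ∀ {d} → d ∈ divisors n → φ d ≡ length (filter (denominator? d) ts)
    fibre {d} d∈ with ∈-divisors⁻ n d∈
    ... | 1≤d , divides k n≡k*d = sym (trans (↭-length (unique-↭
        (Unique.filter⁺ (denominator? d) (range-unique n))
        (Unique.map⁺ (ℕ.*-cancelˡ-≡ _ _ k) (coprimes-unique d d)) to from))
      (List.length-map (k *_) (B 1 d)))
      where
      instance
        d≢0 : NonZero d
        d≢0 = ℕ.>-nonZero 1≤d
        k≢0 : NonZero k
        k≢0 = ℕ.m*n≢0⇒m≢0 k {{subst NonZero n≡k*d (ℕ.≢-nonZero (ℕ.≢-nonZero⁻¹ n))}}
      gcd-k* : ∀ s → gcd (k * s) n ≡ k * gcd s d
      gcd-k* s = trans (cong (gcd (k * s)) n≡k*d) (sym (c*gcd[m,n]≡gcd[cm,cn] k s d))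
      to : ∀ {t} → t ∈ filter (denominator? d) ts → t ∈ map (k *_) (B 1 d)
      to {t} t∈ with ∈-filter⁻ (denominator? d) {xs = ts} t∈
      ... | t∈ts , d*g≡n with ℕ.*-cancelˡ-≡ (gcd t n) k d (trans d*g≡n (trans n≡k*d (ℕ.*-comm k d)))
      ...   | g≡k with subst (_∣ t) g≡k (gcd[m,n]∣m t n)
      ...     | divides s t≡s*k with trans t≡s*k (ℕ.*-comm s k) | ∈-range⁻ t∈ts
      ...       | refl | 1≤t , t≤n = ∈-map⁺ (k *_) (∈-coprimes⁺ d d
        (ℕ.>-nonZero⁻¹ s {{ℕ.m*n≢0⇒n≢0 k {{ℕ.>-nonZero 1≤t}}}})
        (ℕ.*-cancelˡ-≤ k (subst (k * s ≤_) n≡k*d t≤n))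
        (ℕ.*-cancelˡ-≡ (gcd s d) 1 k (trans (sym (gcd-k* s)) (trans g≡k (sym (ℕ.*-identityʳ k))))))
      from : ∀ {t} → t ∈ map (k *_) (B 1 d) → t ∈ filter (denominator? d) ts
      from t∈ with ∈-map⁻ (k *_) t∈
      ... | s , s∈ , refl with ∈-coprimes⁻ d d s∈
      ...   | 1≤s , s≤d , eq = ∈-filter⁺ (denominator? d)
        (∈-range⁺ (ℕ.≤-trans 1≤s (ℕ.m≤n*m s k)) (subst (k * s ≤_) (sym n≡k*d) (ℕ.*-monoʳ-≤ k s≤d)))
        (trans (cong (d *_) (trans (gcd-k* s) (trans (cong (k *_) eq) (ℕ.*-identityʳ k))))
          (trans (ℕ.*-comm d k) (sym n≡k*d)))

  -- `ℚ._/_` reduces to lowest terms, which obscures products; on unnormalised fractions the claim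
  -- is an identity of integers.
  *-/ : ∀ i j n → .{{_ : NonZero n}} → (i ℤ.* j) ℚ./ n ≡ (i ℚ./ 1) ℚ.* (j ℚ./ n)
  *-/ i j (suc n) = ℚ.toℚᵘ-injective (begin
    ℚ.toℚᵘ ((i ℤ.* j) ℚ./ suc n)              ≈⟨ ℚ.toℚᵘ-fromℚᵘ (ℚᵘ.mkℚᵘ (i ℤ.* j) n) ⟩
    ℚᵘ.mkℚᵘ (i ℤ.* j) n                       ≈⟨ ℚᵘ.*≡* (cong (λ k → i ℤ.* j ℤ.* + suc k) (ℕ.+-identityʳ n)) ⟩
    ℚᵘ.mkℚᵘ i 0 ℚᵘ.* ℚᵘ.mkℚᵘ j n              ≈⟨ ℚᵘ.*-cong (ℚ.toℚᵘ-fromℚᵘ (ℚᵘ.mkℚᵘ i 0)) (ℚ.toℚᵘ-fromℚᵘ (ℚᵘ.mkℚᵘ j n)) ⟨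
    ℚ.toℚᵘ (i ℚ./ 1) ℚᵘ.* ℚ.toℚᵘ (j ℚ./ suc n) ≈⟨ ℚ.toℚᵘ-homo-* (i ℚ./ 1) (j ℚ./ suc n) ⟨
    ℚ.toℚᵘ ((i ℚ./ 1) ℚ.* (j ℚ./ suc n))      ∎)
    where open import Relation.Binary.Reasoning.Setoid ℚᵘ.≃-setoid

  *-cancel-/ : ∀ i k n → .{{_ : NonZero n}} → .{{_ : NonZero (k * n)}} →
               (i ℤ.* + k) ℚ./ (k * n) ≡ i ℚ./ n
  *-cancel-/ i (suc k) (suc n) = ℚ.fromℚᵘ-cong {ℚᵘ.mkℚᵘ (i ℤ.* + suc k) (n + k * suc n)} {ℚᵘ.mkℚᵘ i n}
    (ℚᵘ.*≡* (trans (ℤ.*-assoc i (+ suc k) (+ suc n)) (cong (i ℤ.*_) (sym (ℤ.pos-* (suc k) (suc n))))))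

  -- `F n d` depends on `n` only through the factor `φ n` of its numerator.
  F-scale : ∀ {n n′} k d → φ n′ ≡ k * φ n → F n′ d ≡ (+ k ℚ./ 1) ℚ.* F n d
  F-scale k zero eq = sym (ℚ.*-zeroʳ (+ k ℚ./ 1))
  F-scale {n} {n′} k d@(suc _) eq = trans
    (cong (λ i → (i ℚ./ φ d) {{φ-nonZero d}}) numerators)
    (*-/ (+ k) (-1ℤ ℤ.^ ω d ℤ.* + φ n) (φ d) {{φ-nonZero d}})
    where
    open ≡-Reasoning
    s = -1ℤ ℤ.^ ω d
    numerators : s ℤ.* + φ n′ ≡ + k ℤ.* (s ℤ.* + φ n)
    numerators = begin
      s ℤ.* + φ n′             ≡⟨ cong (λ i → s ℤ.* + i) eq ⟩
      s ℤ.* + (k * φ n)        ≡⟨ cong (s ℤ.*_) (ℤ.pos-* k (φ n)) ⟩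
      s ℤ.* (+ k ℤ.* + φ n)    ≡⟨ ℤ.*-assoc s (+ k) (+ φ n) ⟨
      s ℤ.* + k ℤ.* + φ n      ≡⟨ cong (ℤ._* + φ n) (ℤ.*-comm s (+ k)) ⟩
      + k ℤ.* s ℤ.* + φ n      ≡⟨ ℤ.*-assoc (+ k) s (+ φ n) ⟩
      + k ℤ.* (s ℤ.* + φ n)    ∎

  -- Both φ(m) and φ(d) acquire the factor p - 1, which cancels, and the additional prime factor of
  -- the divisor changes the sign.
  F-flip : ∀ {p m d} → Prime p → .{{NonZero m}} → .{{NonZero d}} → ¬ p ∣ m → ¬ p ∣ d →
           F (p * m) (p * d) ≡ (-1ℤ ℚ./ 1) ℚ.* F m d
  F-flip {zero}      p-prime p∤m p∤d with () ← prime⇒nonZero p-prime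
  F-flip {p@(suc q)} {m} {d@(suc _)} p-prime p∤m p∤d = trans
    (ℚ./-cong {q₁ = φ (p * d)} {q₂ = q * φ d} {{φ-nonZero (p * d) {{ℕ.m*n≢0 p d}}}} {{q*φ-nonZero}} numerators (φ-*-∤ p-prime p∤d))
    (trans (*-cancel-/ (-1ℤ ℤ.* (s ℤ.* + φ m)) q (φ d) {{φ-nonZero d}} {{q*φ-nonZero}})
      (*-/ -1ℤ (s ℤ.* + φ m) (φ d) {{φ-nonZero d}}))
    where
    open ≡-Reasoning
    s = -1ℤ ℤ.^ ω d
    q*φ-nonZero : NonZero (q * φ d)
    q*φ-nonZero = subst NonZero (φ-*-∤ p-prime p∤d) (φ-nonZero (p * d) {{ℕ.m*n≢0 p d}})
    numerators : -1ℤ ℤ.^ ω (p * d) ℤ.* + φ (p * m) ≡ -1ℤ ℤ.* (s ℤ.* + φ m) ℤ.* + q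
    numerators = begin
      -1ℤ ℤ.^ ω (p * d) ℤ.* + φ (p * m)     ≡⟨ cong₂ (λ k i → -1ℤ ℤ.^ k ℤ.* + i) (ω-* p-prime p∤d) (φ-*-∤ p-prime p∤m) ⟩
      -1ℤ ℤ.* s ℤ.* + (q * φ m)             ≡⟨ cong (λ i → -1ℤ ℤ.* s ℤ.* i) (trans (cong +_ (ℕ.*-comm q (φ m))) (ℤ.pos-* (φ m) q)) ⟩
      -1ℤ ℤ.* s ℤ.* (+ φ m ℤ.* + q)         ≡⟨ ℤ.*-assoc (-1ℤ ℤ.* s) (+ φ m) (+ q) ⟨
      -1ℤ ℤ.* s ℤ.* + φ m ℤ.* + q           ≡⟨ cong (ℤ._* + q) (ℤ.*-assoc -1ℤ s (+ φ m)) ⟩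
      -1ℤ ℤ.* (s ℤ.* + φ m) ℤ.* + q         ∎

  -- For d ∣ n this is μ(d) φ(n) / φ(d), the Ramanujan sum c_n(n / d).
  eigenvalue : ℕ → ℕ → ℚ
  eigenvalue n d = if does (nonSquareFree? d) then 0ℚ else F n d

  eigenvalue-nonSquareFree : ∀ n {d} → NonSquareFree d → eigenvalue n d ≡ 0ℚ
  eigenvalue-nonSquareFree n {d} nsf with nonSquareFree? d
  ... | yes _ = refl
  ... | no sf = contradiction nsf sf

  eigenvalue-squareFree : ∀ n {d} → ¬ NonSquareFree d → eigenvalue n d ≡ F n d
  eigenvalue-squareFree n {d} sf with nonSquareFree? d
  ... | yes nsf = contradiction nsf sf
  ... | no _    = refl

  eigenvalue-scale : ∀ {n n′} k d → φ n′ ≡ k * φ n → eigenvalue n′ d ≡ (+ k ℚ./ 1) ℚ.* eigenvalue n d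
  eigenvalue-scale k d eq with nonSquareFree? d
  ... | yes _ = sym (ℚ.*-zeroʳ (+ k ℚ./ 1))
  ... | no _  = F-scale k d eq

  eigenvalue-flip : ∀ {p m d} → Prime p → .{{NonZero m}} → .{{NonZero d}} → ¬ p ∣ m → ¬ p ∣ d →
                    eigenvalue (p * m) (p * d) ≡ (-1ℤ ℚ./ 1) ℚ.* eigenvalue m d
  eigenvalue-flip {p} {m} {d} p-prime p∤m p∤d with nonSquareFree? d
  ... | yes (r , r-prime , r²∣d) = eigenvalue-nonSquareFree (p * m) (r , r-prime , ∣-trans r²∣d (n∣m*n p))
  ... | no sf = trans (eigenvalue-squareFree (p * m) (sf ∘ nonSquareFree-*⁻ p-prime p∤d))
                      (F-flip p-prime p∤m p∤d)

  squareFree-1 : ¬ NonSquareFree 1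
  squareFree-1 (p , p-prime , p²∣1) = prime∤1 p-prime (∣-trans (m∣m*n (p ℕ.^ 1)) p²∣1)

-- Kronecker products and diagonalisation.

module KroneckerProducts where

  open Determinants
  open import Algebra.Bundles using (CommutativeRing; CommutativeMonoid)
  open import Algebra.Bundles.Raw using (module RawRing)
  import Algebra.Definitions.RawSemiring as RawSemiringDefs
  import Algebra.Properties.Semiring.Sum
  import Algebra.Properties.CommutativeMonoid.Sum
  import Algebra.Properties.CommutativeSemigroup
  open import Data.Fin using (Fin; zero; suc; combine; remQuot; _↑ˡ_; _↑ʳ_)
  import Data.Fin.Properties as Fin
  open import Data.Nat as ℕ using (ℕ; zero; suc)
  open import Data.Product using (_,_; proj₁; proj₂; uncurry)
  open import Data.Vec.Functional using (Vector)
  open import Level using (_⊔_)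
  open import Relation.Binary.PropositionalEquality as ≡ using (_≡_)
  open import Relation.Nullary using (yes; no; contradiction)

  -- Serves two kinds of sums: those in matrix products, under the addition of a ring, and those
  -- over eigenvalues, in the monoid where spectra are evaluated.
  module ProductIndex {c ℓ} (M : CommutativeMonoid c ℓ) where
    open CommutativeMonoid M
    open Algebra.Properties.CommutativeMonoid.Sum M using (sum; sum-cong-≋)

    sum-+ : ∀ k l (f : Vector Carrier (k ℕ.+ l)) → sum f ≈ sum (λ i → f (i ↑ˡ l)) ∙ sum (λ i → f (k ↑ʳ i))
    sum-+ zero    l f = sym (identityˡ _)
    sum-+ (suc k) l f = trans (∙-congˡ (sum-+ k l (λ i → f (suc i)))) (sym (assoc _ _ _))

    sum-combine : ∀ n k (f : Vector Carrier (n ℕ.* k)) → sum f ≈ sum λ (i : Fin n) → sum λ (j : Fin k) → f (combine i j)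
    sum-combine zero    k f = refl
    sum-combine (suc n) k f = trans (sum-+ k (n ℕ.* k) f)
      (∙-congˡ (sum-combine n k (λ i → f (k ↑ʳ i))))

    sum-remQuot : ∀ n k (f : Fin n → Fin k → Carrier) →
                  sum {n ℕ.* k} (λ x → uncurry f (remQuot {n} k x)) ≈ sum λ i → sum λ j → f i j
    sum-remQuot n k f = trans (sum-combine n k (λ x → uncurry f (remQuot {n} k x)))
      (sum-cong-≋ {n} λ i → sum-cong-≋ {k} λ j → reflexive (≡.cong (uncurry f) (Fin.remQuot-combine i j)))

  module Diagonalisations {c ℓ} (R : CommutativeRing c ℓ) where
    open CommutativeRing R hiding (zero)
    open DeterminantTheory R
    open Algebra.Properties.Semiring.Sum semiring
      using (sum-cong-≋; *-distribˡ-sum; *-distribʳ-sum)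
    open RawSemiringDefs (RawRing.rawSemiring rawRing) using () renaming (sum to ∑)
    open ProductIndex +-commutativeMonoid
    open import Relation.Binary.Reasoning.Setoid setoid
    private
      module *C = Algebra.Properties.CommutativeSemigroup *-commutativeSemigroup

    record Diagonalisation {n} (M : Matrix Carrier n) : Set (c ⊔ ℓ) where
      field
        left right  : Matrix Carrier n
        eigenvalues : Vector Carrier n
        inverse     : ∀ i j → (left ⊡ right) i j ≈ δ i j
        diagonal    : ∀ i j → (left ⊡ (M ⊡ right)) i j ≈ eigenvalues i * δ i j

    Diagonalisation-resp : ∀ {n} {M N : Matrix Carrier n} → M ≋ N → Diagonalisation M → Diagonalisation N
    Diagonalisation-resp {M = M} {N} M≋N D = record
      { left        = left
      ; right       = right
      ; eigenvalues = eigenvalues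
      ; inverse     = inverse
      ; diagonal    = λ i j → trans
          (⊡-cong {M = left} {left} {N ⊡ right} {M ⊡ right} (λ _ _ → refl)
            (⊡-cong {M = N} {M} {right} {right} (λ k l → sym (M≋N k l)) (λ _ _ → refl)) i j)
          (diagonal i j)
      }
      where open Diagonalisation D

    -- The hypothesis on `M ⊡ R` says that column `j` of `R` is an eigenvector for `e j`;
    -- multiplication by `L` then leaves the diagonal matrix.
    fromEigenvectors : ∀ {n} {M : Matrix Carrier n} (L R : Matrix Carrier n) (e : Vector Carrier n) →
      L ⊡ R ≋ δ → (∀ i j → (M ⊡ R) i j ≈ R i j * e j) → Diagonalisation M
    fromEigenvectors {M = M} L R e LR≋δ MR≈Re = record
      { left        = L
      ; right       = R
      ; eigenvalues = e
      ; inverse     = LR≋δ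
      ; diagonal    = λ i j → begin
          ∑ (λ k → L i k * (M ⊡ R) k j)
            ≈⟨ sum-cong-≋ (λ k → trans (*-congˡ (MR≈Re k j)) (sym (*-assoc (L i k) (R k j) (e j)))) ⟩
          ∑ (λ k → L i k * R k j * e j)
            ≈⟨ *-distribʳ-sum (e j) (λ k → L i k * R k j) ⟨
          (L ⊡ R) i j * e j
            ≈⟨ *-congʳ (LR≋δ i j) ⟩
          δ i j * e j
            ≈⟨ δ-transport e i j ⟩
          e i * δ i j ∎
      }
      where
      δ-transport : ∀ {n} (e : Vector Carrier n) i j → δ i j * e j ≈ e i * δ i j
      δ-transport e zero    zero    = *-comm _ _
      δ-transport e zero    (suc j) = trans (zeroˡ _) (sym (zeroʳ _))
      δ-transport e (suc i) zero    = trans (zeroˡ _) (sym (zeroʳ _))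
      δ-transport e (suc i) (suc j) = δ-transport (λ k → e (suc k)) i j

    -- The matrix with entry δ (σ i) v at (i , v) has its transpose as a right
    -- inverse, by injectivity of σ.
    unindex : ∀ {n} {M : Matrix Carrier n} (σ : Fin n → Fin n) → (∀ {i j} → σ i ≡ σ j → i ≡ j) →
              Diagonalisation (λ i j → M (σ i) (σ j)) → Diagonalisation M
    unindex {n} {M} σ σ-injective D = record
      { left        = left ⊡ Π
      ; right       = Πᵀ ⊡ right
      ; eigenvalues = eigenvalues
      ; inverse     = λ i j → trans (⊡-assoc left Π (Πᵀ ⊡ right) i j)
          (trans (⊡-cong {M = left} {left} {Π ⊡ (Πᵀ ⊡ right)} {right} (λ _ _ → refl)
            (λ k l → trans (sym (⊡-assoc Π Πᵀ right k l))
              (trans (⊡-cong {M = Π ⊡ Πᵀ} {δ} {right} {right} ΠΠᵀ (λ _ _ → refl) k l) (⊡-identityˡ right k l))) i j)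
            (inverse i j))
      ; diagonal    = λ i j → trans (⊡-assoc left Π (M ⊡ (Πᵀ ⊡ right)) i j)
          (trans (⊡-cong {M = left} {left} {Π ⊡ (M ⊡ (Πᵀ ⊡ right))} {Mσ ⊡ right} (λ _ _ → refl)
            (λ k l → conj k l) i j)
            (diagonal i j))
      }
      where
      open Diagonalisation D
      Π Πᵀ Mσ : Matrix Carrier n
      Π i v  = δ (σ i) v
      Πᵀ v i = δ v (σ i)
      Mσ i j = M (σ i) (σ j)
      ΠΠᵀ : Π ⊡ Πᵀ ≋ δ
      ΠΠᵀ i j = trans (∑-δˡ (σ i) (λ v → δ v (σ j))) (δ-σ i j)
        where
        δ-σ : ∀ i j → δ (σ i) (σ j) ≈ δ i j
        δ-σ i j with i Fin.≟ j
        ... | yes ≡.refl = reflexive (≡.trans (δ-refl (σ i)) (≡.sym (δ-refl i)))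
        ... | no i≢j     = reflexive (≡.trans (δ-≢ λ eq → i≢j (σ-injective eq)) (≡.sym (δ-≢ i≢j)))
      ΠMΠᵀ : Π ⊡ (M ⊡ Πᵀ) ≋ Mσ
      ΠMΠᵀ i j = trans (∑-δˡ (σ i) (λ v → (M ⊡ Πᵀ) v j)) (∑-δʳ (σ j) (M (σ i)))
      conj : Π ⊡ (M ⊡ (Πᵀ ⊡ right)) ≋ Mσ ⊡ right
      conj k l = begin
        (Π ⊡ (M ⊡ (Πᵀ ⊡ right))) k l
          ≈⟨ ⊡-cong {M = Π} {Π} {M ⊡ (Πᵀ ⊡ right)} {(M ⊡ Πᵀ) ⊡ right} (λ _ _ → refl)
               (λ i j → sym (⊡-assoc M Πᵀ right i j)) k l ⟩
        (Π ⊡ ((M ⊡ Πᵀ) ⊡ right)) k l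
          ≈⟨ ⊡-assoc Π (M ⊡ Πᵀ) right k l ⟨
        ((Π ⊡ (M ⊡ Πᵀ)) ⊡ right) k l
          ≈⟨ ⊡-cong {M = Π ⊡ (M ⊡ Πᵀ)} {Mσ} {right} {right} ΠMΠᵀ (λ _ _ → refl) k l ⟩
        (Mσ ⊡ right) k l ∎

    module _ {m n : ℕ} where

      kron : Matrix Carrier m → Matrix Carrier n → Matrix Carrier (m ℕ.* n)
      kron A B x y = A (proj₁ (remQuot {m} n x)) (proj₁ (remQuot {m} n y))
                   * B (proj₂ (remQuot {m} n x)) (proj₂ (remQuot {m} n y))

      kron-cong : ∀ {A A′ : Matrix Carrier m} {B B′ : Matrix Carrier n} →
                  A ≋ A′ → B ≋ B′ → kron A B ≋ kron A′ B′
      kron-cong A≋A′ B≋B′ x y = *-cong (A≋A′ _ _) (B≋B′ _ _)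

      -- The mixed-product rule: after regrouping, the double sum over pairs of indices factorises.
      kron-⊡ : ∀ (A C : Matrix Carrier m) (B D : Matrix Carrier n) →
               kron A B ⊡ kron C D ≋ kron (A ⊡ C) (B ⊡ D)
      kron-⊡ A C B D x y = begin
        ∑ (λ z → A i (proj₁ (remQuot {m} n z)) * B j (proj₂ (remQuot {m} n z)) *
                 (C (proj₁ (remQuot {m} n z)) k * D (proj₂ (remQuot {m} n z)) l))
          ≈⟨ sum-remQuot m n (λ a b → A i a * B j b * (C a k * D b l)) ⟩
        ∑ (λ a → ∑ λ b → A i a * B j b * (C a k * D b l))
          ≈⟨ sum-cong-≋ (λ a → sum-cong-≋ λ b → *C.interchange (A i a) (B j b) (C a k) (D b l)) ⟩
        ∑ (λ a → ∑ λ b → A i a * C a k * (B j b * D b l))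
          ≈⟨ sum-cong-≋ (λ a → *-distribˡ-sum (A i a * C a k) (λ b → B j b * D b l)) ⟨
        ∑ (λ a → A i a * C a k * (B ⊡ D) j l)
          ≈⟨ *-distribʳ-sum ((B ⊡ D) j l) (λ a → A i a * C a k) ⟨
        (A ⊡ C) i k * (B ⊡ D) j l ∎
        where
        i = proj₁ (remQuot {m} n x)
        j = proj₂ (remQuot {m} n x)
        k = proj₁ (remQuot {m} n y)
        l = proj₂ (remQuot {m} n y)

      remQuot-injective : ∀ {x y} → proj₁ (remQuot {m} n x) ≡ proj₁ (remQuot {m} n y) →
                          proj₂ (remQuot {m} n x) ≡ proj₂ (remQuot {m} n y) → x ≡ y
      remQuot-injective {x} {y} eq₁ eq₂ = ≡.trans (≡.sym (Fin.combine-remQuot {m} n x))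
        (≡.trans (≡.cong₂ combine eq₁ eq₂) (Fin.combine-remQuot {m} n y))

      kron-δ : kron δ δ ≋ δ
      kron-δ x y with x Fin.≟ y
      ... | yes ≡.refl = trans
        (*-cong (reflexive (δ-refl (proj₁ (remQuot {m} n x)))) (reflexive (δ-refl (proj₂ (remQuot {m} n x)))))
        (trans (*-identityˡ 1#) (reflexive (≡.sym (δ-refl x))))
      ... | no x≢y with proj₁ (remQuot {m} n x) Fin.≟ proj₁ (remQuot {m} n y)
                      | proj₂ (remQuot {m} n x) Fin.≟ proj₂ (remQuot {m} n y)
      ...   | no i≢k | _      = trans (*-congʳ (reflexive (δ-≢ i≢k)))
                                  (trans (zeroˡ _) (reflexive (≡.sym (δ-≢ x≢y))))
      ...   | yes _  | no j≢l = trans (*-congˡ (reflexive (δ-≢ j≢l)))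
                                  (trans (zeroʳ _) (reflexive (≡.sym (δ-≢ x≢y))))
      ...   | yes eq₁ | yes eq₂ = contradiction (remQuot-injective eq₁ eq₂) x≢y

      -- By the mixed-product rule the diagonalising matrices can be tensored as well, and the
      -- eigenvalues multiply in pairs.
      kron-diagonalisation : ∀ {A B} → Diagonalisation A → Diagonalisation B → Diagonalisation (kron A B)
      kron-diagonalisation {A} {B} DA DB = record
        { left        = kron DA.left DB.left
        ; right       = kron DA.right DB.right
        ; eigenvalues = λ x → DA.eigenvalues (proj₁ (remQuot {m} n x)) * DB.eigenvalues (proj₂ (remQuot {m} n x))
        ; inverse     = λ x y → trans (kron-⊡ DA.left DA.right DB.left DB.right x y)
            (trans (kron-cong {DA.left ⊡ DA.right} {δ} {DB.left ⊡ DB.right} {δ} DA.inverse DB.inverse x y) (kron-δ x y))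
        ; diagonal    = λ x y → begin
            (kron DA.left DB.left ⊡ (kron A B ⊡ kron DA.right DB.right)) x y
              ≈⟨ ⊡-cong {M = kron DA.left DB.left} {kron DA.left DB.left}
                   {kron A B ⊡ kron DA.right DB.right} {kron (A ⊡ DA.right) (B ⊡ DB.right)}
                   (λ _ _ → refl) (kron-⊡ A DA.right B DB.right) x y ⟩
            (kron DA.left DB.left ⊡ kron (A ⊡ DA.right) (B ⊡ DB.right)) x y
              ≈⟨ kron-⊡ DA.left (A ⊡ DA.right) DB.left (B ⊡ DB.right) x y ⟩
            kron (DA.left ⊡ (A ⊡ DA.right)) (DB.left ⊡ (B ⊡ DB.right)) x y
              ≈⟨ *-cong (DA.diagonal _ _) (DB.diagonal _ _) ⟩
            _ * _ * (_ * _)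
              ≈⟨ *C.interchange _ _ _ _ ⟩
            _ * _ * (kron δ δ x y)
              ≈⟨ *-congˡ (kron-δ x y) ⟩
            _ * _ * δ x y ∎
        }
        where
        module DA = Diagonalisation DA
        module DB = Diagonalisation DB

-- Coprimality matrices and their factorisation at a prime.

module CoprimalityMatrices where

  open Determinants
  open CharacteristicPolynomials
  open Arithmetic
  open KroneckerProducts
  open import Algebra.Bundles using (CommutativeRing)
  open import Algebra.Bundles.Raw using (module RawRing)
  import Algebra.Definitions.RawSemiring as RawSemiringDefs
  import Algebra.Properties.Semiring.Sum
  open import Data.Bool using (if_then_else_)
  open import Data.Fin as Fin using (Fin; zero; suc; toℕ; remQuot)
  import Data.Fin.Properties as Fin
  open import Data.Integer as ℤ using (ℤ; +_) renaming (∣_∣ to abs)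
  import Data.Integer.Properties as ℤ
  import Data.Integer.Divisibility.Signed as ℤS
  open import Data.Integer.Tactic.RingSolver using (solve-∀)
  open import Data.Nat as ℕ using (ℕ; zero; suc; NonZero)
  import Data.Nat.Properties as ℕ
  open import Data.Nat.Coprimality using (gcd≡1⇒coprime; coprime-divisor)
  open import Data.Nat.Divisibility
  open import Data.Nat.GCD
  open import Data.Nat.Primality using (Prime)
  open import Data.Product using (_,_; proj₁; proj₂)
  open import Data.Rational as ℚ using (ℚ; 0ℚ; 1ℚ)
  import Data.Rational.Properties as ℚ
  import Data.Rational.Unnormalised as ℚᵘ
  import Data.Rational.Unnormalised.Properties as ℚᵘ
  open import Data.Rational.Solver using (module +-*-Solver)
  open import Data.Vec.Functional using (Vector)
  open import Relation.Binary.PropositionalEquality as ≡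
    using (_≡_; refl; sym; trans; cong; cong₂; subst; module ≡-Reasoning)
  open import Relation.Nullary using (¬_; Dec; yes; no; contradiction; ⌊_⌋)

  open ℚMat using (_⊡_; _≋_; δ; δ-refl; δ-≢; ∑-δʳ)
  open Algebra.Properties.Semiring.Sum (CommutativeRing.semiring ℚ.+-*-commutativeRing) using (sum-cong-≋; ∑-distrib-+)
  open RawSemiringDefs (RawRing.rawSemiring ℚ.+-*-rawRing) using () renaming (sum to ∑)
  open Diagonalisations ℚ.+-*-commutativeRing

  suc/1 : ∀ n → + suc n ℚ./ 1 ≡ 1ℚ ℚ.+ + n ℚ./ 1
  suc/1 n = ℚ.toℚᵘ-injective (begin
    ℚ.toℚᵘ (+ suc n ℚ./ 1)                    ≈⟨ ℚ.toℚᵘ-fromℚᵘ (ℚᵘ.mkℚᵘ (+ suc n) 0) ⟩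
    ℚᵘ.mkℚᵘ (+ suc n) 0                       ≈⟨ ℚᵘ.*≡* (cong (ℤ._* + 1) (cong (λ i → + 1 ℤ.+ i) (sym (ℤ.*-identityʳ (+ n))))) ⟩
    ℚ.toℚᵘ 1ℚ ℚᵘ.+ ℚᵘ.mkℚᵘ (+ n) 0            ≈⟨ ℚᵘ.+-congʳ (ℚ.toℚᵘ 1ℚ) (ℚ.toℚᵘ-fromℚᵘ (ℚᵘ.mkℚᵘ (+ n) 0)) ⟨
    ℚ.toℚᵘ 1ℚ ℚᵘ.+ ℚ.toℚᵘ (+ n ℚ./ 1)         ≈⟨ ℚ.toℚᵘ-homo-+ 1ℚ (+ n ℚ./ 1) ⟨
    ℚ.toℚᵘ (1ℚ ℚ.+ + n ℚ./ 1)                 ∎)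
    where open import Relation.Binary.Reasoning.Setoid ℚᵘ.≃-setoid

  ∑-const : ∀ n c → ∑ {n} (λ _ → c) ≡ (+ n ℚ./ 1) ℚ.* c
  ∑-const zero    c = sym (ℚ.*-zeroˡ c)
  ∑-const (suc n) c = begin
    c ℚ.+ ∑ {n} (λ _ → c)                  ≡⟨ cong (c ℚ.+_) (∑-const n c) ⟩
    c ℚ.+ (+ n ℚ./ 1) ℚ.* c                ≡⟨ cong (ℚ._+ (+ n ℚ./ 1) ℚ.* c) (ℚ.*-identityˡ c) ⟨
    1ℚ ℚ.* c ℚ.+ (+ n ℚ./ 1) ℚ.* c         ≡⟨ ℚ.*-distribʳ-+ c 1ℚ (+ n ℚ./ 1) ⟨
    (1ℚ ℚ.+ + n ℚ./ 1) ℚ.* c               ≡⟨ cong (ℚ._* c) (suc/1 n) ⟨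
    (+ suc n ℚ./ 1) ℚ.* c                  ∎
    where open ≡-Reasoning

  -- The all-ones vector and the differences e_k − e_0 are eigenvectors of every
  -- combination of the identity and the all-ones matrix.
  module AllOnes (q : ℕ) where
    private
      r N : ℚ
      r = + 1 ℚ./ suc q
      N = + suc q ℚ./ 1

      N*r≡1 : N ℚ.* r ≡ 1ℚ
      N*r≡1 = trans (sym (*-/ (+ suc q) (+ 1) (suc q)))
        (trans (ℚ./-cong {+ suc q ℤ.* + 1} {suc q} {+ 1 ℤ.* + suc q} {suc q ℕ.* 1}
                 (ℤ.*-comm (+ suc q) (+ 1)) (sym (ℕ.*-identityʳ (suc q))))
               (*-cancel-/ (+ 1) (suc q) 1))

      -- The columns of `R` are the eigenvectors. `L` reads off coordinates in this basis: the mean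
      -- of a vector, and the deviation of its entry `suc k` from the mean; hence the constant 1 /
      -- (q + 1).
      L R : Matrix ℚ (suc q)
      L zero    j = r
      L (suc k) j = δ (suc k) j ℚ.- r
      R i zero    = 1ℚ
      R i (suc l) = δ i (suc l) ℚ.- δ i zero

      ∑-*1 : (c : Vector ℚ (suc q)) → ∑ (λ j → c j ℚ.* R j zero) ≡ ∑ c
      ∑-*1 c = sum-cong-≋ {suc q} {λ j → c j ℚ.* R j zero} {c} λ j → ℚ.*-identityʳ (c j)

      ∑-*difference : (c : Vector ℚ (suc q)) (l : Fin q) →
                      ∑ (λ j → c j ℚ.* R j (suc l)) ≡ c (suc l) ℚ.- c zero
      ∑-*difference c l = begin
        ∑ (λ j → c j ℚ.* R j (suc l))
          ≡⟨ sum-cong-≋ expand ⟩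
        ∑ (λ j → c j ℚ.* δ j (suc l) ℚ.+ ℚ.- c j ℚ.* δ j zero)
          ≡⟨ ∑-distrib-+ (λ j → c j ℚ.* δ j (suc l)) (λ j → ℚ.- c j ℚ.* δ j zero) ⟩
        ∑ (λ j → c j ℚ.* δ j (suc l)) ℚ.+ ∑ (λ j → ℚ.- c j ℚ.* δ j zero)
          ≡⟨ cong₂ ℚ._+_ (∑-δʳ (suc l) c) (∑-δʳ zero (λ j → ℚ.- c j)) ⟩
        c (suc l) ℚ.- c zero ∎
        where
        open ≡-Reasoning
        open +-*-Solver
        expand : ∀ j → c j ℚ.* R j (suc l) ≡ c j ℚ.* δ j (suc l) ℚ.+ ℚ.- c j ℚ.* δ j zero
        expand j = solve 3 (λ a x y → a :* (x :- y) := a :* x :+ (:- a) :* y) refl (c j) (δ j (suc l)) (δ j zero)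

      ∑-δ₁ : (k : Fin (suc q)) → ∑ (δ k) ≡ 1ℚ
      ∑-δ₁ k = trans (sum-cong-≋ {suc q} {δ k} {λ j → δ k j ℚ.* 1ℚ} λ j → sym (ℚ.*-identityʳ (δ k j)))
                     (ℚMat.∑-δˡ k (λ _ → 1ℚ))

      LR≋δ : L ⊡ R ≋ δ
      LR≋δ zero    zero    = trans (∑-*1 (λ _ → r)) (trans (∑-const (suc q) r) N*r≡1)
      LR≋δ zero    (suc l) = trans (∑-*difference (λ _ → r) l) (ℚ.+-inverseʳ r)
      LR≋δ (suc k) zero    = begin
        ∑ (λ j → L (suc k) j ℚ.* R j zero)
          ≡⟨ ∑-*1 (L (suc k)) ⟩
        ∑ (λ j → δ (suc k) j ℚ.- r)
          ≡⟨ ∑-distrib-+ (δ (suc k)) (λ _ → ℚ.- r) ⟩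
        ∑ (δ (suc k)) ℚ.+ ∑ {suc q} (λ _ → ℚ.- r)
          ≡⟨ cong₂ ℚ._+_ (∑-δ₁ (suc k)) (∑-const (suc q) (ℚ.- r)) ⟩
        1ℚ ℚ.+ N ℚ.* ℚ.- r
          ≡⟨ cong (1ℚ ℚ.+_) (trans (sym (ℚ.neg-distribʳ-* N r)) (cong ℚ.-_ N*r≡1)) ⟩
        0ℚ ∎
        where open ≡-Reasoning
      LR≋δ (suc k) (suc l) = trans (∑-*difference (L (suc k)) l)
        (solve 2 (λ x y → (x :- y) :- (con 0ℚ :- y) := x) refl (δ k l) r)
        where open +-*-Solver

      NR : Fin (suc q) → ℚ
      NR zero    = N
      NR (suc _) = 0ℚ

      JR : ∀ i j → ((λ _ _ → 1ℚ) ⊡ R) i j ≡ R i j ℚ.* NR j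
      JR i zero    = trans (∑-*1 (λ _ → 1ℚ)) (trans (∑-const (suc q) 1ℚ) (ℚ.*-comm N 1ℚ))
      JR i (suc l) = trans (∑-*difference (λ _ → 1ℚ) l) (sym (ℚ.*-zeroʳ (R i (suc l))))

    J-values I-values : Fin (suc q) → ℚ
    J-values zero    = + suc q ℚ./ 1
    J-values (suc _) = 0ℚ
    I-values zero    = + q ℚ./ 1
    I-values (suc _) = ℤ.-1ℤ ℚ./ 1

    J : Diagonalisation {suc q} (λ _ _ → 1ℚ)
    J = fromEigenvectors L R J-values LR≋δ λ where
      i zero    → JR i zero
      i (suc l) → JR i (suc l)

    J-I : Diagonalisation {suc q} (λ i j → 1ℚ ℚ.- δ i j)
    J-I = fromEigenvectors L R I-values LR≋δ eigen
      where
      open ≡-Reasoning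
      split : ∀ i j k → (1ℚ ℚ.- δ i k) ℚ.* R k j ≡ 1ℚ ℚ.* R k j ℚ.+ δ i k ℚ.* ℚ.- R k j
      split i j k = solve 2 (λ x y → (con 1ℚ :- x) :* y := con 1ℚ :* y :+ x :* (:- y)) refl (δ i k) (R k j)
        where open +-*-Solver
      shifted : ∀ j → NR j ℚ.- 1ℚ ≡ I-values j
      shifted zero    = trans (cong (ℚ._- 1ℚ) (suc/1 q))
        (solve 1 (λ x → con 1ℚ :+ x :- con 1ℚ := x) refl (+ q ℚ./ 1))
        where open +-*-Solver
      shifted (suc _) = refl
      eigen : ∀ i j → ((λ i j → 1ℚ ℚ.- δ i j) ⊡ R) i j ≡ R i j ℚ.* I-values j
      eigen i j = begin
        ∑ (λ k → (1ℚ ℚ.- δ i k) ℚ.* R k j)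
          ≡⟨ sum-cong-≋ (split i j) ⟩
        ∑ (λ k → 1ℚ ℚ.* R k j ℚ.+ δ i k ℚ.* ℚ.- R k j)
          ≡⟨ ∑-distrib-+ (λ k → 1ℚ ℚ.* R k j) (λ k → δ i k ℚ.* ℚ.- R k j) ⟩
        ∑ (λ k → 1ℚ ℚ.* R k j) ℚ.+ ∑ (λ k → δ i k ℚ.* ℚ.- R k j)
          ≡⟨ cong₂ ℚ._+_ (JR i j) (ℚMat.∑-δˡ i (λ k → ℚ.- R k j)) ⟩
        R i j ℚ.* NR j ℚ.- R i j
          ≡⟨ solve 2 (λ x y → x :* y :- x := x :* (y :- con 1ℚ)) refl (R i j) (NR j) ⟩
        R i j ℚ.* (NR j ℚ.- 1ℚ)
          ≡⟨ cong (R i j ℚ.*_) (shifted j) ⟩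
        R i j ℚ.* I-values j ∎
        where open +-*-Solver

  difference : ∀ {k} → (Fin k → ℕ) → Fin k → Fin k → ℤ
  difference ρ i j = + ρ i ℤ.- + ρ j

  -- Rows carry natural numbers `ρ i`, of which only the residues modulo `n` count. For suitable
  -- labels the Kronecker factorisation holds entry by entry, without a permutation of indices.
  coprimalityMatrix : ∀ {k} → (Fin k → ℕ) → ℕ → Matrix ℚ k
  coprimalityMatrix ρ n i j = if ⌊ gcd (abs (difference ρ i j)) n ℕ.≟ 1 ⌋ then 1ℚ else 0ℚ

  indicator-yes : ∀ {a} {P : Set a} (P? : Dec P) → P → (if ⌊ P? ⌋ then 1ℚ else 0ℚ) ≡ 1ℚ
  indicator-yes (yes _) p = refl
  indicator-yes (no ¬p) p = contradiction p ¬p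

  indicator-no : ∀ {a} {P : Set a} (P? : Dec P) → ¬ P → (if ⌊ P? ⌋ then 1ℚ else 0ℚ) ≡ 0ℚ
  indicator-no (yes p) ¬p = contradiction p ¬p
  indicator-no (no _)  ¬p = refl

  indicator-cong : ∀ {a b} {P : Set a} {Q : Set b} (P? : Dec P) (Q? : Dec Q) → (P → Q) → (Q → P) →
                   (if ⌊ P? ⌋ then 1ℚ else 0ℚ) ≡ (if ⌊ Q? ⌋ then 1ℚ else 0ℚ)
  indicator-cong P? (yes q) P⇒Q Q⇒P = indicator-yes P? (Q⇒P q)
  indicator-cong P? (no ¬q) P⇒Q Q⇒P = indicator-no P? (λ p → ¬q (P⇒Q p))

  ∣-shift⁺ : ∀ {d} m α γ → d ∣ m → d ∣ abs γ → d ∣ abs (+ m ℤ.* α ℤ.+ γ)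
  ∣-shift⁺ {d} m α γ d∣m d∣γ = ℤS.∣⇒∣ᵤ {+ d} (ℤS.∣m∣n⇒∣m+n
    (ℤS.∣m⇒∣m*n {+ d} {+ m} α (ℤS.∣ᵤ⇒∣ d∣m)) (ℤS.∣ᵤ⇒∣ {+ d} {γ} d∣γ))

  ∣-shift⁻ : ∀ {d} m α γ → d ∣ m → d ∣ abs (+ m ℤ.* α ℤ.+ γ) → d ∣ abs γ
  ∣-shift⁻ {d} m α γ d∣m d∣ = ℤS.∣⇒∣ᵤ {+ d} (ℤS.∣m+n∣m⇒∣n {+ d} {+ m ℤ.* α}
    (ℤS.∣ᵤ⇒∣ d∣) (ℤS.∣m⇒∣m*n {+ d} {+ m} α (ℤS.∣ᵤ⇒∣ d∣m)))

  gcd-shift : ∀ m α γ → gcd (abs (+ m ℤ.* α ℤ.+ γ)) m ≡ gcd (abs γ) m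
  gcd-shift m α γ = ∣-antisym
    (gcd-greatest (∣-shift⁻ m α γ (gcd[m,n]∣n (abs z) m) (gcd[m,n]∣m (abs z) m)) (gcd[m,n]∣n (abs z) m))
    (gcd-greatest (∣-shift⁺ m α γ (gcd[m,n]∣n (abs γ) m) (gcd[m,n]∣m (abs γ) m)) (gcd[m,n]∣n (abs γ) m))
    where z = + m ℤ.* α ℤ.+ γ

  -- Two numbers below `p` differ by less than `p`, so divisibility forces the difference to be
  -- zero.
  ∣difference⇒≡ : ∀ {p} (a a′ : Fin p) → p ∣ abs (+ toℕ a ℤ.- + toℕ a′) → a ≡ a′
  ∣difference⇒≡ {p} a a′ p∣ = go (abs (+ toℕ a ℤ.- + toℕ a′)) refl p∣
    where
    small : abs (+ toℕ a ℤ.- + toℕ a′) ℕ.< p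
    small = ℕ.≤-<-trans (subst (λ i → abs i ℕ.≤ toℕ a ℕ.⊔ toℕ a′) (sym (ℤ.m-n≡m⊖n (toℕ a) (toℕ a′)))
      (ℤ.∣m⊝n∣≤m⊔n (toℕ a) (toℕ a′))) (ℕ.⊔-lub (Fin.toℕ<n a) (Fin.toℕ<n a′))
    go : ∀ d → abs (+ toℕ a ℤ.- + toℕ a′) ≡ d → p ∣ d → a ≡ a′
    go zero    eq _   = Fin.toℕ-injective (ℤ.+-injective (ℤ.i-j≡0⇒i≡j _ _ (ℤ.∣i∣≡0⇒i≡0 eq)))
    go (suc d) eq p∣d = contradiction (∣⇒≤ p∣d) (ℕ.<⇒≱ (subst (ℕ._< p) eq small))

  ≡⇒∣difference : ∀ {k} n (ρ : Fin k → ℕ) {i j} → i ≡ j → n ∣ abs (difference ρ i j)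
  ≡⇒∣difference n ρ {i} refl = subst (λ z → n ∣ abs z) (sym (ℤ.+-inverseʳ (+ ρ i))) (n ∣0)

  InjectiveModulo : ∀ {k} → ℕ → (Fin k → ℕ) → Set
  InjectiveModulo n ρ = ∀ {i j} → n ∣ abs (difference ρ i j) → i ≡ j

  difference-combination : ∀ k l x x′ y y′ →
    + (k ℕ.* x ℕ.+ l ℕ.* y) ℤ.- + (k ℕ.* x′ ℕ.+ l ℕ.* y′) ≡
    + k ℤ.* (+ x ℤ.- + x′) ℤ.+ + l ℤ.* (+ y ℤ.- + y′)
  difference-combination k l x x′ y y′ = trans
    (cong₂ ℤ._-_ (cast x y) (cast x′ y′))
    (rearrange (+ k) (+ l) (+ x) (+ x′) (+ y) (+ y′))
    where
    cast : ∀ x y → + (k ℕ.* x ℕ.+ l ℕ.* y) ≡ + k ℤ.* + x ℤ.+ + l ℤ.* + y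
    cast x y = trans (ℤ.pos-+ (k ℕ.* x) (l ℕ.* y)) (cong₂ ℤ._+_ (ℤ.pos-* k x) (ℤ.pos-* l y))
    rearrange : ∀ k l x x′ y y′ →
      k ℤ.* x ℤ.+ l ℤ.* y ℤ.- (k ℤ.* x′ ℤ.+ l ℤ.* y′) ≡ k ℤ.* (x ℤ.- x′) ℤ.+ l ℤ.* (y ℤ.- y′)
    rearrange = solve-∀

  module _ {p m : ℕ} (p-prime : Prime p) (ρ : Fin m → ℕ) (ρ-injective : InjectiveModulo m ρ) where

    private
      quot : Fin (p ℕ.* m) → Fin p
      quot x = proj₁ (remQuot {p} m x)
      rem : Fin (p ℕ.* m) → Fin m
      rem x = proj₂ (remQuot {p} m x)
      α : Fin (p ℕ.* m) → Fin (p ℕ.* m) → ℤ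
      α x y = + toℕ (quot x) ℤ.- + toℕ (quot y)
      β : Fin (p ℕ.* m) → Fin (p ℕ.* m) → ℤ
      β x y = difference ρ (rem x) (rem y)

    -- The labelling m a + l ρ(b) of the pairs (a , b): with l = p it is the
    -- Chinese remainder isomorphism up to units, with l = 1 it refines residues
    -- modulo m to residues modulo p m.
    extend : ℕ → Fin (p ℕ.* m) → ℕ
    extend l x = m ℕ.* toℕ (quot x) ℕ.+ l ℕ.* ρ (rem x)

    difference-extend : ∀ l x y → difference (extend l) x y ≡ + m ℤ.* α x y ℤ.+ + l ℤ.* β x y
    difference-extend l x y = difference-combination m l (toℕ (quot x)) (toℕ (quot y)) (ρ (rem x)) (ρ (rem y))

    module _ (p∤m : ¬ p ∣ m) where
      private
        Δ : ∀ x y → ℤ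
        Δ x y = + m ℤ.* α x y ℤ.+ + p ℤ.* β x y

        -- Modulo `p` only m α remains of `Δ`, and `m` is invertible there. Modulo `m` only p β
        -- remains, which `gcd-Δ` exploits.
        p∣Δ⇒≡ : ∀ x y → p ∣ abs (Δ x y) → quot x ≡ quot y
        p∣Δ⇒≡ x y p∣Δ = ∣difference⇒≡ (quot x) (quot y)
          (coprime-divisor (gcd≡1⇒coprime (prime∤⇒gcd≡1 p-prime p∤m)) (subst (p ∣_) (ℤ.abs-* (+ m) (α x y))
            (∣-shift⁻ p (β x y) (+ m ℤ.* α x y) ∣-refl
              (subst (λ z → p ∣ abs z) (ℤ.+-comm (+ m ℤ.* α x y) (+ p ℤ.* β x y)) p∣Δ))))

        ≡⇒p∣Δ : ∀ x y → quot x ≡ quot y → p ∣ abs (Δ x y)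
        ≡⇒p∣Δ x y eq = subst (λ z → p ∣ abs z) (ℤ.+-comm (+ p ℤ.* β x y) (+ m ℤ.* α x y))
          (∣-shift⁺ p (β x y) (+ m ℤ.* α x y) ∣-refl (subst (p ∣_) (sym (ℤ.abs-* (+ m) (α x y)))
            (∣-trans (≡⇒∣difference p toℕ eq) (n∣m*n m))))

        gcd-Δ : ∀ x y → gcd (abs (Δ x y)) m ≡ gcd (p ℕ.* abs (β x y)) m
        gcd-Δ x y = trans (gcd-shift m (α x y) (+ p ℤ.* β x y)) (cong (λ k → gcd k m) (ℤ.abs-* (+ p) (β x y)))

      extend-injective-∤ : InjectiveModulo (p ℕ.* m) (extend p)
      extend-injective-∤ {x} {y} pm∣ = remQuot-injective (p∣Δ⇒≡ x y (∣-trans (m∣m*n m) pm∣Δ))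
        (ρ-injective (coprime-divisor
          (gcd≡1⇒coprime (trans (gcd-comm m p) (prime∤⇒gcd≡1 p-prime p∤m)))
          (subst (m ∣_) (ℤ.abs-* (+ p) (β x y)) (∣-shift⁻ m (α x y) (+ p ℤ.* β x y) ∣-refl (∣-trans (n∣m*n p) pm∣Δ)))))
        where pm∣Δ = subst (λ z → p ℕ.* m ∣ abs z) (difference-extend p x y) pm∣

      -- Prime to `p * m` means prime to `p` and to `m`. For `Δ` the first says that the components
      -- in `Fin p` differ, an entry of J - I; the second says that β is prime to `m`, because `p`
      -- is a unit modulo `m`.
      coprimalityMatrix-∤ : kron {p} {m} (λ i j → 1ℚ ℚ.- δ i j) (coprimalityMatrix ρ m) ≋
                            coprimalityMatrix (extend p) (p ℕ.* m)
      coprimalityMatrix-∤ x y = trans (entry (quot x Fin.≟ quot y))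
        (cong (λ z → if ⌊ gcd (abs z) (p ℕ.* m) ℕ.≟ 1 ⌋ then 1ℚ else 0ℚ) (sym (difference-extend p x y)))
        where
        b? = gcd (abs (β x y)) m ℕ.≟ 1
        d? = gcd (abs (Δ x y)) (p ℕ.* m) ℕ.≟ 1
        entry : Dec (quot x ≡ quot y) →
                (1ℚ ℚ.- δ (quot x) (quot y)) ℚ.* (if ⌊ b? ⌋ then 1ℚ else 0ℚ) ≡ (if ⌊ d? ⌋ then 1ℚ else 0ℚ)
        entry (yes eq) = begin
          (1ℚ ℚ.- δ (quot x) (quot y)) ℚ.* (if ⌊ b? ⌋ then 1ℚ else 0ℚ)
            ≡⟨ cong (λ z → (1ℚ ℚ.- z) ℚ.* (if ⌊ b? ⌋ then 1ℚ else 0ℚ))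
                 (trans (cong (δ (quot x)) (sym eq)) (δ-refl (quot x))) ⟩
          0ℚ ℚ.* (if ⌊ b? ⌋ then 1ℚ else 0ℚ)
            ≡⟨ ℚ.*-zeroˡ (if ⌊ b? ⌋ then 1ℚ else 0ℚ) ⟩
          0ℚ
            ≡⟨ indicator-no d? (λ d≡1 → proj₁ (gcd[t,p*m]≡1⁻ p-prime (abs (Δ x y)) m d≡1) (≡⇒p∣Δ x y eq)) ⟨
          (if ⌊ d? ⌋ then 1ℚ else 0ℚ) ∎
          where open ≡-Reasoning
        entry (no neq) = begin
          (1ℚ ℚ.- δ (quot x) (quot y)) ℚ.* (if ⌊ b? ⌋ then 1ℚ else 0ℚ)
            ≡⟨ cong (λ z → (1ℚ ℚ.- z) ℚ.* (if ⌊ b? ⌋ then 1ℚ else 0ℚ)) (δ-≢ neq) ⟩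
          1ℚ ℚ.* (if ⌊ b? ⌋ then 1ℚ else 0ℚ)
            ≡⟨ ℚ.*-identityˡ _ ⟩
          (if ⌊ b? ⌋ then 1ℚ else 0ℚ)
            ≡⟨ indicator-cong b? d?
                 (λ b≡1 → gcd[t,p*m]≡1⁺ p-prime (abs (Δ x y)) m (λ p∣Δ → neq (p∣Δ⇒≡ x y p∣Δ))
                   (trans (gcd-Δ x y) (gcd[p*s,m]≡1⁺ p-prime (abs (β x y)) m p∤m b≡1)))
                 (λ d≡1 → gcd[p*s,m]≡1⁻ p-prime (abs (β x y)) m
                   (trans (sym (gcd-Δ x y)) (proj₂ (gcd[t,p*m]≡1⁻ p-prime (abs (Δ x y)) m d≡1)))) ⟩
          (if ⌊ d? ⌋ then 1ℚ else 0ℚ) ∎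
          where open ≡-Reasoning

    module _ (p∣m : p ∣ m) .{{_ : NonZero m}} where
      private
        Δ : ∀ x y → ℤ
        Δ x y = + m ℤ.* α x y ℤ.+ + 1 ℤ.* β x y

        gcd-Δ : ∀ x y → gcd (abs (Δ x y)) m ≡ gcd (abs (β x y)) m
        gcd-Δ x y = trans (gcd-shift m (α x y) (+ 1 ℤ.* β x y)) (cong (λ z → gcd (abs z) m) (ℤ.*-identityˡ (β x y)))

      -- Reduction modulo `m` identifies the second components. Their labels are then equal, so β is
      -- zero and not just divisible by `m`; cancelling `m` leaves that `p` divides α.
      extend-injective-∣ : InjectiveModulo (p ℕ.* m) (extend 1)
      extend-injective-∣ {x} {y} pm∣ = remQuot-injective
        (∣difference⇒≡ (quot x) (quot y) (*-cancelˡ-∣ m (subst₂ _∣_ (ℕ.*-comm p m) Δ≡mα pm∣Δ))) rem≡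
        where
        open ≡ using (subst₂)
        pm∣Δ = subst (λ z → p ℕ.* m ∣ abs z) (difference-extend 1 x y) pm∣
        rem≡ : rem x ≡ rem y
        rem≡ = ρ-injective (subst (λ z → m ∣ abs z) (ℤ.*-identityˡ (β x y))
          (∣-shift⁻ m (α x y) (+ 1 ℤ.* β x y) ∣-refl (∣-trans (n∣m*n p) pm∣Δ)))
        β≡0 : β x y ≡ + 0
        β≡0 = trans (cong (λ b → + ρ (rem x) ℤ.- + ρ b) (sym rem≡)) (ℤ.+-inverseʳ (+ ρ (rem x)))
        Δ≡mα : abs (Δ x y) ≡ m ℕ.* abs (α x y)
        Δ≡mα = trans (cong (λ z → abs (+ m ℤ.* α x y ℤ.+ + 1 ℤ.* z)) β≡0)
          (trans (cong abs (ℤ.+-identityʳ (+ m ℤ.* α x y))) (ℤ.abs-* (+ m) (α x y)))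

      -- As `p` divides `m`, a number prime to `m` is prime to `p * m`, and `Δ` agrees with β modulo
      -- `m`; the entry is thus independent of the first components, as J requires.
      coprimalityMatrix-∣ : kron {p} {m} (λ _ _ → 1ℚ) (coprimalityMatrix ρ m) ≋
                            coprimalityMatrix (extend 1) (p ℕ.* m)
      coprimalityMatrix-∣ x y = begin
        1ℚ ℚ.* (if ⌊ b? ⌋ then 1ℚ else 0ℚ)
          ≡⟨ ℚ.*-identityˡ _ ⟩
        (if ⌊ b? ⌋ then 1ℚ else 0ℚ)
          ≡⟨ indicator-cong b? d?
               (λ b≡1 → gcd[t,p*m]≡1⁺ p-prime (abs (Δ x y)) m (p∤Δ b≡1) (trans (gcd-Δ x y) b≡1))
               (λ d≡1 → trans (sym (gcd-Δ x y)) (proj₂ (gcd[t,p*m]≡1⁻ p-prime (abs (Δ x y)) m d≡1))) ⟩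
        (if ⌊ d? ⌋ then 1ℚ else 0ℚ)
          ≡⟨ cong (λ z → if ⌊ gcd (abs z) (p ℕ.* m) ℕ.≟ 1 ⌋ then 1ℚ else 0ℚ) (difference-extend 1 x y) ⟨
        coprimalityMatrix (extend 1) (p ℕ.* m) x y ∎
        where
        open ≡-Reasoning
        b? = gcd (abs (β x y)) m ℕ.≟ 1
        d? = gcd (abs (Δ x y)) (p ℕ.* m) ℕ.≟ 1
        p∤Δ : gcd (abs (β x y)) m ≡ 1 → ¬ p ∣ abs (Δ x y)
        p∤Δ b≡1 p∣Δ = prime∤1 p-prime (subst (p ∣_) (trans (gcd-Δ x y) b≡1) (gcd-greatest p∣Δ p∣m))

-- Spectra by recursion over the prime factors.

module UnitaryCayleyGraphs where

  open Determinants
  open PolynomialRing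
  open CharacteristicPolynomials
  open Arithmetic
  open KroneckerProducts
  open CoprimalityMatrices
  open import Algebra.Bundles using (CommutativeMonoid; Group)
  import Algebra.Properties.CommutativeMonoid.Mult
  import Algebra.Properties.CommutativeMonoid.Sum
  import Algebra.Properties.CommutativeSemigroup
  import Algebra.Properties.Monoid.Mult
  import Algebra.Properties.Group
  open import Data.Fin as Fin using (Fin; zero; suc; toℕ; remQuot)
  import Data.Fin.Properties as Fin
  open import Data.Integer as ℤ using (ℤ; +_) renaming (∣_∣ to abs)
  import Data.Integer.Properties as ℤ
  import Data.Integer.Divisibility.Signed as ℤS
  open import Data.List using (List; []; _∷_; _++_; map; foldr; filter; replicate)
  open import Data.List.Membership.Propositional using (_∈_)
  open import Data.List.Membership.Propositional.Properties
    using (∈-filter⁺; ∈-filter⁻; ∈-++⁺ˡ; ∈-++⁺ʳ; ∈-++⁻)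
  open import Data.List.Relation.Binary.Permutation.Propositional as Perm using (_↭_)
  import Data.List.Relation.Binary.Permutation.Propositional.Properties as Perm
  open import Data.List.Relation.Unary.All as All using (All; []; _∷_)
  open import Data.List.Relation.Unary.AllPairs using (_∷_)
  open import Data.List.Relation.Unary.Any using (here; there)
  import Data.List.Relation.Unary.Unique.Propositional.Properties as Unique
  import Data.List.Properties as List
  open import Data.Nat as ℕ using (ℕ; zero; suc; NonZero; _≤_)
  import Data.Nat.Properties as ℕ
  open import Data.Nat.Divisibility
  open import Data.Nat.DivMod using (_%_; m%n<n)
  open import Data.Nat.GCD
  open import Data.Nat.ListAction using (sum; product)
  open import Data.Nat.ListAction.Properties using (sum-++; sum-↭)
  open import Data.Nat.Primality using (Prime; prime⇒nonZero; productOfPrimes≢0)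
  open import Data.Nat.Primality.Factorisation using (factorise; module PrimeFactorisation)
  open import Data.Product using (_×_; _,_; proj₁; proj₂)
  open import Data.Rational as ℚ using (ℚ; 0ℚ; 1ℚ)
  import Data.Rational.Properties as ℚ
  open import Data.Sum using (inj₁; inj₂)
  open import Function.Bundles using (Inverse)
  open import Level using (_⊔_)
  open import Relation.Binary.PropositionalEquality as ≡ using (_≡_; _≢_; cong; subst)
  open import Relation.Nullary using (¬_; Dec; yes; no; contradiction; ¬?; _×-dec_)

  open Diagonalisations ℚ.+-*-commutativeRing

  spectrumOf : ℕ → List ℚ
  spectrumOf n = multiset ((+ φ n ℚ./ 1 , 1) ∷ (0ℚ , sum (map φ (X n))) ∷
    map (λ d → F n d , φ d) (squareFreeDivisors≢1 n))

  module Spectra {c ℓ} (M : CommutativeMonoid c ℓ) where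
    open CommutativeMonoid M
    open Algebra.Properties.CommutativeMonoid.Mult M
      using (×-congʳ; ×-congˡ; ×-homo-+; ×-homo-1; ×-assocˡ; ×-distrib-+) renaming (_×_ to _·_)
    open Algebra.Properties.CommutativeMonoid.Sum M using (sum-replicate; sum-cong-≋) renaming (sum to ∑)
    open Algebra.Properties.CommutativeSemigroup commutativeSemigroup using (x∙yz≈y∙xz)
    open ProductIndex M
    open import Relation.Binary.Reasoning.Setoid setoid

    ⨁ : List ℕ → (ℕ → Carrier) → Carrier
    ⨁ xs f = foldr (λ x y → f x ∙ y) ε xs

    ⨁-cong : ∀ {f g} xs → (∀ {x} → x ∈ xs → f x ≈ g x) → ⨁ xs f ≈ ⨁ xs g
    ⨁-cong []       f≈g = refl
    ⨁-cong (x ∷ xs) f≈g = ∙-cong (f≈g (here ≡.refl)) (⨁-cong xs λ x∈ → f≈g (there x∈))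

    ⨁-++ : ∀ xs ys f → ⨁ (xs ++ ys) f ≈ ⨁ xs f ∙ ⨁ ys f
    ⨁-++ []       ys f = sym (identityˡ _)
    ⨁-++ (x ∷ xs) ys f = trans (∙-congˡ (⨁-++ xs ys f)) (sym (assoc _ _ _))

    ⨁-map : ∀ (h : ℕ → ℕ) xs f → ⨁ (map h xs) f ≈ ⨁ xs (λ x → f (h x))
    ⨁-map h []       f = refl
    ⨁-map h (x ∷ xs) f = ∙-congˡ (⨁-map h xs f)

    ⨁-↭ : ∀ {xs ys} f → xs ↭ ys → ⨁ xs f ≈ ⨁ ys f
    ⨁-↭ f Perm.refl         = refl
    ⨁-↭ f (Perm.prep x p)   = ∙-congˡ (⨁-↭ f p)
    ⨁-↭ f (Perm.swap x y p) = trans (∙-congˡ (∙-congˡ (⨁-↭ f p))) (x∙yz≈y∙xz _ _ _)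
    ⨁-↭ f (Perm.trans p q)  = trans (⨁-↭ f p) (⨁-↭ f q)

    ·-⨁ : ∀ k xs f → k · ⨁ xs f ≈ ⨁ xs (λ x → k · f x)
    ·-⨁ zero []    f = refl
    ·-⨁ (suc k) [] f = trans (identityˡ _) (·-⨁ k [] f)
    ·-⨁ k (x ∷ xs) f = trans (×-distrib-+ (f x) (⨁ xs f) k) (∙-congˡ (·-⨁ k xs f))

    ⨁-· : ∀ (h : ℕ → ℕ) xs y → ⨁ xs (λ x → h x · y) ≈ sum (map h xs) · y
    ⨁-· h []       y = refl
    ⨁-· h (x ∷ xs) y = trans (∙-congˡ (⨁-· h xs y)) (sym (×-homo-+ y (h x) (sum (map h xs))))

    divisorSum : ℕ → (ℚ → Carrier) → Carrier
    divisorSum n g = ⨁ (divisors n) λ d → φ d · g (eigenvalue n d)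

    -- `spectrum` is quantified over `g` because the recursion applies it to `g` composed with a
    -- scaling of ℚ. Being n in number and incongruent modulo `n`, the labels run through all
    -- residues.
    record Model (n : ℕ) : Set (c ⊔ ℓ) where
      field
        label           : Fin n → ℕ
        label-injective : InjectiveModulo n label
        diagonalisation : Diagonalisation (coprimalityMatrix label n)
      open Diagonalisation diagonalisation public
      field
        spectrum : ∀ g → ∑ (λ i → g (eigenvalues i)) ≈ divisorSum n g

    -- Modulo 1 the difference 0 is prime to the modulus, so the matrix is (1), and its eigenvalue
    -- is 1 = μ(1) φ(1) / φ(1).
    model-1 : Model 1
    model-1 = record
      { label           = λ _ → 0
      ; label-injective = λ { {zero} {zero} _ → ≡.refl }
      ; diagonalisation = record
        { left        = ℚMat.δ
        ; right       = ℚMat.δ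
        ; eigenvalues = λ _ → 1ℚ
        ; inverse     = λ { zero zero → ≡.refl }
        ; diagonal    = λ { zero zero → ≡.refl }
        }
      ; spectrum        = λ g → ∙-congʳ (sym (×-homo-1 (g 1ℚ)))
      }

    module _ {p m : ℕ} (p-prime : Prime p) .{{m≢0 : NonZero m}} (model : Model m) where
      open Model model using (label; label-injective; diagonalisation; eigenvalues; spectrum)

      private
        -- `e` stands for the spectrum of the factor of size `suc q`, in which `x` occurs once and
        -- `y` occurs `q` times; each of the `suc q` blocks is an instance of `spectrum` with a
        -- scaled argument.
        ∑-blocks : ∀ q (e : Fin (suc q) → ℚ) (x y : ℚ) → e zero ≡ x → (∀ k → e (suc k) ≡ y) → ∀ (g : ℚ → Carrier) →
          ∑ (λ z → g (e (proj₁ (remQuot {suc q} m z)) ℚ.* eigenvalues (proj₂ (remQuot {suc q} m z)))) ≈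
          divisorSum m (λ v → g (x ℚ.* v)) ∙ q · divisorSum m (λ v → g (y ℚ.* v))
        ∑-blocks q e x y e₀≡x e₊≡y g = begin
          ∑ (λ z → g (e (proj₁ (remQuot {suc q} m z)) ℚ.* eigenvalues (proj₂ (remQuot {suc q} m z))))
            ≈⟨ sum-remQuot (suc q) m (λ a b → g (e a ℚ.* eigenvalues b)) ⟩
          ∑ (λ b → g (e zero ℚ.* eigenvalues b)) ∙ ∑ (λ k → ∑ λ b → g (e (suc k) ℚ.* eigenvalues b))
            ≈⟨ ∙-cong (block zero x e₀≡x) (trans (sum-cong-≋ λ k → block (suc k) y (e₊≡y k)) (sum-replicate q)) ⟩
          divisorSum m (λ v → g (x ℚ.* v)) ∙ q · divisorSum m (λ v → g (y ℚ.* v)) ∎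
          where
          block : ∀ a w → e a ≡ w → ∑ (λ b → g (e a ℚ.* eigenvalues b)) ≈ divisorSum m (λ v → g (w ℚ.* v))
          block a w ≡.refl = spectrum (λ v → g (w ℚ.* v))

      -- The simple eigenvalue p - 1 turns the value for m at d into that for p m at d. The
      -- eigenvalue -1, taken p - 1 times, yields the value at p d, with multiplicity (p - 1) φ(d) =
      -- φ(p d).
      model-∤ : ¬ p ∣ m → Model (p ℕ.* m)
      model-∤ p∤m = go p p-prime p∤m
        where
        -- `p` is generalised afresh so that it can be split as `suc q`, the size for which
        -- `AllOnes` is stated.
        go : ∀ p → Prime p → ¬ p ∣ m → Model (p ℕ.* m)
        go zero      p-prime _   with () ← prime⇒nonZero p-prime
        go p@(suc q) p-prime p∤m = record
          { label           = extend p-prime label label-injective p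
          ; label-injective = extend-injective-∤ p-prime label label-injective p∤m
          ; diagonalisation = Diagonalisation-resp (coprimalityMatrix-∤ p-prime label label-injective p∤m)
                                (kron-diagonalisation (AllOnes.J-I q) diagonalisation)
          ; spectrum        = λ g → begin
              _
                ≈⟨ ∑-blocks q (AllOnes.I-values q) (+ q ℚ./ 1) (ℤ.-1ℤ ℚ./ 1) ≡.refl (λ _ → ≡.refl) g ⟩
              divisorSum m (λ v → g ((+ q ℚ./ 1) ℚ.* v)) ∙ q · divisorSum m (λ v → g ((ℤ.-1ℤ ℚ./ 1) ℚ.* v))
                ≈⟨ ∙-cong (⨁-cong (divisors m) (λ {d} _ → old g d))
                     (trans (·-⨁ q (divisors m) (λ d → φ d · g ((ℤ.-1ℤ ℚ./ 1) ℚ.* eigenvalue m d)))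
                       (⨁-cong (divisors m) (new g))) ⟩
              ⨁ (divisors m) (h g) ∙ ⨁ (divisors m) (λ d → h g (p ℕ.* d))
                ≈⟨ ∙-congˡ (⨁-map (p ℕ.*_) (divisors m) (h g)) ⟨
              ⨁ (divisors m) (h g) ∙ ⨁ (map (p ℕ.*_) (divisors m)) (h g)
                ≈⟨ ⨁-++ (divisors m) (map (p ℕ.*_) (divisors m)) (h g) ⟨
              ⨁ (divisors m ++ map (p ℕ.*_) (divisors m)) (h g)
                ≈⟨ ⨁-↭ (h g) (divisors-∤ p-prime p∤m) ⟨
              divisorSum (p ℕ.* m) g ∎
          }
          where
          h : (ℚ → Carrier) → ℕ → Carrier
          h g d = φ d · g (eigenvalue (p ℕ.* m) d)
          old : ∀ g d → φ d · g ((+ q ℚ./ 1) ℚ.* eigenvalue m d) ≈ h g d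
          old g d = ×-congʳ (φ d) (reflexive (cong g (≡.sym (eigenvalue-scale q d (φ-*-∤ p-prime p∤m)))))
          new : ∀ g {d} → d ∈ divisors m → q · (φ d · g ((ℤ.-1ℤ ℚ./ 1) ℚ.* eigenvalue m d)) ≈ h g (p ℕ.* d)
          new g {d} d∈ = begin
            q · (φ d · g ((ℤ.-1ℤ ℚ./ 1) ℚ.* eigenvalue m d))
              ≈⟨ ×-assocˡ (g ((ℤ.-1ℤ ℚ./ 1) ℚ.* eigenvalue m d)) q (φ d) ⟩
            (q ℕ.* φ d) · g ((ℤ.-1ℤ ℚ./ 1) ℚ.* eigenvalue m d)
              ≈⟨ ×-congˡ (≡.sym (φ-*-∤ p-prime p∤d)) ⟩
            φ (p ℕ.* d) · g ((ℤ.-1ℤ ℚ./ 1) ℚ.* eigenvalue m d)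
              ≈⟨ ×-congʳ (φ (p ℕ.* d)) (reflexive (cong g (≡.sym
                   (eigenvalue-flip p-prime {{m≢0}} {{ℕ.>-nonZero (proj₁ (∈-divisors⁻ m d∈))}} p∤m p∤d)))) ⟩
            h g (p ℕ.* d) ∎
            where
            p∤d : ¬ p ∣ d
            p∤d p∣d = p∤m (∣-trans p∣d (proj₂ (∈-divisors⁻ m d∈)))

      -- The simple eigenvalue p accounts for the divisors of m, since φ(p m) = p φ(m). The
      -- remaining (p - 1) m eigenvalues are zero and fill the divisors of p m that do not divide m.
      model-∣ : p ∣ m → Model (p ℕ.* m)
      model-∣ p∣m = go p p-prime p∣m
        where
        go : ∀ p → Prime p → p ∣ m → Model (p ℕ.* m)
        go zero      p-prime _   with () ← prime⇒nonZero p-prime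
        go p@(suc q) p-prime p∣m = record
          { label           = extend p-prime label label-injective 1
          ; label-injective = extend-injective-∣ p-prime label label-injective p∣m
          ; diagonalisation = Diagonalisation-resp (coprimalityMatrix-∣ p-prime label label-injective p∣m)
                                (kron-diagonalisation (AllOnes.J q) diagonalisation)
          ; spectrum        = λ g → begin
              _
                ≈⟨ ∑-blocks q (AllOnes.J-values q) (+ p ℚ./ 1) 0ℚ ≡.refl (λ _ → ≡.refl) g ⟩
              divisorSum m (λ v → g ((+ p ℚ./ 1) ℚ.* v)) ∙ q · divisorSum m (λ v → g (0ℚ ℚ.* v))
                ≈⟨ ∙-cong (⨁-cong (divisors m) (λ {d} _ → old g d)) (zeros g) ⟩
              ⨁ (divisors m) (h g) ∙ ⨁ newDivisors (h g)
                ≈⟨ ⨁-++ (divisors m) newDivisors (h g) ⟨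
              ⨁ (divisors m ++ newDivisors) (h g)
                ≈⟨ ⨁-↭ (h g) (divisors-∣ p-prime m) ⟨
              divisorSum (p ℕ.* m) g ∎
          }
          where
          newDivisors : List ℕ
          newDivisors = filter (λ d → ¬? (d ∣? m)) (divisors (p ℕ.* m))
          h : (ℚ → Carrier) → ℕ → Carrier
          h g d = φ d · g (eigenvalue (p ℕ.* m) d)
          old : ∀ g d → φ d · g ((+ p ℚ./ 1) ℚ.* eigenvalue m d) ≈ h g d
          old g d = ×-congʳ (φ d) (reflexive (cong g (≡.sym (eigenvalue-scale p d (φ-*-∣ p-prime p∣m)))))
          -- The φ(d) add up to m over the divisors of m and to p m over those of p m, which leaves
          -- (p - 1) m for the new ones.
          count : sum (map φ newDivisors) ≡ q ℕ.* m
          count = ℕ.+-cancelˡ-≡ m _ _ (≡.trans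
            (cong (ℕ._+ sum (map φ newDivisors)) (≡.sym (sum-φ-divisors m)))
            (≡.trans (≡.sym (sum-++ (map φ (divisors m)) (map φ newDivisors)))
            (≡.trans (cong sum (≡.sym (List.map-++ φ (divisors m) newDivisors)))
            (≡.trans (≡.sym (sum-↭ (Perm.map⁺ φ (divisors-∣ p-prime m))))
              (sum-φ-divisors (p ℕ.* m) {{ℕ.m*n≢0 p m}})))))
          zeros : ∀ g → q · divisorSum m (λ v → g (0ℚ ℚ.* v)) ≈ ⨁ newDivisors (h g)
          zeros g = begin
            q · divisorSum m (λ v → g (0ℚ ℚ.* v))
              ≈⟨ ×-congʳ q (⨁-cong (divisors m) λ {d} _ →
                   ×-congʳ (φ d) (reflexive (cong g (ℚ.*-zeroˡ (eigenvalue m d))))) ⟩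
            q · ⨁ (divisors m) (λ d → φ d · g 0ℚ)
              ≈⟨ ×-congʳ q (trans (⨁-· φ (divisors m) (g 0ℚ)) (×-congˡ (sum-φ-divisors m))) ⟩
            q · (m · g 0ℚ)
              ≈⟨ ×-assocˡ (g 0ℚ) q m ⟩
            (q ℕ.* m) · g 0ℚ
              ≈⟨ ×-congˡ (≡.sym count) ⟩
            sum (map φ newDivisors) · g 0ℚ
              ≈⟨ ⨁-· φ newDivisors (g 0ℚ) ⟨
            ⨁ newDivisors (λ d → φ d · g 0ℚ)
              ≈⟨ ⨁-cong newDivisors (λ {d} d∈ → ×-congʳ (φ d) (reflexive (cong g (≡.sym (zero-eigenvalue d∈))))) ⟩
            ⨁ newDivisors (h g) ∎
            where
            zero-eigenvalue : ∀ {d} → d ∈ newDivisors → eigenvalue (p ℕ.* m) d ≡ 0ℚ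
            zero-eigenvalue {d} d∈ = let d∈pm , d∤m = ∈-filter⁻ (λ d → ¬? (d ∣? m)) {xs = divisors (p ℕ.* m)} d∈ in
              eigenvalue-nonSquareFree (p ℕ.* m)
                (new-divisor-nonSquareFree p-prime p∣m (proj₂ (∈-divisors⁻ (p ℕ.* m) d∈pm)) d∤m)

    -- The primes may repeat and come in any order; whether the next one divides the product of
    -- those after it decides between the two steps.
    model-product : ∀ ps → All Prime ps → Model (product ps)
    model-product []       []                 = model-1
    model-product (p ∷ ps) (p-prime ∷ primes) with p ∣? product ps
    ... | yes p∣m = model-∣ p-prime {{productOfPrimes≢0 primes}} (model-product ps primes) p∣m
    ... | no p∤m  = model-∤ p-prime {{productOfPrimes≢0 primes}} (model-product ps primes) p∤m

    model : ∀ n → .{{NonZero n}} → Model n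
    model n = subst Model (≡.sym isFactorisation) (model-product factors factorsPrime)
      where open PrimeFactorisation (factorise n)

    combine-all : (ℚ → Carrier) → List ℚ → Carrier
    combine-all g es = foldr _∙_ ε (map g es)

    combine-replicate : ∀ g k e es → combine-all g (replicate k e ++ es) ≈ k · g e ∙ combine-all g es
    combine-replicate g zero    e es = sym (identityˡ _)
    combine-replicate g (suc k) e es = trans (∙-congˡ (combine-replicate g k e es)) (sym (assoc _ _ _))

    combine-multiset : ∀ g (e : ℕ → ℚ) (k : ℕ → ℕ) ds →
      combine-all g (multiset (map (λ d → e d , k d) ds)) ≈ ⨁ ds (λ d → k d · g (e d))
    combine-multiset g e k []       = refl
    combine-multiset g e k (d ∷ ds) = trans (combine-replicate g (k d) (e d) _)
      (∙-congˡ (combine-multiset g e k ds))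

    -- The divisor 1 stands alone because its value φ(n) is listed separately, and the members of
    -- `X n` stay together because their zeros are gathered into one entry.
    divisors-split : ∀ n → .{{NonZero n}} → divisors n ↭ 1 ∷ X n ++ squareFreeDivisors≢1 n
    divisors-split n = unique-↭ (divisors-unique n)
      (All.tabulate 1≢ ∷ Unique.++⁺ (Unique.filter⁺ nonSquareFree? (divisors-unique n))
        (Unique.filter⁺ squareFree≢1? (divisors-unique n))
        λ (d∈X , d∈S) → proj₁ (S⁻ d∈S) (proj₂ (X⁻ d∈X)))
      split join
      where
      squareFree≢1? : ∀ d → Dec (¬ NonSquareFree d × d ≢ 1)
      squareFree≢1? d = ¬? (nonSquareFree? d) ×-dec ¬? (d ℕ.≟ 1)
      X⁻ : ∀ {d} → d ∈ X n → d ∈ divisors n × NonSquareFree d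
      X⁻ = ∈-filter⁻ nonSquareFree? {xs = divisors n}
      S⁻ : ∀ {d} → d ∈ squareFreeDivisors≢1 n → ¬ NonSquareFree d × d ≢ 1
      S⁻ d∈ = proj₂ (∈-filter⁻ squareFree≢1? {xs = divisors n} d∈)
      1≢ : ∀ {d} → d ∈ X n ++ squareFreeDivisors≢1 n → 1 ≢ d
      1≢ d∈ ≡.refl with ∈-++⁻ (X n) d∈
      ... | inj₁ 1∈X = squareFree-1 (proj₂ (X⁻ 1∈X))
      ... | inj₂ 1∈S = proj₂ (S⁻ 1∈S) ≡.refl
      split : ∀ {d} → d ∈ divisors n → d ∈ 1 ∷ X n ++ squareFreeDivisors≢1 n
      split {d} d∈ with nonSquareFree? d | d ℕ.≟ 1
      ... | yes nsf | _          = there (∈-++⁺ˡ (∈-filter⁺ nonSquareFree? d∈ nsf))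
      ... | no _    | yes ≡.refl = here ≡.refl
      ... | no sf   | no d≢1     = there (∈-++⁺ʳ (X n) (∈-filter⁺ squareFree≢1? d∈ (sf , d≢1)))
      join : ∀ {d} → d ∈ 1 ∷ X n ++ squareFreeDivisors≢1 n → d ∈ divisors n
      join (here ≡.refl) = ∈-divisors⁺ n (1∣ n)
      join (there d∈) with ∈-++⁻ (X n) d∈
      ... | inj₁ d∈X = proj₁ (X⁻ d∈X)
      ... | inj₂ d∈S = proj₁ (∈-filter⁻ squareFree≢1? {xs = divisors n} d∈S)

    divisorSum-multiset : ∀ n → .{{NonZero n}} → ∀ g → divisorSum n g ≈ combine-all g (spectrumOf n)
    divisorSum-multiset n g = begin
      divisorSum n g
        ≈⟨ ⨁-↭ h (divisors-split n) ⟩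
      h 1 ∙ ⨁ (X n ++ squareFreeDivisors≢1 n) h
        ≈⟨ ∙-cong first (trans (⨁-++ (X n) (squareFreeDivisors≢1 n) h) (∙-cong zeros rest)) ⟩
      g (+ φ n ℚ./ 1) ∙ (sum (map φ (X n)) · g 0ℚ ∙ combine-all g (multiset (map (λ d → F n d , φ d) (squareFreeDivisors≢1 n))))
        ≈⟨ ∙-congˡ (combine-replicate g (sum (map φ (X n))) 0ℚ
             (multiset (map (λ d → F n d , φ d) (squareFreeDivisors≢1 n)))) ⟨
      combine-all g (spectrumOf n) ∎
      where
      h : ℕ → Carrier
      h d = φ d · g (eigenvalue n d)
      first : h 1 ≈ g (+ φ n ℚ./ 1)
      first = trans (×-homo-1 _) (reflexive (cong g (≡.trans (eigenvalue-squareFree n squareFree-1)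
        (cong (λ i → i ℚ./ 1) (ℤ.*-identityˡ (+ φ n))))))
      zeros : ⨁ (X n) h ≈ sum (map φ (X n)) · g 0ℚ
      zeros = trans (⨁-cong (X n) λ {d} d∈ → ×-congʳ (φ d) (reflexive (cong g
          (eigenvalue-nonSquareFree n (proj₂ (∈-filter⁻ nonSquareFree? {xs = divisors n} d∈))))))
        (⨁-· φ (X n) (g 0ℚ))
      rest : ⨁ (squareFreeDivisors≢1 n) h ≈ combine-all g (multiset (map (λ d → F n d , φ d) (squareFreeDivisors≢1 n)))
      rest = trans (⨁-cong (squareFreeDivisors≢1 n) λ {d} d∈ → ×-congʳ (φ d) (reflexive (cong g
          (eigenvalue-squareFree n (proj₁ (proj₂ (∈-filter⁻ (λ d → ¬? (nonSquareFree? d) ×-dec ¬? (d ℕ.≟ 1)) {xs = divisors n} d∈)))))))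
        (sym (combine-multiset g (F n) φ (squareFreeDivisors≢1 n)))

  -- Powers of the generator and the adjacency matrix.

  module _ {c ℓ} {G : Group c ℓ} {a : Group.Carrier G} {n : ℕ} (2≤n : 2 ≤ n) (cyc : IsCyclicOfOrder G a n) where
    private
      module G = Group G
    open Unitary G 2≤n cyc
    open IsCyclicOfOrder cyc using (enumeration)
    open Inverse enumeration using (to; from; inverseˡ)
    open Algebra.Properties.Group G using (∙-cancelˡ)
    open Algebra.Properties.Monoid.Mult G.monoid using (×-homo-+; ×-congˡ) renaming (_×_ to _·_)
    open import Relation.Binary.Reasoning.Setoid G.setoid

    private instance
      n-nonZero : NonZero n
      n-nonZero = ℕ.>-nonZero (ℕ.<⇒≤ 2≤n)

    pow : ℕ → G.Carrier
    pow k = k · a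

    -- `n≤m` excludes a positive exponent below `n` with trivial power, so the remainder of `k`
    -- modulo `n` is zero.
    pow≈ε⇒∣ : ∀ k → pow k G.≈ G.ε → n ∣ k
    pow≈ε⇒∣ k aᵏ≈ε = m%n≡0⇒n∣m k n (go (k % n) (m%n<n k n) (G.trans (G.sym (reduce aⁿ≈ε k)) aᵏ≈ε))
      where
      go : ∀ r → r ℕ.< n → pow r G.≈ G.ε → r ≡ 0
      go zero    _   _    = ≡.refl
      go (suc r) r<n aʳ≈ε = contradiction (n≤m {suc r} aʳ≈ε) (ℕ.<⇒≱ r<n)

    pow-≤-cancel : ∀ k l → k ≤ l → pow k G.≈ pow l → n ∣ l ℕ.∸ k
    pow-≤-cancel k l k≤l eq = pow≈ε⇒∣ (l ℕ.∸ k) (∙-cancelˡ (pow k) _ _ (begin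
      pow k G.∙ pow (l ℕ.∸ k)  ≈⟨ ×-homo-+ a k (l ℕ.∸ k) ⟨
      pow (k ℕ.+ (l ℕ.∸ k))    ≈⟨ ×-congˡ (ℕ.m+[n∸m]≡n k≤l) ⟩
      pow l                    ≈⟨ eq ⟨
      pow k                    ≈⟨ G.identityʳ _ ⟨
      pow k G.∙ G.ε            ∎))

    pow≈pow⇒∣ : ∀ k l → pow k G.≈ pow l → n ∣ abs (+ k ℤ.- + l)
    pow≈pow⇒∣ k l eq with ℕ.≤-total k l
    ... | inj₁ k≤l = subst (n ∣_) (≡.sym (≡.trans (cong abs (ℤ.m-n≡m⊖n k l)) (ℤ.∣⊖∣-≤ k≤l))) (pow-≤-cancel k l k≤l eq)
    ... | inj₂ l≤k = subst (n ∣_)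
      (≡.sym (≡.trans (cong abs (ℤ.m-n≡m⊖n k l)) (≡.trans (ℤ.∣m⊖n∣≡∣n⊖m∣ k l) (ℤ.∣⊖∣-≤ l≤k))))
      (pow-≤-cancel l k l≤k (G.sym eq))

    -- The hypothesis makes k - l congruent to i modulo n, and a gcd with n depends on the residue
    -- alone. Comparing the exponents k and i + l keeps all exponents natural.
    gcd-quotient : ∀ k l i → pow k G.∙ pow l G.⁻¹ G.≈ pow i → gcd (abs (+ k ℤ.- + l)) n ≡ gcd i n
    gcd-quotient k l i eq with ℤS.∣ᵤ⇒∣ {+ n} {+ k ℤ.- + (i ℕ.+ l)} (pow≈pow⇒∣ k (i ℕ.+ l) k≈i+l)
      where
      k≈i+l : pow k G.≈ pow (i ℕ.+ l)
      k≈i+l = begin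
        pow k                              ≈⟨ G.identityʳ _ ⟨
        pow k G.∙ G.ε                      ≈⟨ G.∙-congˡ (G.inverseˡ (pow l)) ⟨
        pow k G.∙ (pow l G.⁻¹ G.∙ pow l)   ≈⟨ G.assoc _ _ _ ⟨
        pow k G.∙ pow l G.⁻¹ G.∙ pow l     ≈⟨ G.∙-congʳ eq ⟩
        pow i G.∙ pow l                    ≈⟨ ×-homo-+ a i l ⟨
        pow (i ℕ.+ l)                      ∎
    ... | ℤS.divides z k-i-l≡z*n = ≡.trans (cong (λ w → gcd (abs w) n) k-l≡n*z+i) (gcd-shift n z (+ i))
      where
      open import Data.Integer.Tactic.RingSolver using (solve-∀)
      rearrange : ∀ k i l → k ℤ.- l ≡ k ℤ.- (i ℤ.+ l) ℤ.+ i
      rearrange = solve-∀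
      k-l≡n*z+i : + k ℤ.- + l ≡ + n ℤ.* z ℤ.+ + i
      k-l≡n*z+i = ≡.trans (rearrange (+ k) (+ i) (+ l))
        (cong (ℤ._+ + i) (≡.trans k-i-l≡z*n (ℤ.*-comm z (+ n))))

    S-pow⇒gcd≡1 : ∀ k l → S (pow k G.∙ pow l G.⁻¹) → gcd (abs (+ k ℤ.- + l)) n ≡ 1
    S-pow⇒gcd≡1 k l (i , i∈B , eq) = ≡.trans (gcd-quotient k l i eq) (proj₂ (proj₂ (∈B⁻ {1} {n = n} i∈B)))

    gcd≡1⇒S-pow : ∀ k l → gcd (abs (+ k ℤ.- + l)) n ≡ 1 → S (pow k G.∙ pow l G.⁻¹)
    gcd≡1⇒S-pow k l gcd≡1 = toℕ r , ∈B⁺ (positive (toℕ r) gcd[r,n]≡1) (ℕ.<⇒≤ (Fin.toℕ<n r)) gcd[r,n]≡1 , eq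
      where
      r,eq = residue aⁿ≈ε (pow k G.∙ pow l G.⁻¹)
      r = proj₁ r,eq
      eq = proj₂ r,eq
      gcd[r,n]≡1 : gcd (toℕ r) n ≡ 1
      gcd[r,n]≡1 = ≡.trans (≡.sym (gcd-quotient k l (toℕ r) eq)) gcd≡1
      -- Members of `B 1 n` start at 1; the residue 0 is excluded because gcd(0, n) = n is at least
      -- 2.
      positive : ∀ i → gcd i n ≡ 1 → 1 ≤ i
      positive zero    gcd≡1 = contradiction (≡.trans (≡.sym gcd≡1) (gcd-identityˡ n)) (ℕ.<⇒≢ 2≤n)
      positive (suc i) _     = ℕ.s≤s ℕ.z≤n

    module _ (label : Fin n → ℕ) (label-injective : InjectiveModulo n label) where

      -- The group comes with an arbitrary enumeration; this map sends a row to the position of the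
      -- power of `a` named by its label, and is the permutation handed to `unindex`.
      vertex : Fin n → Fin n
      vertex i = from (pow (label i))

      vertex-injective : ∀ {i j} → vertex i ≡ vertex j → i ≡ j
      vertex-injective {i} {j} eq = label-injective (pow≈pow⇒∣ (label i) (label j) (from-injective eq))

      coprimalityMatrix≋A : ∀ i j → coprimalityMatrix label n i j ≡ A (vertex i) (vertex j)
      coprimalityMatrix≋A i j = indicator-cong
        (gcd (abs (difference label i j)) n ℕ.≟ 1) (S? (to (vertex i) G.∙ to (vertex j) G.⁻¹))
        (λ eq → S-resp (G.sym quotient≈) (gcd≡1⇒S-pow (label i) (label j) eq))
        (λ s → S-pow⇒gcd≡1 (label i) (label j) (S-resp quotient≈ s))
        where
        quotient≈ : to (vertex i) G.∙ to (vertex j) G.⁻¹ G.≈ pow (label i) G.∙ pow (label j) G.⁻¹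
        quotient≈ = G.∙-cong (inverseˡ ≡.refl) (G.⁻¹-cong (inverseˡ ≡.refl))

      A-diagonalisation : Diagonalisation (coprimalityMatrix label n) → Diagonalisation A
      A-diagonalisation D = unindex vertex vertex-injective (Diagonalisation-resp coprimalityMatrix≋A D)

-- The spectrum of the Cayley graph.

open import Algebra.Bundles using (Group)
open import Data.Integer using (+_)
open import Data.List using (_∷_; map)
open import Data.Nat as ℕ using (ℕ; _≤_)
import Data.Nat.Properties as ℕ
open import Data.Nat.ListAction using (sum)
open import Data.Product using (_,_)
open import Data.Rational using (ℚ; 0ℚ; _/_)
open CharacteristicPolynomials
open KroneckerProducts using (module Diagonalisations)
open UnitaryCayleyGraphs

theorem3p1 : ∀ {c ℓ} (n : ℕ) (2≤n : 2 ≤ n)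
    (G : Group c ℓ) (a : Group.Carrier G) (cyc : IsCyclicOfOrder G a n) →
    IsSpectrum (Unitary.A G 2≤n cyc)
    (multiset ((+ φ n / 1 , 1)
    ∷ (0ℚ , sum (map φ (X n)))
    ∷ map (λ d → F n d , φ d) (squareFreeDivisors≢1 n)))
theorem3p1 n 2≤n G a cyc = begin
  charPoly A
    ≈⟨ charPoly-diagonalisable A D.left D.right D.eigenvalues D.inverse D.diagonal ⟩
  ∏ₚ (λ i → linearFactor (D.eigenvalues i))
    ≈⟨ spectrum linearFactor ⟩
  divisorSum n linearFactor
    ≈⟨ divisorSum-multiset n {{n-nonZero}} linearFactor ⟩
  combine-all linearFactor (spectrumOf n) ∎
  where
  -- In the multiplicative monoid of ℚ[x] the sums over eigenvalues become products, and
  -- `combine-all linearFactor` unfolds to the product in `IsSpectrum`.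
  open Spectra P.*-commutativeMonoid
  open Unitary G 2≤n cyc using (A)
  open import Relation.Binary.Reasoning.Setoid P.setoid
  n-nonZero : ℕ.NonZero n
  n-nonZero = ℕ.>-nonZero (ℕ.<⇒≤ 2≤n)
  open Model (model n {{n-nonZero}}) using (label; label-injective; diagonalisation; spectrum)
  module D = Diagonalisations.Diagonalisation
    (A-diagonalisation 2≤n cyc label label-injective diagonalisation)
  linearFactor : ℚ → Poly
  linearFactor e = varₚ +ₚ -ₚ constₚ e
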